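{- Let $G$ be a graph of order $n\ge 3$ and maximum degree $\Delta(G)=2$. Then $\mathcal{A}(G)\le \mathcal{A}(U_n)$, with equality if and only if $G$ is isomorphic to $U_n$, where $U_n=\frac{n}{3}K_3$ if $n\equiv 0 \pmod 3$; $U_n=\frac{n-1}{3}K_3\cup K_1$ if $n=4$ or $n=7$; $U_n=\frac{n-4}{3}K_3\cup C_4$ if $n\equiv 1\pmod 3$ and $n\ge 10$; $U_n=\frac{n-5}{3}K_3\cup C_5$ if $n\equiv 2\pmod 3$ and $n\ge 5$.
   Context: Graphs are finite and simple. For a graph $G$ of order $n$ and an integer $k$, $S(G,k)$ denotes the number of partitions of $V(G)$ into exactly $k$ nonempty stable sets (non-equivalent colorings with exactly $k$ colors). Let $\mathcal{B}(G)=\sum_{k=1}^n S(G,k)$, $\mathcal{T}(G)=\sum_{k=1}^n kS(G,k)$, and $\mathcal{A}(G)=\mathcal{T}(G)/\mathcal{B}(G)$. $G\cup H$ denotes disjoint union, $pH$ the disjoint union of $p$ copies of $H$ ($0H$ is the graph with no vertices), $K_m$ the complete graph and $C_m$ the cycle on $m$ vertices. -}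

module Defs where

open import Data.Nat using (ℕ; zero; suc; _+_; _*_; _∸_; _⊔_; _≡ᵇ_; _%_; _/_)
open import Data.Bool using (Bool; true; false; not; _∧_; _∨_; if_then_else_)
open import Data.Bool.Properties using (∨-comm)
open import Data.Fin using (Fin; toℕ; splitAt; _≟_)
open import Data.Sum using (_⊎_; inj₁; inj₂)
open import Data.Product using (Σ; _×_; _,_; proj₁; proj₂)
open import Data.List using (List; []; _∷_; length; filter; map; concatMap; upTo; allFin; foldr)
open import Data.Nat.ListAction using (sum)
open import Data.Bool.ListAction using (and)
open import Data.Vec using (Vec; []; _∷ʳ_; lookup)
open import Relation.Nullary using (yes; no; ¬_)
open import Relation.Nullary.Decidable using (⌊_⌋)
open import Relation.Binary.PropositionalEquality using (_≡_; refl; sym; cong; cong₂)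
open import Function.Bundles using (_↔_; Inverse)

record Graph : Set where
  field
    order  : ℕ
    adj    : Fin order → Fin order → Bool
    adj-sym    : ∀ i j → adj i j ≡ adj j i
    adj-irrefl : ∀ i → adj i i ≡ false
open Graph public

private
  neq : ∀ {n} → Fin n → Fin n → Bool
  neq i j = not ⌊ i ≟ j ⌋

  neq-sym : ∀ {n} (i j : Fin n) → neq i j ≡ neq j i
  neq-sym i j with i ≟ j | j ≟ i
  ... | yes _ | yes _ = refl
  ... | no _  | no _  = refl
  ... | yes p | no ¬q = Data.Empty.⊥-elim (¬q (sym p))
    where import Data.Empty
  ... | no ¬p | yes q = Data.Empty.⊥-elim (¬p (sym q))
    where import Data.Empty

  neq-refl : ∀ {n} (i : Fin n) → neq i i ≡ false
  neq-refl i with i ≟ i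
  ... | yes _ = refl
  ... | no ¬p = Data.Empty.⊥-elim (¬p refl)
    where import Data.Empty

mkGraph : (n : ℕ) → (Fin n → Fin n → Bool) → Graph
mkGraph n R = record
  { order = n
  ; adj = λ i j → neq i j ∧ (R i j ∨ R j i)
  ; adj-sym = λ i j → cong₂ _∧_ (neq-sym i j) (∨-comm (R i j) (R j i))
  ; adj-irrefl = λ i → cong (_∧ (R i i ∨ R i i)) (neq-refl i)
  }

K : ℕ → Graph
K m = mkGraph m (λ _ _ → true)

-- cycle C_m (vertex i adjacent to i+1 mod m); used for m ≥ 3
C : ℕ → Graph
C m = mkGraph m (λ i j → (suc (toℕ i) ≡ᵇ toℕ j) ∨ ((suc (toℕ i) ≡ᵇ m) ∧ (toℕ j ≡ᵇ 0)))

emptyGraph : Graph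
emptyGraph = mkGraph 0 (λ _ _ → false)

private
  adj⊎ : (G H : Graph) → Fin (order G) ⊎ Fin (order H) → Fin (order G) ⊎ Fin (order H) → Bool
  adj⊎ G H (inj₁ a) (inj₁ b) = adj G a b
  adj⊎ G H (inj₂ a) (inj₂ b) = adj H a b
  adj⊎ G H (inj₁ _) (inj₂ _) = false
  adj⊎ G H (inj₂ _) (inj₁ _) = false

  adj⊎-sym : (G H : Graph) → ∀ x y → adj⊎ G H x y ≡ adj⊎ G H y x
  adj⊎-sym G H (inj₁ a) (inj₁ b) = adj-sym G a b
  adj⊎-sym G H (inj₂ a) (inj₂ b) = adj-sym H a b
  adj⊎-sym G H (inj₁ _) (inj₂ _) = refl
  adj⊎-sym G H (inj₂ _) (inj₁ _) = refl

  adj⊎-irrefl : (G H : Graph) → ∀ x → adj⊎ G H x x ≡ false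
  adj⊎-irrefl G H (inj₁ a) = adj-irrefl G a
  adj⊎-irrefl G H (inj₂ a) = adj-irrefl H a

infixr 5 _∪ᴳ_
_∪ᴳ_ : Graph → Graph → Graph
G ∪ᴳ H = record
  { order = order G + order H
  ; adj = λ i j → adj⊎ G H (splitAt (order G) i) (splitAt (order G) j)
  ; adj-sym = λ i j → adj⊎-sym G H (splitAt (order G) i) (splitAt (order G) j)
  ; adj-irrefl = λ i → adj⊎-irrefl G H (splitAt (order G) i)
  }

copies : ℕ → Graph → Graph
copies zero    H = emptyGraph
copies (suc p) H = H ∪ᴳ copies p H

_≅_ : Graph → Graph → Set
G ≅ H = Σ (Fin (order G) ↔ Fin (order H)) λ f →
          ∀ i j → adj H (Inverse.to f i) (Inverse.to f j) ≡ adj G i j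

deg : (G : Graph) → Fin (order G) → ℕ
deg G i = length (filter (λ j → adj G i j ≡ᵇ' true) (allFin (order G)))
  where
    open import Data.Bool.Properties using () renaming (_≟_ to _≡ᵇ'_)

maxDegree : Graph → ℕ
maxDegree G = foldr _⊔_ 0 (map (deg G) (allFin (order G)))

-- Partitions of {0,…,n-1} into nonempty blocks, encoded canonically as
-- restricted growth strings: vertex i gets the block label c_i, where
-- c_i ≤ (number of blocks among vertices < i).  Each partition corresponds
-- to exactly one such string.  Paired with the number of blocks.

partitions : (n : ℕ) → List (Vec ℕ n × ℕ)
partitions zero    = ([] , 0) ∷ []
partitions (suc n) =
  concatMap (λ ck → map (λ b → (proj₁ ck ∷ʳ b , proj₂ ck ⊔ suc b)) (upTo (suc (proj₂ ck))))
            (partitions n)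

isStablePartition : (G : Graph) → Vec ℕ (order G) → Bool
isStablePartition G c =
  and (concatMap (λ i → map (λ j → not (adj G i j) ∨ not (lookup c i ≡ᵇ lookup c j))
                            (allFin (order G)))
                 (allFin (order G)))

S : Graph → ℕ → ℕ
S G k = length (filter (λ ck → T? ((proj₂ ck ≡ᵇ k) ∧ isStablePartition G (proj₁ ck)))
                       (partitions (order G)))
  where
    open import Data.Bool.Properties using () renaming (_≟_ to _≟b_)
    open import Relation.Nullary using (Dec)
    T? : (b : Bool) → Dec (b ≡ true)
    T? b = b ≟b true

𝓑 : Graph → ℕ
𝓑 G = sum (map (λ k → S G k) (map suc (upTo (order G))))

𝓣 : Graph → ℕ
𝓣 G = sum (map (λ k → k * S G k) (map suc (upTo (order G))))

K₃ : Graph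
K₃ = K 3

U : ℕ → Graph
U n with n % 3
... | 0 = copies (n / 3) K₃
... | 1 = if (n ≡ᵇ 4) ∨ (n ≡ᵇ 7)
            then copies ((n ∸ 1) / 3) K₃ ∪ᴳ K 1
            else copies ((n ∸ 4) / 3) K₃ ∪ᴳ C 4
... | 2 = copies ((n ∸ 5) / 3) K₃ ∪ᴳ C 5
... | _ = emptyGraph   -- unreachable (n % 3 < 3)

{-# OPTIONS --safe #-}

-- Write x^k̲ = x(x − 1)⋯(x − k + 1). In this basis the coefficients of the chromatic polynomial P_G are the
-- S(G, k), so 𝓣/𝓑 is the mean of k. In any product w · x^i̲ this mean is strictly increasing in i (a
-- Cauchy–Schwarz inequality). Hence if the coefficients of f are dominated by those of g in the likelihood
-- ratio order, then replacing a factor f of P_G by g increases the mean, whatever the other components are.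
--
-- A graph with Δ ≤ 2 is a disjoint union of paths and cycles. With y = x − 1, the path on m + 1 vertices has
-- polynomial x yᵐ, and dominance yields P_{m+3} → K₃ ∪ P_m. The cycle on m vertices has polynomial
-- x(x − 1)(x − 2)(yᵐ⁻³ + yᵐ⁻⁵ + ⋯), plus x y when m is even; log-convexity of the moments of y yields
-- C_{m+3} → K₃ ∪ C_m for m ≥ 3. The remaining components K₁, K₂, C₄, C₅ are merged two at a time by dominance,
-- until at most one is left beside copies of K₃. Only K₃ ∪ K₁ against C₄ depends on the context: C₄ wins beside
-- two or more further triangles, by a quadratic inequality between the moments of x − 3.

module Submission where

open import Defs
open import Data.Bool using (Bool; true; false; not; _∧_; _∨_; if_then_else_) renaming (T to IsTrue)
open import Data.Bool.ListAction using (and)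
open import Data.Bool.Properties using () renaming (_≟_ to _≟ᵇ_)
open import Data.Empty using (⊥; ⊥-elim)
open import Data.Fin as Fin using (Fin; zero; suc; toℕ; splitAt; join; punchIn; _↑ˡ_; _↑ʳ_; fromℕ; fromℕ<; opposite)
open import Data.Fin.Permutation using (Permutation; remove; _⟨$⟩ʳ_; _⟨$⟩ˡ_; inverseʳ; punchIn-permute; ↔⇒≡)
open import Data.Fin.Properties using (splitAt-↑ˡ; splitAt-↑ʳ; toℕ<n; toℕ-injective; splitAt-join; join-splitAt; toℕ-↑ˡ; toℕ-↑ʳ; toℕ-fromℕ; toℕ-fromℕ<; opposite-prop; opposite-involutive)
open import Data.List as List using (List; []; _∷_; map; foldr; _++_; concatMap; applyUpTo; upTo; tabulate; allFin; filter; length; cartesianProduct; replicate)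
open import Data.List.Membership.Propositional using (_∈_)
open import Data.List.Membership.Propositional.Properties using (∈-filter⁺; ∈-cartesianProduct⁺; ∈-allFin; ∈-map⁺)
open import Data.List.Properties using (map-++; map-cong-local; map-∘; map-cong)
open import Data.List.Relation.Unary.All as All using (All; []; _∷_)
import Data.List.Relation.Unary.All.Properties as All
open import Data.List.Relation.Unary.Any using (here; there; index)
open import Data.List.Relation.Unary.Any.Properties using (lookup-index)
open import Data.Nat hiding (_!)
open import Data.Nat.DivMod using ([m+kn]%n≡m%n; m*n/n≡m)
open import Data.Nat.ListAction using (sum)
open import Data.Nat.ListAction.Properties using (sum-++)
open import Data.Nat.Properties
open import Data.Nat.Tactic.RingSolver using (solve-∀)
open import Data.Product using (Σ; ∃; _×_; _,_; proj₁; proj₂)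
open import Data.Sum using (_⊎_; inj₁; inj₂)
open import Data.Unit using (⊤; tt)
open import Data.Vec as Vec using (Vec; []; _∷_; _∷ʳ_; lookup)
open import Data.Vec.Properties using (map-∷ʳ; lookup-map; lookup∘tabulate; tabulate-cong; lookup-splitAt; lookup-++ˡ; lookup-++ʳ)
open import Function using (id)
open import Function.Bundles using (Inverse; mk↔ₛ′; _⇔_; mk⇔)
open import Relation.Binary.PropositionalEquality hiding ([_])
open import Relation.Nullary using (¬_; Dec; yes; no)
open import Relation.Nullary.Decidable using (_×-dec_; _⊎-dec_)

-- The functional x^k̲ ↦ 1, which is `sum` here, is the expectation E over a Poisson variable of
-- mean 1. Hence 𝓑 = E P_G, and since E (x - 1) x^k̲ = k, also 𝓣 = E (x - 1) P_G. This is why `sum`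
-- behaves like integration against a positive weight, why the powers of y = x - 1 have moments with
-- Cauchy-Schwarz inequalities, and, because E x f(x) = E f(x + 1), why a factor x(x - 1)(x - 2) can
-- be traded for the variable x - 3. The Poisson variance 1 adds a surplus to each of these
-- inequalities; it gives strictness, and the odd cycles depend on it. All arithmetic is in ℕ.
-- Factors x - i are applied only to sequences that vanish below i, and identities with a minus sign
-- are stated with the negative term moved to the other side. Each replacement is an isomorphism or
-- strictly increases the mean, so one chain yields both the bound and the equality case. Since C₄
-- against K₃ ∪ K₁ has no answer valid in every context, two relations are kept: one for all
-- contexts, under which components can be replaced, and one for the bare graph, used only for the
-- last step.

-- Sequences of coefficients in the falling factorial basis

-- s stands for the function x ↦ Σₖ sₖ x(x − 1)⋯(x − k + 1); sum, T, Q and Cub are the sums of sₖ, k sₖ, k² sₖ, k³ sₖ.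
Seq : Set
Seq = List ℕ

eval : Seq → ℕ → ℕ
eval []      x       = 0
eval (a ∷ s) zero    = a
eval (a ∷ s) (suc x) = a + suc x * eval s x

T : Seq → ℕ
T []      = 0
T (a ∷ s) = sum s + T s

Q : Seq → ℕ
Q []      = 0
Q (a ∷ s) = sum s + 2 * T s + Q s

infix 4 _≈_
-- Values are compared instead of lists, since equal polynomials may differ in trailing zeros.
_≈_ : Seq → Seq → Set
s ≈ t = ∀ x → eval s x ≡ eval t x

-- The falling factorial basis is triangular on 0, 1, 2, ...: the value at 0 is the head, and in the
-- rest the factor x + 1 cancels. So values on ℕ determine all coefficients.
≈-tail : ∀ {a b s t} → a ∷ s ≈ b ∷ t → (a ≡ b) × s ≈ t
≈-tail {a} e = e 0 , λ x → *-cancelˡ-≡ _ _ (suc x)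
  (+-cancelˡ-≡ a _ _ (trans (e (suc x)) (cong (_+ _) (sym (e 0)))))

eval-[-] : ∀ a x → eval (a ∷ []) x ≡ a
eval-[-] a zero    = refl
eval-[-] a (suc x) = trans (cong (a +_) (*-zeroʳ (suc x))) (+-identityʳ a)

eval-0∷ : ∀ s x → eval (0 ∷ s) x ≡ x * eval s (x ∸ 1)
eval-0∷ s zero    = refl
eval-0∷ s (suc x) = refl

≈-[]-tail : ∀ {b t} → [] ≈ b ∷ t → (0 ≡ b) × [] ≈ t
≈-[]-tail {b} {t} e = ≈-tail {0} {b} {[]} {t}
  λ { zero → e 0 ; (suc x) → trans (*-zeroʳ (suc x)) (e (suc x)) }

sum-≈ : ∀ s t → s ≈ t → sum s ≡ sum t
sum-≈ []      []      e = refl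
sum-≈ []      (b ∷ t) e with ≈-[]-tail {b} {t} e
... | refl , e′ = sum-≈ [] t e′
sum-≈ (a ∷ s) []      e with ≈-[]-tail {a} {s} (λ x → sym (e x))
... | refl , e′ = sum-≈ s [] (λ x → sym (e′ x))
sum-≈ (a ∷ s) (b ∷ t) e with ≈-tail {a} {b} {s} {t} e
... | refl , e′ = cong (a +_) (sum-≈ s t e′)

T-≈ : ∀ s t → s ≈ t → T s ≡ T t
T-≈ []      []      e = refl
T-≈ []      (b ∷ t) e with ≈-[]-tail {b} {t} e
... | refl , e′ = cong₂ _+_ (sum-≈ [] t e′) (T-≈ [] t e′)
T-≈ (a ∷ s) []      e with ≈-[]-tail {a} {s} (λ x → sym (e x))
... | refl , e′ = cong₂ _+_ (sum-≈ s [] (λ x → sym (e′ x))) (T-≈ s [] (λ x → sym (e′ x)))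
T-≈ (a ∷ s) (b ∷ t) e with ≈-tail {a} {b} {s} {t} e
... | refl , e′ = cong₂ _+_ (sum-≈ s t e′) (T-≈ s t e′)

infixl 6 _⊕_
_⊕_ : Seq → Seq → Seq
[]      ⊕ t       = t
(a ∷ s) ⊕ []      = a ∷ s
(a ∷ s) ⊕ (b ∷ t) = a + b ∷ s ⊕ t

eval-⊕ : ∀ s t x → eval (s ⊕ t) x ≡ eval s x + eval t x
eval-⊕ []      t       x       = refl
eval-⊕ (a ∷ s) []      x       = sym (+-identityʳ _)
eval-⊕ (a ∷ s) (b ∷ t) zero    = refl
eval-⊕ (a ∷ s) (b ∷ t) (suc x) rewrite eval-⊕ s t x = lem a b (suc x) (eval s x) (eval t x)
  where
  lem : ∀ a b x u v → a + b + x * (u + v) ≡ a + x * u + (b + x * v)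
  lem = solve-∀

sum-⊕ : ∀ s t → sum (s ⊕ t) ≡ sum s + sum t
sum-⊕ []      t       = refl
sum-⊕ (a ∷ s) []      = sym (+-identityʳ _)
sum-⊕ (a ∷ s) (b ∷ t) rewrite sum-⊕ s t = lem a b (sum s) (sum t)
  where
  lem : ∀ a b u v → a + b + (u + v) ≡ a + u + (b + v)
  lem = solve-∀

T-⊕ : ∀ s t → T (s ⊕ t) ≡ T s + T t
T-⊕ []      t       = refl
T-⊕ (a ∷ s) []      = sym (+-identityʳ _)
T-⊕ (a ∷ s) (b ∷ t) rewrite sum-⊕ s t | T-⊕ s t = lem (sum s) (sum t) (T s) (T t)
  where
  lem : ∀ a b u v → a + b + (u + v) ≡ a + u + (b + v)
  lem = solve-∀

infixr 7 _·_
_·_ : ℕ → Seq → Seq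
a · s = map (a *_) s

eval-· : ∀ a s x → eval (a · s) x ≡ a * eval s x
eval-· a []      x       = sym (*-zeroʳ a)
eval-· a (b ∷ s) zero    = refl
eval-· a (b ∷ s) (suc x) rewrite eval-· a s x = lem a b (suc x) (eval s x)
  where
  lem : ∀ a b x u → a * b + x * (a * u) ≡ a * (b + x * u)
  lem = solve-∀

sum-· : ∀ a s → sum (a · s) ≡ a * sum s
sum-· a []      = sym (*-zeroʳ a)
sum-· a (b ∷ s) rewrite sum-· a s = sym (*-distribˡ-+ a b (sum s))

T-· : ∀ a s → T (a · s) ≡ a * T s
T-· a []      = sym (*-zeroʳ a)
T-· a (b ∷ s) rewrite sum-· a s | T-· a s = sym (*-distribˡ-+ a (sum s) (T s))

-- A sequence whose first i coefficients are 0 vanishes at every x < i, which makes the truncated x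
-- ∸ i harmless as a factor.
Supp : ℕ → Seq → Set
Supp zero    s       = ⊤
Supp (suc i) []      = ⊤
Supp (suc i) (a ∷ s) = (a ≡ 0) × Supp i s

-- Multiplication by x − i of a sequence supported on [i, ∞), where x − i has nonnegative values.
mulSub : ℕ → Seq → Seq
mulSub i       []      = []
mulSub zero    (a ∷ s) = 0 ∷ (a ∷ []) ⊕ (s ⊕ mulSub zero s)
mulSub (suc i) (a ∷ s) = 0 ∷ mulSub i s

eval-mulSub : ∀ i s → Supp i s → ∀ x → eval (mulSub i s) x ≡ (x ∸ i) * eval s x
eval-mulSub i       []      p x       = sym (*-zeroʳ (x ∸ i))
eval-mulSub zero    (a ∷ s) p zero    = refl
eval-mulSub zero    (a ∷ s) p (suc x) = cong (suc x *_) (step x)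
  where
  lem : ∀ a x u → a + (u + x * u) ≡ a + suc x * u
  lem = solve-∀
  step : ∀ y → eval ((a ∷ []) ⊕ (s ⊕ mulSub zero s)) y ≡ a + suc y * eval s y
  step y rewrite eval-⊕ (a ∷ []) (s ⊕ mulSub zero s) y | eval-⊕ s (mulSub zero s) y
               | eval-mulSub zero s tt y | eval-[-] a y = lem a y (eval s y)
eval-mulSub (suc i) (a ∷ s) p zero = refl
eval-mulSub (suc i) (.0 ∷ s) (refl , p) (suc x) rewrite eval-mulSub i s p x =
  lem (suc x) (x ∸ i) (eval s x)
  where
  lem : ∀ x y u → x * (y * u) ≡ y * (x * u)
  lem = solve-∀

-- From (x - i) x^k̲ = x^(k+1)̲ + (k - i) x^k̲, whose coefficients sum to k + 1 - i. The same
-- identity gives `T-mulSub`.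
sum-mulSub : ∀ i s → Supp i s → sum (mulSub i s) + i * sum s ≡ T s + sum s
sum-mulSub i       []      p = *-zeroʳ i
sum-mulSub zero    (a ∷ s) p
  rewrite sum-⊕ (a ∷ []) (s ⊕ mulSub zero s) | sum-⊕ s (mulSub zero s) =
  trans (lem a (sum s) (sum (mulSub zero s)))
        (trans (cong (λ z → a + (sum s + z)) (sum-mulSub zero s tt)) (lem′ a (sum s) (T s)))
  where
  lem : ∀ a b c → a + 0 + (b + c) + 0 ≡ a + (b + (c + 0))
  lem = solve-∀
  lem′ : ∀ a b t → a + (b + (t + b)) ≡ b + t + (a + b)
  lem′ = solve-∀
sum-mulSub (suc i) (.0 ∷ s) (refl , p) =
  trans (lem (sum (mulSub i s)) i (sum s))
        (trans (cong (_+ sum s) (sum-mulSub i s p)) (lem′ (sum s) (T s)))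
  where
  lem : ∀ c i b → c + suc i * b ≡ c + i * b + b
  lem = solve-∀
  lem′ : ∀ b t → t + b + b ≡ b + t + b
  lem′ = solve-∀

T-mulSub : ∀ i s → Supp i s → T (mulSub i s) + i * T s ≡ Q s + T s + sum s
T-mulSub i       []      p = *-zeroʳ i
T-mulSub zero    (a ∷ s) p
  rewrite sum-⊕ (a ∷ []) (s ⊕ mulSub zero s) | sum-⊕ s (mulSub zero s)
        | T-⊕ (a ∷ []) (s ⊕ mulSub zero s) | T-⊕ s (mulSub zero s) =
  trans (lem a (sum s) (sum (mulSub zero s)) (T s) (T (mulSub zero s)))
        (trans (cong₂ (λ y z → a + (sum s + y) + (T s + z)) (sum-mulSub zero s tt) (T-mulSub zero s tt))
               (lem′ a (sum s) (T s) (Q s)))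
  where
  lem : ∀ a b c t u → a + 0 + (b + c) + (t + u) + 0 ≡ a + (b + (c + 0)) + (t + (u + 0))
  lem = solve-∀
  lem′ : ∀ a b t q → a + (b + (t + b)) + (t + (q + t + b)) ≡ b + 2 * t + q + (b + t) + (a + b)
  lem′ = solve-∀
T-mulSub (suc i) (.0 ∷ s) (refl , p) =
  trans (lem (sum (mulSub i s)) (T (mulSub i s)) i (sum s) (T s))
        (trans (cong₂ (λ y z → y + z + (sum s + T s)) (sum-mulSub i s p) (T-mulSub i s p))
               (lem′ (sum s) (T s) (Q s)))
  where
  lem : ∀ c d i b t → c + d + suc i * (b + t) ≡ c + i * b + (d + i * t) + (b + t)
  lem = solve-∀
  lem′ : ∀ b t q → t + b + (q + t + b) + (b + t) ≡ b + 2 * t + q + (b + t) + b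
  lem′ = solve-∀

Supp-⊕ : ∀ i s t → Supp i s → Supp i t → Supp i (s ⊕ t)
Supp-⊕ zero    s        t        p q = tt
Supp-⊕ (suc i) []       t        p q = q
Supp-⊕ (suc i) (a ∷ s)  []       p q = p
Supp-⊕ (suc i) (.0 ∷ s) (.0 ∷ t) (refl , p) (refl , q) = refl , Supp-⊕ i s t p q

Supp-· : ∀ i a s → Supp i s → Supp i (a · s)
Supp-· zero    a s        p = tt
Supp-· (suc i) a []       p = tt
Supp-· (suc i) a (.0 ∷ s) (refl , p) = *-zeroʳ a , Supp-· i a s p

Supp-mulSub : ∀ i s → Supp i s → Supp (suc i) (mulSub i s)
Supp-mulSub i       []      p = tt
Supp-mulSub zero    (a ∷ s) p = refl , tt
Supp-mulSub (suc i) (a ∷ s) p = refl , Supp-mulSub i s (proj₂ p)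

Supp-weaken : ∀ {i j} s → i ≤ j → Supp j s → Supp i s
Supp-weaken s       z≤n     p = tt
Supp-weaken []      (s≤s h) p = tt
Supp-weaken (a ∷ s) (s≤s h) p = proj₁ p , Supp-weaken s h (proj₂ p)

Supp-mulSub′ : ∀ i j s → i ≤ j → Supp j s → Supp j (mulSub i s)
Supp-mulSub′ i       zero    s       h p = tt
Supp-mulSub′ i       (suc j) []      h p = tt
Supp-mulSub′ zero    (suc j) (.0 ∷ s) h (refl , p) = refl ,
  Supp-⊕ j (0 ∷ []) _ (Supp-0 j) (Supp-⊕ j s _ p (Supp-mulSub′ zero j s z≤n p))
  where
  Supp-0 : ∀ j → Supp j (0 ∷ [])
  Supp-0 zero          = tt
  Supp-0 (suc zero)    = refl , tt
  Supp-0 (suc (suc j)) = refl , tt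
Supp-mulSub′ (suc i) (suc j) (a ∷ s) (s≤s h) (_ , p) = refl , Supp-mulSub′ i j s h p

-- Σⱼ fⱼ (x − i)(x − i − 1)⋯(x − i − j + 1) u
conv : Seq → ℕ → Seq → Seq
conv []      i u = []
conv (a ∷ f) i u = a · u ⊕ conv f (suc i) (mulSub i u)

eval-conv : ∀ f i u → Supp i u → ∀ x → eval (conv f i u) x ≡ eval f (x ∸ i) * eval u x
eval-conv []      i u p x = refl
eval-conv (a ∷ f) i u p x
  rewrite eval-⊕ (a · u) (conv f (suc i) (mulSub i u)) x | eval-· a u x
        | eval-conv f (suc i) (mulSub i u) (Supp-mulSub i u p) x | eval-mulSub i u p x =
  go (x ∸ i) (x ∸ suc i) (sym (trans (∸-+-assoc x i 1) (cong (x ∸_) (+-comm i 1))))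
  where
  lem : ∀ a e z v → a * v + e * (z * v) ≡ (a + z * e) * v
  lem = solve-∀
  go : ∀ z z′ → z′ ≡ z ∸ 1 →
       a * eval u x + eval f z′ * (z * eval u x) ≡ eval (a ∷ f) z * eval u x
  go zero    _ _    = trans (cong (a * eval u x +_) (*-zeroʳ (eval f _))) (+-identityʳ _)
  go (suc z) _ refl = lem a (eval f z) (suc z) (eval u x)

infixr 7 _⊛_
_⊛_ : Seq → Seq → Seq
f ⊛ w = conv f 0 w

eval-⊛ : ∀ f w x → eval (f ⊛ w) x ≡ eval f x * eval w x
eval-⊛ f w = eval-conv f 0 w tt

Supp-⊛ : ∀ i f w → Supp i w → Supp i (f ⊛ w)
Supp-⊛ i f w p = go f 0 w p
  where
  Supp-mulSub″ : ∀ i j s → Supp j s → Supp j (mulSub i s)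
  Supp-mulSub″ i j s p with i ≤? j
  ... | yes h = Supp-mulSub′ i j s h p
  ... | no ¬h = go′ i j s (≰⇒> ¬h) p
    where
    go′ : ∀ i j s → j < i → Supp j s → Supp j (mulSub i s)
    go′ i       zero    s       h p = tt
    go′ i       (suc j) []      h p = tt
    go′ (suc i) (suc j) (a ∷ s) (s≤s h) p = refl , go′ i j s h (proj₂ p)
  go : ∀ f k w → Supp i w → Supp i (conv f k w)
  go []      k w p = Supp-[] i
    where
    Supp-[] : ∀ i → Supp i []
    Supp-[] zero    = tt
    Supp-[] (suc i) = tt
  go (a ∷ f) k w p = Supp-⊕ i _ _ (Supp-· i a w p) (go f (suc k) (mulSub k w) (Supp-mulSub″ k i w p))

-- Comparison of means

-- A pair (t , b) stands for the ratio t / b.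
infix 4 _⊏_ _⊑_
_⊏_ _⊑_ : ℕ × ℕ → ℕ × ℕ → Set
(t , b) ⊏ (t′ , b′) = t * b′ < t′ * b
(t , b) ⊑ (t′ , b′) = t * b′ ≤ t′ * b

infixl 6 _⊹_
_⊹_ : ℕ × ℕ → ℕ × ℕ → ℕ × ℕ
(t , b) ⊹ (t′ , b′) = t + t′ , b + b′

≤-of-+ : ∀ {m n} d → m + d ≡ n → m ≤ n
≤-of-+ {m} d refl = m≤m+n m d

<⇒0<ʳ : ∀ {a b c} → a < b * c → 0 < c
<⇒0<ʳ {a} {b} {zero}  h = ≤-trans (s≤s z≤n) (subst (a <_) (*-zeroʳ b) h)
<⇒0<ʳ {b = b} {suc c} h = s≤s z≤n

<-*ʳ : ∀ {a b} c → 0 < c → a < b → a * c < b * c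
<-*ʳ (suc c) _ h = *-monoˡ-< (suc c) h

⊑-⊏-trans : ∀ p q r → 0 < proj₂ p → p ⊑ q → q ⊏ r → p ⊏ r
⊑-⊏-trans (a , b) (c , d) (e , f) b>0 p q = *-cancelʳ-< d (a * f) (e * b) (begin-strict
  a * f * d   ≡⟨ lem a f d ⟩
  a * d * f   ≤⟨ *-monoˡ-≤ f p ⟩
  c * b * f   ≡⟨ lem c b f ⟩
  c * f * b   <⟨ <-*ʳ b b>0 q ⟩
  e * d * b   ≡⟨ lem e d b ⟩
  e * b * d   ∎)
  where
  open ≤-Reasoning
  lem : ∀ x y z → x * y * z ≡ x * z * y
  lem = solve-∀

⊏-⊑-trans : ∀ p q r → 0 < proj₂ r → p ⊏ q → q ⊑ r → p ⊏ r
⊏-⊑-trans (a , b) (c , d) (e , f) f>0 p q = *-cancelʳ-< d (a * f) (e * b) (begin-strict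
  a * f * d   ≡⟨ lem a f d ⟩
  a * d * f   <⟨ <-*ʳ f f>0 p ⟩
  c * b * f   ≡⟨ lem c b f ⟩
  c * f * b   ≤⟨ *-monoˡ-≤ b q ⟩
  e * d * b   ≡⟨ lem e d b ⟩
  e * b * d   ∎)
  where
  open ≤-Reasoning
  lem : ∀ x y z → x * y * z ≡ x * z * y
  lem = solve-∀

⊏-trans : ∀ p q r → p ⊏ q → q ⊏ r → p ⊏ r
⊏-trans p q r h h′ = ⊑-⊏-trans p q r (<⇒0<ʳ {b = proj₁ q} h) (<⇒≤ h) h′

⊏-⊹ˡ : ∀ p q r → p ⊏ r → q ⊏ r → p ⊹ q ⊏ r
⊏-⊹ˡ (a , b) (c , d) (e , f) h h′ = subst₂ _<_ (sym (*-distribʳ-+ f a c)) (sym (*-distribˡ-+ e b d)) (+-mono-< h h′)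

⊏-⊹ʳ : ∀ p q r → r ⊏ p → r ⊏ q → r ⊏ p ⊹ q
⊏-⊹ʳ (a , b) (c , d) (e , f) h h′ = subst₂ _<_ (sym (*-distribˡ-+ e b d)) (sym (*-distribʳ-+ f a c)) (+-mono-< h h′)

⊏-self-⊹ : ∀ p r → p ⊏ r → p ⊹ r ⊏ r
⊏-self-⊹ (a , b) (e , f) h = subst₂ _<_ (sym (*-distribʳ-+ f a e)) (sym (*-distribˡ-+ e b f)) (+-monoˡ-< (e * f) h)

pr : Seq → ℕ × ℕ
pr s = T s , sum s

pr-≈ : ∀ s t → s ≈ t → pr s ≡ pr t
pr-≈ s t e = cong₂ _,_ (T-≈ s t e) (sum-≈ s t e)

-- Cauchy–Schwarz.
T²≤sum*Q : ∀ s → T s * T s ≤ sum s * Q s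
T²≤sum*Q []      = z≤n
-- Prepending a coefficient shifts all indices by one, which leaves sum · Q - T² unchanged; the new
-- entry at index 0 can only increase it.
T²≤sum*Q (a ∷ s) = begin
  (b + t) * (b + t)                    ≡⟨ lem b t ⟩
  t * t + (2 * (b * t) + b * b)        ≤⟨ +-monoˡ-≤ _ (T²≤sum*Q s) ⟩
  b * q + (2 * (b * t) + b * b)        ≤⟨ m≤m+n _ (a * (b + 2 * t + q)) ⟩
  b * q + (2 * (b * t) + b * b) + a * (b + 2 * t + q) ≡⟨ lem′ a b t q ⟩
  (a + b) * (b + 2 * t + q)            ∎
  where
  open ≤-Reasoning
  b = sum s
  t = T s
  q = Q s
  lem : ∀ b t → (b + t) * (b + t) ≡ t * t + (2 * (b * t) + b * b)
  lem = solve-∀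
  lem′ : ∀ a b t q → b * q + (2 * (b * t) + b * b) + a * (b + 2 * t + q) ≡ (a + b) * (b + 2 * t + q)
  lem′ = solve-∀

-- Multiplication by x − i increases the mean: this is the positivity of a variance.
pr-mulSub : ∀ i u → Supp i u → 0 < sum u → pr u ⊏ pr (mulSub i u)
pr-mulSub i u p h = +-cancelʳ-< (i * T u * sum u) _ _ (begin-strict
  T u * B′ + i * T u * sum u             ≡⟨ lem (T u) B′ i (sum u) ⟩
  T u * (B′ + i * sum u)                 ≡⟨ cong (T u *_) (sum-mulSub i u p) ⟩
  T u * (T u + sum u)                    ≡⟨ lem₁ (T u) (sum u) ⟩
  T u * T u + T u * sum u                ≤⟨ +-monoˡ-≤ _ (T²≤sum*Q u) ⟩
  -- The square of `sum u` gives strictness even when u has a single coefficient, where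
  -- Cauchy-Schwarz is an equality.
  sum u * Q u + T u * sum u              <⟨ +-monoʳ-< (sum u * Q u) (m<m+n (T u * sum u) (*-mono-< h h)) ⟩
  sum u * Q u + (T u * sum u + sum u * sum u) ≡⟨ lem₂ (sum u) (Q u) (T u) ⟩
  (Q u + T u + sum u) * sum u            ≡⟨ cong (_* sum u) (T-mulSub i u p) ⟨
  (T′ + i * T u) * sum u                 ≡⟨ *-distribʳ-+ (sum u) T′ (i * T u) ⟩
  T′ * sum u + i * T u * sum u           ∎)
  where
  open ≤-Reasoning
  B′ = sum (mulSub i u)
  T′ = T (mulSub i u)
  lem : ∀ t b i c → t * b + i * t * c ≡ t * (b + i * c)
  lem = solve-∀
  lem₁ : ∀ t b → t * (t + b) ≡ t * t + t * b
  lem₁ = solve-∀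
  lem₂ : ∀ b q t → b * q + (t * b + b * b) ≡ (q + t + b) * b
  lem₂ = solve-∀

sum≤sum-mulSub : ∀ i u → Supp i u → sum u ≤ sum (mulSub i u)
sum≤sum-mulSub i       []      p = z≤n
sum≤sum-mulSub zero    (a ∷ s) p
  rewrite sum-⊕ (a ∷ []) (s ⊕ mulSub zero s) | sum-⊕ s (mulSub zero s) =
  ≤-of-+ (sum (mulSub zero s)) (lem a (sum s) (sum (mulSub zero s)))
  where
  lem : ∀ a b c → a + b + c ≡ a + 0 + (b + c)
  lem = solve-∀
sum≤sum-mulSub (suc i) (.0 ∷ s) (refl , p) = sum≤sum-mulSub i s p

sum-conv>0 : ∀ f i u → Supp i u → 0 < sum f → 0 < sum u → 0 < sum (conv f i u)
sum-conv>0 (a ∷ f) i u p hf hu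
  rewrite sum-⊕ (a · u) (conv f (suc i) (mulSub i u)) | sum-· a u with a
... | suc a′ = ≤-trans hu (≤-trans (m≤m+n (sum u) (a′ * sum u)) (m≤m+n _ _))
... | zero   = sum-conv>0 f (suc i) (mulSub i u) (Supp-mulSub i u p) hf (≤-trans hu (sum≤sum-mulSub i u p))

lin : Seq → (ℕ → ℕ × ℕ) → ℕ × ℕ
lin []      p = 0 , 0
lin (a ∷ f) p = (a * proj₁ (p 0) , a * proj₂ (p 0)) ⊹ lin f (λ j → p (suc j))

-- Entry j belongs to (x - i)(x - i - 1)⋯(x - i - j + 1) u, the sequence that coefficient j of f
-- multiplies in `conv f i u`.
prs : ℕ → Seq → ℕ → ℕ × ℕ
prs i u zero    = pr u
prs i u (suc j) = prs (suc i) (mulSub i u) j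

pr-conv : ∀ f i u → pr (conv f i u) ≡ lin f (prs i u)
pr-conv []      i u = refl
pr-conv (a ∷ f) i u = trans
  (cong₂ _,_ (trans (T-⊕ (a · u) _) (cong (_+ _) (T-· a u))) (trans (sum-⊕ (a · u) _) (cong (_+ _) (sum-· a u))))
  (cong (_ ⊹_) (pr-conv f (suc i) (mulSub i u)))

prs-increasing : ∀ i u → Supp i u → 0 < sum u → ∀ j → pr u ⊏ prs i u (suc j)
prs-increasing i u p h zero    = pr-mulSub i u p h
prs-increasing i u p h (suc j) = ⊏-trans (pr u) (pr (mulSub i u)) (prs (suc i) (mulSub i u) (suc j)) (pr-mulSub i u p h)
  (prs-increasing (suc i) (mulSub i u) (Supp-mulSub i u p) (≤-trans h (sum≤sum-mulSub i u p)) j)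

-- Likelihood ratio dominance

𝟙 : Bool → ℕ
𝟙 b = if b then 1 else 0

𝟙-∨ : ∀ b c → 𝟙 (b ∨ c) ≤ 𝟙 b + 𝟙 c
𝟙-∨ false c = ≤-refl
𝟙-∨ true  c = s≤s z≤n

-- These are the 2 × 2 minors that pair the leading entries a of f and c of g with the later
-- entries. The test is Boolean so that concrete instances are settled by evaluation; lists of
-- different lengths fail it.
headDominated : ℕ → ℕ → Seq → Seq → Bool
headDominated a c []      []      = true
headDominated a c (x ∷ f) (y ∷ g) = (c * x ≤ᵇ a * y) ∧ headDominated a c f g
headDominated a c _       _       = false

headStrict : ℕ → ℕ → Seq → Seq → Bool
headStrict a c (x ∷ f) (y ∷ g) = (c * x <ᵇ a * y) ∨ headStrict a c f g
headStrict a c _       _       = false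

-- f is dominated by g in the likelihood ratio order, respectively strictly somewhere.
dominated strictly : Seq → Seq → Bool
dominated []      []      = true
dominated (a ∷ f) (c ∷ g) = headDominated a c f g ∧ dominated f g
dominated _       _       = false
strictly (a ∷ f) (c ∷ g) = headStrict a c f g ∨ strictly f g
strictly _       _       = false

∧-true : ∀ {b c} → (b ∧ c) ≡ true → (b ≡ true) × (c ≡ true)
∧-true {true} {true} refl = refl , refl

-- The difference of the two main terms is (n - m)(q - p), at least 1 when m < n.
rearrange : ∀ {m n p q} → m ≤ n → p < q → 𝟙 (m <ᵇ n) + (m * q + n * p) ≤ n * q + m * p
rearrange {m} {n} {p} {q} h h′ with m≤n⇒∃[o]m+o≡n h | m≤n⇒∃[o]m+o≡n h′
... | d , refl | e , refl = ≤-trans (+-monoˡ-≤ _ (bound m d)) (≤-of-+ (d * e) (lem m d p e))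
  where
  bound : ∀ m d → 𝟙 (m <ᵇ m + d) ≤ d
  bound zero    zero    = z≤n
  bound zero    (suc d) = s≤s z≤n
  bound (suc m) d       = bound m d
  lem : ∀ m d p e → d + (m * (suc p + e) + (m + d) * p) + d * e ≡ (m + d) * (suc p + e) + m * p
  lem = solve-∀

-- The summand 𝟙 records strictness.
dominated-head : ∀ a c f g t b (p : ℕ → ℕ × ℕ) → (∀ j → (t , b) ⊏ p j) → headDominated a c f g ≡ true →
  𝟙 (headStrict a c f g) + (c * (proj₁ (lin f p) * b) + a * (t * proj₂ (lin g p))) ≤
  a * (proj₁ (lin g p) * b) + c * (t * proj₂ (lin f p))
dominated-head a c []      []      t b p h d = ≤-reflexive (lem a c t b)
  where
  lem : ∀ a c t b → c * (0 * b) + a * (t * 0) ≡ a * (0 * b) + c * (t * 0)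
  lem = solve-∀
dominated-head a c (x ∷ f) (y ∷ g) t b p h d with ∧-true {c * x ≤ᵇ a * y} d
... | d₁ , d₂ = begin
  𝟙 (s₁ ∨ s₂) + (c * ((x * pt + F₁) * b) + a * (t * (y * pb + G₂)))
    ≤⟨ +-monoˡ-≤ _ (𝟙-∨ s₁ s₂) ⟩
  𝟙 s₁ + 𝟙 s₂ + (c * ((x * pt + F₁) * b) + a * (t * (y * pb + G₂)))
    ≡⟨ lem (𝟙 s₁) (𝟙 s₂) a c x y t b pt pb F₁ G₂ ⟩
  (𝟙 s₁ + (c * x * (pt * b) + a * y * (t * pb))) + (𝟙 s₂ + (c * (F₁ * b) + a * (t * G₂)))
    ≤⟨ +-mono-≤ (rearrange (≤ᵇ⇒≤ (c * x) (a * y) (subst IsTrue (sym d₁) tt)) (h 0))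
                (dominated-head a c f g t b (λ j → p (suc j)) (λ j → h (suc j)) d₂) ⟩
  (a * y * (pt * b) + c * x * (t * pb)) + (a * (G₁ * b) + c * (t * F₂))
    ≡⟨ lem′ a c x y t b pt pb G₁ F₂ ⟩
  a * ((y * pt + G₁) * b) + c * (t * (x * pb + F₂)) ∎
  where
  open ≤-Reasoning
  s₁ = c * x <ᵇ a * y
  s₂ = headStrict a c f g
  pt = proj₁ (p 0)
  pb = proj₂ (p 0)
  F₁ = proj₁ (lin f (λ j → p (suc j)))
  F₂ = proj₂ (lin f (λ j → p (suc j)))
  G₁ = proj₁ (lin g (λ j → p (suc j)))
  G₂ = proj₂ (lin g (λ j → p (suc j)))
  lem : ∀ s s′ a c x y t b pt pb F G → s + s′ + (c * ((x * pt + F) * b) + a * (t * (y * pb + G))) ≡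
        (s + (c * x * (pt * b) + a * y * (t * pb))) + (s′ + (c * (F * b) + a * (t * G)))
  lem = solve-∀
  lem′ : ∀ a c x y t b pt pb G F → (a * y * (pt * b) + c * x * (t * pb)) + (a * (G * b) + c * (t * F)) ≡
         a * ((y * pt + G) * b) + c * (t * (x * pb + F))
  lem′ = solve-∀

-- Cauchy-Binet: with p j = (tⱼ , bⱼ), right side minus left side, apart from the indicator, is the
-- sum over i < j of (fᵢ gⱼ - fⱼ gᵢ)(tⱼ bᵢ - tᵢ bⱼ). Dominance makes the first factors nonnegative,
-- monotonicity of p the second ones positive. The induction splits off the pairs with i = 0.
dominated-lin : ∀ f g p → (∀ i j → p i ⊏ p (suc (i + j))) → dominated f g ≡ true →
  𝟙 (strictly f g) + proj₁ (lin f p) * proj₂ (lin g p) ≤ proj₁ (lin g p) * proj₂ (lin f p)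
dominated-lin []      []      p h d = z≤n
dominated-lin (a ∷ f) (c ∷ g) p h d with ∧-true {headDominated a c f g} d
... | d₁ , d₂ = begin
  𝟙 (s₁ ∨ s₂) + (a * t + F₁) * (c * b + G₂)
    ≤⟨ +-monoˡ-≤ _ (𝟙-∨ s₁ s₂) ⟩
  𝟙 s₁ + 𝟙 s₂ + (a * t + F₁) * (c * b + G₂)
    ≡⟨ lem (𝟙 s₁) (𝟙 s₂) a c t b F₁ G₂ ⟩
  a * c * t * b + ((𝟙 s₁ + (c * (F₁ * b) + a * (t * G₂))) + (𝟙 s₂ + F₁ * G₂))
    ≤⟨ +-monoʳ-≤ (a * c * t * b) (+-mono-≤ (dominated-head a c f g t b (λ j → p (suc j)) (h 0) d₁)
                 (dominated-lin f g (λ j → p (suc j)) (λ i j → h (suc i) j) d₂)) ⟩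
  a * c * t * b + ((a * (G₁ * b) + c * (t * F₂)) + G₁ * F₂)
    ≡⟨ lem′ a c t b G₁ F₂ ⟩
  (c * t + G₁) * (a * b + F₂) ∎
  where
  open ≤-Reasoning
  s₁ = headStrict a c f g
  s₂ = strictly f g
  t = proj₁ (p 0)
  b = proj₂ (p 0)
  F₁ = proj₁ (lin f (λ j → p (suc j)))
  F₂ = proj₂ (lin f (λ j → p (suc j)))
  G₁ = proj₁ (lin g (λ j → p (suc j)))
  G₂ = proj₂ (lin g (λ j → p (suc j)))
  lem : ∀ s s′ a c t b F G → s + s′ + (a * t + F) * (c * b + G) ≡
        a * c * t * b + ((s + (c * (F * b) + a * (t * G))) + (s′ + F * G))
  lem = solve-∀
  lem′ : ∀ a c t b G F → a * c * t * b + ((a * (G * b) + c * (t * F)) + G * F) ≡ (c * t + G) * (a * b + F)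
  lem′ = solve-∀

conv-⊏ : ∀ f g i u → Supp i u → 0 < sum u → dominated f g ≡ true → strictly f g ≡ true →
  pr (conv f i u) ⊏ pr (conv g i u)
conv-⊏ f g i u p h d s = subst₂ _⊏_ (sym (pr-conv f i u)) (sym (pr-conv g i u))
  (subst (λ b → 𝟙 b + proj₁ (lin f (prs i u)) * proj₂ (lin g (prs i u)) ≤ proj₁ (lin g (prs i u)) * proj₂ (lin f (prs i u))) s (dominated-lin f g (prs i u) (inc i u p h) d))
  where
  inc : ∀ i u → Supp i u → 0 < sum u → ∀ k j → prs i u k ⊏ prs i u (suc (k + j))
  inc i u p h zero    j = prs-increasing i u p h j
  inc i u p h (suc k) j = inc (suc i) (mulSub i u) (Supp-mulSub i u p) (≤-trans h (sum≤sum-mulSub i u p)) k j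

infix 4 _≺_
-- The context w stands for the product of the polynomials of all other components.
record _≺_ (f g : Seq) : Set where
  constructor ≺-intro
  field ⊏-in : ∀ w → 0 < sum w → pr (f ⊛ w) ⊏ pr (g ⊛ w)
open _≺_

≺-trans : ∀ {f g h} → f ≺ g → g ≺ h → f ≺ h
≺-trans {f} {g} {h} p q = ≺-intro λ w w>0 →
  ⊏-trans (pr (f ⊛ w)) (pr (g ⊛ w)) (pr (h ⊛ w)) (⊏-in p w w>0) (⊏-in q w w>0)

dominated⇒≺ : ∀ f g → dominated f g ≡ true → strictly f g ≡ true → f ≺ g
dominated⇒≺ f g d s = ≺-intro λ w w>0 → conv-⊏ f g 0 w tt w>0 d s

⊛-cong : ∀ {f f′ w w′} → f ≈ f′ → w ≈ w′ → f ⊛ w ≈ f′ ⊛ w′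
⊛-cong {f} {f′} {w} {w′} e e′ x = trans (eval-⊛ f w x) (trans (cong₂ _*_ (e x) (e′ x)) (sym (eval-⊛ f′ w′ x)))

≺-resp-≈ : ∀ {f f′ g g′} → f ≈ f′ → g ≈ g′ → f ≺ g → f′ ≺ g′
≺-resp-≈ {f} {f′} {g} {g′} e e′ p = ≺-intro λ w w>0 → subst₂ _⊏_
  (pr-≈ (f ⊛ w) (f′ ⊛ w) (⊛-cong {f} {f′} {w} {w} e (λ _ → refl)))
  (pr-≈ (g ⊛ w) (g′ ⊛ w) (⊛-cong {g} {g′} {w} {w} e′ (λ _ → refl))) (⊏-in p w w>0)

-- The factor h is absorbed into the context.
≺-⊛ : ∀ {f g} h → 0 < sum h → f ≺ g → h ⊛ f ≺ h ⊛ g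
≺-⊛ {f} {g} h h>0 p = ≺-intro λ w w>0 →
  subst₂ _⊏_ (swap w f) (swap w g) (⊏-in p (h ⊛ w) (sum-conv>0 h 0 w tt h>0 w>0))
  where
  lem : ∀ f h w → f * (h * w) ≡ h * f * w
  lem = solve-∀
  swap : ∀ w f → pr (f ⊛ (h ⊛ w)) ≡ pr ((h ⊛ f) ⊛ w)
  swap w f = pr-≈ (f ⊛ (h ⊛ w)) ((h ⊛ f) ⊛ w) λ x → begin
    eval (f ⊛ (h ⊛ w)) x                ≡⟨ eval-⊛ f (h ⊛ w) x ⟩
    eval f x * eval (h ⊛ w) x           ≡⟨ cong (eval f x *_) (eval-⊛ h w x) ⟩
    eval f x * (eval h x * eval w x)    ≡⟨ lem (eval f x) (eval h x) (eval w x) ⟩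
    eval h x * eval f x * eval w x      ≡⟨ cong (_* eval w x) (eval-⊛ h f x) ⟨
    eval (h ⊛ f) x * eval w x           ≡⟨ eval-⊛ (h ⊛ f) w x ⟨
    eval ((h ⊛ f) ⊛ w) x                ∎
    where open ≡-Reasoning

-- Paths and long cycles

pr-⊕ : ∀ s t → pr (s ⊕ t) ≡ pr s ⊹ pr t
pr-⊕ s t = cong₂ _,_ (T-⊕ s t) (sum-⊕ s t)

⊛-distribʳ : ∀ f g w → (f ⊕ g) ⊛ w ≈ (f ⊛ w) ⊕ (g ⊛ w)
⊛-distribʳ f g w x = begin
  eval ((f ⊕ g) ⊛ w) x                          ≡⟨ eval-⊛ (f ⊕ g) w x ⟩
  eval (f ⊕ g) x * eval w x                     ≡⟨ cong (_* eval w x) (eval-⊕ f g x) ⟩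
  (eval f x + eval g x) * eval w x              ≡⟨ *-distribʳ-+ (eval w x) (eval f x) (eval g x) ⟩
  eval f x * eval w x + eval g x * eval w x     ≡⟨ cong₂ _+_ (eval-⊛ f w x) (eval-⊛ g w x) ⟨
  eval (f ⊛ w) x + eval (g ⊛ w) x               ≡⟨ eval-⊕ (f ⊛ w) (g ⊛ w) x ⟨
  eval ((f ⊛ w) ⊕ (g ⊛ w)) x                    ∎
  where open ≡-Reasoning

-- Moments of y = x - 1

mul-x-1 : ℕ → Seq → Seq
mul-x-1 zero    s = s
mul-x-1 (suc j) s = mulSub 1 (mul-x-1 j s)

Supp-mul-x-1 : ∀ i j s → Supp (suc i) s → Supp (suc i) (mul-x-1 j s)
Supp-mul-x-1 i zero    s p = p
Supp-mul-x-1 i (suc j) s p = Supp-mulSub′ 1 (suc i) _ (s≤s z≤n) (Supp-mul-x-1 i j s p)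

eval-mul-x-1 : ∀ j s → Supp 1 s → ∀ x → eval (mul-x-1 j s) x ≡ (x ∸ 1) ^ j * eval s x
eval-mul-x-1 zero    s p x = sym (*-identityˡ _)
eval-mul-x-1 (suc j) s p x = trans (eval-mulSub 1 (mul-x-1 j s) (Supp-mul-x-1 0 j s p) x)
  (trans (cong ((x ∸ 1) *_) (eval-mul-x-1 j s p x)) (sym (*-assoc (x ∸ 1) _ _)))

moment : Seq → ℕ → ℕ
moment s j = sum (mul-x-1 j s)

module Moments (s : Seq) (supp : Supp 1 s) (s>0 : 0 < sum s) where

  M : ℕ → ℕ
  M = moment s

  supp-j : ∀ j → Supp 1 (mul-x-1 j s)
  supp-j j = Supp-mul-x-1 0 j s supp

  -- The coefficients of (x - 1) x^k̲ sum to k, so the weighted sum T of one sequence is the plain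
  -- sum of the next. Means thus become ratios of consecutive moments.
  T≡M : ∀ j → T (mul-x-1 j s) ≡ M (suc j)
  T≡M j = sym (+-cancelʳ-≡ (M j) _ _ (trans (cong (M (suc j) +_) (sym (*-identityˡ (M j)))) (sum-mulSub 1 (mul-x-1 j s) (supp-j j))))

  p : ℕ → ℕ × ℕ
  p j = M (suc j) , M j

  pr≡p : ∀ j → pr (mul-x-1 j s) ≡ p j
  pr≡p j = cong (_, M j) (T≡M j)

  M-mono : ∀ j → M j ≤ M (suc j)
  M-mono j = sum≤sum-mulSub 1 (mul-x-1 j s) (supp-j j)

  M-pos : ∀ j → 0 < M j
  M-pos zero    = s>0
  M-pos (suc j) = ≤-trans (M-pos j) (M-mono j)

  M-mono-≤ : ∀ {i j} → i ≤ j → M i ≤ M j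
  M-mono-≤ {i} h with m≤n⇒∃[o]m+o≡n h
  ... | d , refl = go d
    where
    go : ∀ d → M i ≤ M (i + d)
    go zero    rewrite +-identityʳ i = ≤-refl
    go (suc d) rewrite +-suc i d = ≤-trans (go d) (M-mono (i + d))

  -- Cauchy-Schwarz, sharpened: the moment two steps on is `Q u + sum u`, and its part `sum u`
  -- supplies the extra square M j * M j. The surplus is what `gap` spends.
  logConvex : ∀ j → M (suc j) * M (suc j) + M j * M j ≤ M (2 + j) * M j
  logConvex j = begin
    M (suc j) * M (suc j) + M j * M j ≡⟨ cong (λ t → t * t + M j * M j) (T≡M j) ⟨
    T u * T u + M j * M j             ≤⟨ +-monoˡ-≤ _ (T²≤sum*Q u) ⟩
    sum u * Q u + M j * M j           ≡⟨ lem (M j) (Q u) ⟩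
    (Q u + sum u) * M j               ≡⟨ cong (_* M j) eq ⟨
    M (2 + j) * M j                   ∎
    where
    open ≤-Reasoning
    u = mul-x-1 j s
    lem : ∀ b q → b * q + b * b ≡ (q + b) * b
    lem = solve-∀
    lem′ : ∀ q t b → q + t + b ≡ q + b + 1 * t
    lem′ = solve-∀
    eq : M (2 + j) ≡ Q u + sum u
    eq = +-cancelʳ-≡ (1 * T u) _ _ (trans (cong (_+ 1 * T u) (sym (T≡M (suc j))))
      (trans (T-mulSub 1 u (supp-j j)) (lem′ (Q u) (T u) (sum u))))

  p-step : ∀ j → p j ⊏ p (suc j)
  p-step j = <-≤-trans (m<m+n (M (suc j) * M (suc j)) (*-mono-< (M-pos j) (M-pos j))) (logConvex j)

  p-increasing : ∀ i k → p i ⊏ p (suc (i + k))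
  p-increasing i zero    rewrite +-identityʳ i = p-step i
  p-increasing i (suc k) rewrite +-suc i k =
    ⊏-trans (p i) (p (suc (i + k))) (p (2 + (i + k))) (p-increasing i k) (p-step (suc (i + k)))

  p-< : ∀ {i j} → i < j → p i ⊏ p j
  p-< {i} h with m≤n⇒∃[o]m+o≡n h
  ... | k , refl = p-increasing i k

  -- Adjoining `p 1` to a later `p (2 + k + d)` lowers its mean; this bounds the loss, so that the
  -- mean stays above that of `p k`. For d = 0 the loss is paid by the surplus in
  -- `logConvex (suc k)`, after M 1 ≤ M k, which uses k ≥ 1. Log-convexity carries the estimate to
  -- larger d.
  gap : ∀ k d → 1 ≤ k → M (3 + k + d) * M k ≥ M (2 + k + d) * M (suc k) + M (suc k) * M 1
  gap k zero h rewrite +-identityʳ k = *-cancelʳ-≤ _ _ (M (suc k)) ⦃ >-nonZero (M-pos (suc k)) ⦄ (begin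
    (M₂ * M₁ + M₁ * M 1) * M₁        ≤⟨ *-monoˡ-≤ M₁ (+-monoʳ-≤ (M₂ * M₁) (*-monoʳ-≤ M₁ (M-mono-≤ h))) ⟩
    (M₂ * M₁ + M₁ * M₀) * M₁         ≡⟨ lem M₀ M₁ M₂ ⟩
    M₂ * (M₁ * M₁) + M₁ * M₁ * M₀    ≤⟨ +-monoˡ-≤ _ (*-monoʳ-≤ M₂ (m+n≤o⇒m≤o _ (logConvex k))) ⟩
    M₂ * (M₂ * M₀) + M₁ * M₁ * M₀    ≡⟨ lem′ M₀ M₁ M₂ ⟩
    (M₂ * M₂ + M₁ * M₁) * M₀         ≤⟨ *-monoˡ-≤ M₀ (logConvex (suc k)) ⟩
    M₃ * M₁ * M₀                     ≡⟨ lem″ M₀ M₁ M₃ ⟩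
    M₃ * M₀ * M₁                     ∎)
    where
    open ≤-Reasoning
    M₀ = M k
    M₁ = M (suc k)
    M₂ = M (2 + k)
    M₃ = M (3 + k)
    lem : ∀ a b c → (c * b + b * a) * b ≡ c * (b * b) + b * b * a
    lem = solve-∀
    lem′ : ∀ a b c → c * (c * a) + b * b * a ≡ (c * c + b * b) * a
    lem′ = solve-∀
    lem″ : ∀ a b c → c * b * a ≡ c * a * b
    lem″ = solve-∀
  gap k (suc d) h rewrite +-suc k d = *-cancelʳ-≤ _ _ A ⦃ >-nonZero (M-pos (2 + k + d)) ⦄ (begin
    (A′ * M (suc k) + M (suc k) * M 1) * A          ≡⟨ lem A A′ (M (suc k)) (M 1) ⟩
    A′ * (A * M (suc k)) + A * (M (suc k) * M 1)    ≤⟨ +-monoʳ-≤ (A′ * (A * M (suc k))) (*-monoˡ-≤ _ (M-mono (2 + k + d))) ⟩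
    A′ * (A * M (suc k)) + A′ * (M (suc k) * M 1)   ≡⟨ *-distribˡ-+ A′ _ _ ⟨
    A′ * (A * M (suc k) + M (suc k) * M 1)          ≤⟨ *-monoʳ-≤ A′ (gap k d h) ⟩
    A′ * (A′ * M k)                                 ≡⟨ *-assoc A′ A′ (M k) ⟨
    A′ * A′ * M k                                   ≤⟨ *-monoˡ-≤ (M k) (m+n≤o⇒m≤o (A′ * A′) (logConvex (2 + k + d))) ⟩
    A″ * A * M k                                    ≡⟨ lem′ A″ A (M k) ⟩
    A″ * M k * A                                    ∎)
    where
    open ≤-Reasoning
    A  = M (2 + k + d)
    A′ = M (3 + k + d)
    A″ = M (4 + k + d)
    lem : ∀ a b c e → (b * c + c * e) * a ≡ b * (a * c) + a * (c * e)
    lem = solve-∀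
    lem′ : ∀ a b c → a * b * c ≡ a * c * b
    lem′ = solve-∀

  p-⊏-p⊹p₁ : ∀ k d → 1 ≤ k → p k ⊏ p (2 + k + d) ⊹ p 1
  p-⊏-p⊹p₁ k d h = begin-strict
    M (suc k) * (M (2 + k + d) + M 1)                 ≡⟨ lem (M (suc k)) (M (2 + k + d)) (M 1) ⟩
    M (2 + k + d) * M (suc k) + M (suc k) * M 1       ≤⟨ gap k d h ⟩
    M (3 + k + d) * M k                               <⟨ m<m+n _ (*-mono-< (M-pos 2) (M-pos k)) ⟩
    M (3 + k + d) * M k + M 2 * M k                   ≡⟨ *-distribʳ-+ (M k) (M (3 + k + d)) (M 2) ⟨
    (M (3 + k + d) + M 2) * M k                       ∎
    where
    open ≤-Reasoning
    lem : ∀ a b c → a * (b + c) ≡ b * a + a * c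
    lem = solve-∀

  -- With u and v the moments 2 + a and 3 + a, and with d and e the increments from u to v and from
  -- v on, log-convexity gives e/d ≥ v/u ≥ M 2 / M 1. The inequalities `main` and `main₂` are e/d ≥
  -- v/u and e/d ≥ M 2 / M 1 with denominators cleared.
  p⊹p₁-step : ∀ a → p (2 + a) ⊹ p 1 ⊑ p (3 + a) ⊹ p 1
  p⊹p₁-step a with m≤n⇒∃[o]m+o≡n (M-mono (2 + a)) | m≤n⇒∃[o]m+o≡n (M-mono (3 + a))
  ... | d , eq₁ | e , eq₂ = begin
    (v + M 2) * (v + M 1)                    ≡⟨ cong (λ z → (z + M 2) * (z + M 1)) (sym eq₁) ⟩
    (u + d + M 2) * (u + d + M 1)            ≡⟨ lem u d (M 1) (M 2) ⟩
    u * d + d * d + (M 2 * d + ((u + d) * (u + M 1) + M 2 * (u + M 1)))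
      ≤⟨ +-mono-≤ main (+-monoˡ-≤ _ main₂) ⟩
    e * u + (M 1 * e + ((u + d) * (u + M 1) + M 2 * (u + M 1)))
      ≡⟨ lem′ u d e (M 1) (M 2) ⟩
    (u + d + e + M 2) * (u + M 1)            ≡⟨ cong (λ z → (z + e + M 2) * (u + M 1)) eq₁ ⟩
    (v + e + M 2) * (u + M 1)                ≡⟨ cong (λ z → (z + M 2) * (u + M 1)) eq₂ ⟩
    (M (4 + a) + M 2) * (u + M 1)            ∎
    where
    open ≤-Reasoning
    u = M (2 + a)
    v = M (3 + a)
    lem : ∀ u d m n → (u + d + n) * (u + d + m) ≡ u * d + d * d + (n * d + ((u + d) * (u + m) + n * (u + m)))
    lem = solve-∀
    lem′ : ∀ u d e m n → e * u + (m * e + ((u + d) * (u + m) + n * (u + m))) ≡ (u + d + e + n) * (u + m)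
    lem′ = solve-∀
    lem₁ : ∀ u d → (u + d) * (u + d) ≡ (u * d + d * d) + (u + d) * u
    lem₁ = solve-∀
    main : u * d + d * d ≤ e * u
    main = +-cancelʳ-≤ ((u + d) * u) _ _ (begin
      u * d + d * d + (u + d) * u ≡⟨ lem₁ u d ⟨
      (u + d) * (u + d)           ≡⟨ cong (λ z → z * z) eq₁ ⟩
      v * v                       ≤⟨ m+n≤o⇒m≤o _ (logConvex (2 + a)) ⟩
      M (4 + a) * u               ≡⟨ cong (_* u) (sym eq₂) ⟩
      (v + e) * u                 ≡⟨ cong (λ z → (z + e) * u) (sym eq₁) ⟩
      (u + d + e) * u             ≡⟨ lem₃ u d e ⟩
      e * u + (u + d) * u         ∎)
      where
      lem₃ : ∀ u d e → (u + d + e) * u ≡ e * u + (u + d) * u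
      lem₃ = solve-∀
    lem₄ : ∀ u d m → (u + d) * m * d ≡ m * (u * d + d * d)
    lem₄ = solve-∀
    main₂ : M 2 * d ≤ M 1 * e
    main₂ = *-cancelʳ-≤ _ _ u ⦃ >-nonZero (M-pos (2 + a)) ⦄ (begin
      M 2 * d * u           ≡⟨ lem₅ (M 2) d u ⟩
      M 2 * u * d           ≤⟨ *-monoˡ-≤ d (<⇒≤ (p-increasing 1 a)) ⟩
      v * M 1 * d           ≡⟨ cong (λ z → z * M 1 * d) (sym eq₁) ⟩
      (u + d) * M 1 * d     ≡⟨ lem₄ u d (M 1) ⟩
      M 1 * (u * d + d * d) ≤⟨ *-monoʳ-≤ (M 1) main ⟩
      M 1 * (e * u)         ≡⟨ *-assoc (M 1) e u ⟨
      M 1 * e * u           ∎)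
      where
      lem₅ : ∀ a b c → a * b * c ≡ a * c * b
      lem₅ = solve-∀

-- A path with m edges whose first vertex has colour a and whose last vertex must avoid the colour z
-- has e m y (if a = z) or o m y (if a ≠ z) proper colourings with y + 1 colours.
e o : ℕ → ℕ → ℕ
e zero    y = 0
e (suc m) y = y * o m y
o zero    y = 1
o (suc m) y = e m y + (y ∸ 1) * o m y

-- Deletion-contraction: (y + 1) e m y counts the colourings of the cycle with m + 1 vertices, and a
-- cycle with an edge removed is a path, with it contracted a shorter cycle.
e+e : ∀ m y → e m y + e (suc m) y ≡ y ^ suc m
e+e zero    y       = refl
e+e (suc m) zero    = refl
e+e (suc m) (suc z) = trans (lem (suc z) z (e m (suc z)) (o m (suc z)))
  (cong (suc z *_) (e+e m (suc z)))
  where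
  lem : ∀ y z a b → y * b + y * (a + z * b) ≡ y * (a + suc z * b)
  lem = solve-∀

e-zero : ∀ m → e m 0 ≡ 0
e-zero zero    = refl
e-zero (suc m) = refl

-- Deletion-contraction twice, with y^(m+2) - y^(m+1) = (y - 1) y^(m+1). It makes the recursion for
-- cycles free of signs.
e-step : ∀ m y → e (2 + m) y ≡ e m y + (y ∸ 1) * y ^ suc m
e-step m zero    = sym (trans (+-identityʳ _) (e-zero m))
e-step m (suc z) rewrite sym (e+e m (suc z)) = lem z (e m (suc z)) (o m (suc z))
  where
  lem : ∀ z a b → suc z * (a + z * b) ≡ a + z * (a + suc z * b)
  lem = solve-∀

k₁ k₂ k₃ : Seq
k₁ = 0 ∷ 1 ∷ []
k₂ = 0 ∷ 0 ∷ 1 ∷ []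
k₃ = 0 ∷ 0 ∷ 0 ∷ 1 ∷ []

eval-k₁ : ∀ x → eval k₁ x ≡ x
eval-k₁ x = trans (eval-0∷ (1 ∷ []) x) (trans (cong (x *_) (eval-[-] 1 (x ∸ 1))) (*-identityʳ x))

eval-k₂ : ∀ x → eval k₂ x ≡ x * (x ∸ 1)
eval-k₂ x = trans (eval-0∷ k₁ x) (cong (x *_) (eval-k₁ (x ∸ 1)))

eval-k₃ : ∀ x → eval k₃ x ≡ x * ((x ∸ 1) * (x ∸ 2))
eval-k₃ x = trans (eval-0∷ k₂ x) (cong (x *_) (trans (eval-k₂ (x ∸ 1)) (cong ((x ∸ 1) *_) (∸-+-assoc x 1 1))))

path : ℕ → Seq
path m = mul-x-1 m k₁

eval-path : ∀ m x → eval (path m) x ≡ x * (x ∸ 1) ^ m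
eval-path m x = trans (eval-mul-x-1 m k₁ (refl , tt) x)
  (trans (cong ((x ∸ 1) ^ m *_) (eval-k₁ x)) (*-comm _ x))

-- The index is one less than the number of vertices. The initial values are those of a loop, which
-- has no colouring, and of a double edge, which counts as K₂.
cycle : ℕ → Seq
cycle zero          = []
cycle (suc zero)    = k₂
cycle (suc (suc m)) = cycle m ⊕ mul-x-1 m k₃

eval-cycle : ∀ m x → eval (cycle m) x ≡ x * e m (x ∸ 1)
eval-cycle zero          x = sym (*-zeroʳ x)
eval-cycle (suc zero)    x = trans (eval-k₂ x) (cong (x *_) (sym (*-identityʳ (x ∸ 1))))
eval-cycle (suc (suc m)) x = begin
  eval (cycle m ⊕ mul-x-1 m k₃) x
    ≡⟨ eval-⊕ (cycle m) (mul-x-1 m k₃) x ⟩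
  eval (cycle m) x + eval (mul-x-1 m k₃) x
    ≡⟨ cong₂ _+_ (eval-cycle m x) (eval-mul-x-1 m k₃ (refl , tt) x) ⟩
  x * e m y + y ^ m * eval k₃ x
    ≡⟨ cong (λ z → x * e m y + y ^ m * z) (eval-k₃ x) ⟩
  x * e m y + y ^ m * (x * (y * (x ∸ 2)))
    ≡⟨ cong (λ z → x * e m y + y ^ m * (x * (y * z))) (sym (∸-+-assoc x 1 1)) ⟩
  x * e m y + y ^ m * (x * (y * (y ∸ 1)))
    ≡⟨ lem x y (y ∸ 1) (e m y) (y ^ m) ⟩
  x * (e m y + (y ∸ 1) * y ^ suc m)
    ≡⟨ cong (x *_) (e-step m y) ⟨
  x * e (2 + m) y ∎
  where
  open ≡-Reasoning
  y = x ∸ 1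
  lem : ∀ x y z a b → x * a + b * (x * (y * z)) ≡ x * (a + z * (y * b))
  lem = solve-∀

-- Both sides share the factor x yⁱ w, which becomes the context V. There remain y³ and x(x - 1)(x -
-- 2) = y³ - y, to be compared in falling factorials of y; this is why `conv` starts at 1.
path-⊏ : ∀ i w → 0 < sum w → pr (path (3 + i) ⊛ w) ⊏ pr ((k₃ ⊛ path i) ⊛ w)
path-⊏ i w w>0 = subst₂ _⊏_ (pr-≈ (conv f 1 V) (path (3 + i) ⊛ w) eq₁) (pr-≈ (conv g 1 V) ((k₃ ⊛ path i) ⊛ w) eq₂)
  (conv-⊏ f g 1 V V-supp V>0 refl refl)
  where
  -- f is y³, with Stirling numbers of the second kind as coefficients; in g = y³ - y the lowest of
  -- them has disappeared.
  f g : Seq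
  f = 0 ∷ 1 ∷ 3 ∷ 1 ∷ []
  g = 0 ∷ 0 ∷ 3 ∷ 1 ∷ []
  V : Seq
  V = mul-x-1 i (w ⊛ k₁)
  w⊛k₁-supp : Supp 1 (w ⊛ k₁)
  w⊛k₁-supp = Supp-⊛ 1 w k₁ (refl , tt)
  V-supp : Supp 1 V
  V-supp = Supp-mul-x-1 0 i (w ⊛ k₁) w⊛k₁-supp
  V>0 : 0 < sum V
  V>0 = Moments.M-pos (w ⊛ k₁) w⊛k₁-supp (sum-conv>0 w 0 k₁ tt w>0 (s≤s z≤n)) i
  eval-V : ∀ x → eval V x ≡ x * (x ∸ 1) ^ i * eval w x
  eval-V x = trans (eval-mul-x-1 i (w ⊛ k₁) w⊛k₁-supp x)
    (trans (cong ((x ∸ 1) ^ i *_) (trans (eval-⊛ w k₁ x) (cong (eval w x *_) (eval-k₁ x)))) (lem x ((x ∸ 1) ^ i) (eval w x)))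
    where
    lem : ∀ x a b → a * (b * x) ≡ x * a * b
    lem = solve-∀
  eval-f : ∀ y → eval f y ≡ y * (y * y)
  eval-f zero                = refl
  eval-f (suc zero)          = refl
  eval-f (suc (suc zero))    = refl
  eval-f (suc (suc (suc y))) = trans (cong (λ z → (3 + y) * (1 + (2 + y) * (3 + suc y * z))) (eval-[-] 1 y)) (lem y)
    where
    lem : ∀ y → (3 + y) * (1 + (2 + y) * (3 + suc y * 1)) ≡ (3 + y) * ((3 + y) * (3 + y))
    lem = solve-∀
  eval-g : ∀ x → eval k₃ x ≡ eval g (x ∸ 1)
  eval-g zero                      = refl
  eval-g (suc zero)                = refl
  eval-g (suc (suc zero))          = refl
  eval-g (suc (suc (suc zero)))    = refl
  eval-g (suc (suc (suc (suc y)))) = trans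
    (cong (λ z → (4 + y) * ((3 + y) * ((2 + y) * z))) (eval-[-] 1 (suc y)))
    (trans (lem y) (cong (λ z → (3 + y) * ((2 + y) * (3 + suc y * z))) (sym (eval-[-] 1 y))))
    where
    lem : ∀ y → (4 + y) * ((3 + y) * ((2 + y) * 1)) ≡ (3 + y) * ((2 + y) * (3 + suc y * 1))
    lem = solve-∀
  eq₁ : conv f 1 V ≈ path (3 + i) ⊛ w
  eq₁ x = begin
    eval (conv f 1 V) x                        ≡⟨ eval-conv f 1 V V-supp x ⟩
    eval f y * eval V x                        ≡⟨ cong₂ _*_ (eval-f y) (eval-V x) ⟩
    y * (y * y) * (x * y ^ i * eval w x)       ≡⟨ lem x y (y ^ i) (eval w x) ⟩
    x * (y * (y * (y * y ^ i))) * eval w x     ≡⟨ cong (_* eval w x) (eval-path (3 + i) x) ⟨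
    eval (path (3 + i)) x * eval w x           ≡⟨ eval-⊛ (path (3 + i)) w x ⟨
    eval (path (3 + i) ⊛ w) x                  ∎
    where
    open ≡-Reasoning
    y = x ∸ 1
    lem : ∀ x y a b → y * (y * y) * (x * a * b) ≡ x * (y * (y * (y * a))) * b
    lem = solve-∀
  eq₂ : conv g 1 V ≈ (k₃ ⊛ path i) ⊛ w
  eq₂ x = begin
    eval (conv g 1 V) x                        ≡⟨ eval-conv g 1 V V-supp x ⟩
    eval g y * eval V x                        ≡⟨ cong₂ _*_ (sym (eval-g x)) (eval-V x) ⟩
    eval k₃ x * (x * y ^ i * eval w x)         ≡⟨ *-assoc (eval k₃ x) _ _ ⟨
    eval k₃ x * (x * y ^ i) * eval w x         ≡⟨ cong (λ z → eval k₃ x * z * eval w x) (eval-path i x) ⟨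
    eval k₃ x * eval (path i) x * eval w x     ≡⟨ cong (_* eval w x) (eval-⊛ k₃ (path i) x) ⟨
    eval (k₃ ⊛ path i) x * eval w x            ≡⟨ eval-⊛ (k₃ ⊛ path i) w x ⟨
    eval ((k₃ ⊛ path i) ⊛ w) x                 ∎
    where
    open ≡-Reasoning
    y = x ∸ 1

path-≺ : ∀ i → path (3 + i) ≺ k₃ ⊛ path i
path-≺ i = ≺-intro (path-⊏ i)

-- Splitting a triangle off a long cycle

module CycleReduction (w : Seq) (w>0 : 0 < sum w) where

  -- With y = x − 1, the sequence r is s (y² − y + 1).
  s z r : Seq
  s = w ⊛ k₃
  z = w ⊛ k₂
  r = mulSub 2 (mulSub 1 s) ⊕ s

  s-supp : Supp 3 s
  s-supp = Supp-⊛ 3 w k₃ (refl , refl , refl , tt)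

  z-supp : Supp 2 z
  z-supp = Supp-⊛ 2 w k₂ (refl , refl , tt)

  r-supp : Supp 1 r
  r-supp = Supp-⊕ 1 (mulSub 2 (mulSub 1 s)) s
    (Supp-weaken {1} {3} _ (s≤s z≤n) (Supp-mulSub′ 2 3 _ (s≤s (s≤s z≤n)) (Supp-mulSub′ 1 3 s (s≤s z≤n) s-supp)))
    (Supp-weaken {1} {3} s (s≤s z≤n) s-supp)

  s>0 : 0 < sum s
  s>0 = sum-conv>0 w 0 k₃ tt w>0 (s≤s z≤n)

  r>0 : 0 < sum r
  r>0 = subst (0 <_) (sym (sum-⊕ (mulSub 2 (mulSub 1 s)) s)) (≤-trans s>0 (m≤n+m (sum s) _))

  open Moments s (Supp-weaken {1} {3} s (s≤s z≤n) s-supp) s>0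
  module R = Moments r r-supp r>0

  eval-s : ∀ x → eval s x ≡ eval w x * eval k₃ x
  eval-s = eval-⊛ w k₃

  eval-y : ∀ j x → eval (mul-x-1 j s) x ≡ (x ∸ 1) ^ j * eval s x
  eval-y j = eval-mul-x-1 j s (Supp-weaken {1} {3} s (s≤s z≤n) s-supp)

  eval-r : ∀ x → eval r x ≡ ((x ∸ 2) * (x ∸ 1) + 1) * eval s x
  eval-r x = begin
    eval r x                                            ≡⟨ eval-⊕ (mulSub 2 (mulSub 1 s)) s x ⟩
    eval (mulSub 2 (mulSub 1 s)) x + eval s x           ≡⟨ cong (_+ eval s x) (trans (eval-mulSub 2 (mulSub 1 s) ys-supp x)
                                                            (cong ((x ∸ 2) *_) (eval-mulSub 1 s (Supp-weaken {1} {3} s (s≤s z≤n) s-supp) x))) ⟩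
    (x ∸ 2) * ((x ∸ 1) * eval s x) + eval s x           ≡⟨ lem (x ∸ 2) (x ∸ 1) (eval s x) ⟩
    ((x ∸ 2) * (x ∸ 1) + 1) * eval s x                  ∎
    where
    open ≡-Reasoning
    ys-supp : Supp 2 (mulSub 1 s)
    ys-supp = Supp-weaken {2} {3} _ (s≤s (s≤s z≤n)) (Supp-mulSub′ 1 3 s (s≤s z≤n) s-supp)
    lem : ∀ a b c → a * (b * c) + c ≡ (a * b + 1) * c
    lem = solve-∀

  z⊏p₀ : pr z ⊏ p 0
  z⊏p₀ = subst (pr z ⊏_) (trans (pr-≈ (mulSub 2 z) s eq) (pr≡p 0))
    (pr-mulSub 2 z z-supp (sum-conv>0 w 0 k₂ tt w>0 (s≤s z≤n)))
    where
    lem : ∀ a b c d → a * (d * (b * c)) ≡ d * (b * (c * a))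
    lem = solve-∀
    eq : mulSub 2 z ≈ s
    eq x = trans (eval-mulSub 2 z z-supp x) (trans (cong ((x ∸ 2) *_) (trans (eval-⊛ w k₂ x) (cong (eval w x *_) (eval-k₂ x))))
      (trans (lem (x ∸ 2) x (x ∸ 1) (eval w x)) (trans (cong (eval w x *_) (sym (eval-k₃ x))) (sym (eval-s x)))))

  pr-cycle-step : ∀ m → pr (cycle (2 + m) ⊛ w) ≡ pr (cycle m ⊛ w) ⊹ p m
  pr-cycle-step m = trans (pr-≈ (cycle (2 + m) ⊛ w) ((cycle m ⊛ w) ⊕ mul-x-1 m s) eq)
    (trans (pr-⊕ (cycle m ⊛ w) (mul-x-1 m s)) (cong (pr (cycle m ⊛ w) ⊹_) (pr≡p m)))
    where
    lem : ∀ a b c → a * b * c ≡ a * (c * b)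
    lem = solve-∀
    eq : cycle (2 + m) ⊛ w ≈ (cycle m ⊛ w) ⊕ mul-x-1 m s
    eq x = begin
      eval ((cycle m ⊕ mul-x-1 m k₃) ⊛ w) x                   ≡⟨ ⊛-distribʳ (cycle m) (mul-x-1 m k₃) w x ⟩
      eval ((cycle m ⊛ w) ⊕ (mul-x-1 m k₃ ⊛ w)) x             ≡⟨ eval-⊕ (cycle m ⊛ w) (mul-x-1 m k₃ ⊛ w) x ⟩
      eval (cycle m ⊛ w) x + eval (mul-x-1 m k₃ ⊛ w) x        ≡⟨ cong (eval (cycle m ⊛ w) x +_) (begin
        eval (mul-x-1 m k₃ ⊛ w) x               ≡⟨ eval-⊛ (mul-x-1 m k₃) w x ⟩
        eval (mul-x-1 m k₃) x * eval w x        ≡⟨ cong (_* eval w x) (eval-mul-x-1 m k₃ (refl , tt) x) ⟩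
        (x ∸ 1) ^ m * eval k₃ x * eval w x      ≡⟨ lem ((x ∸ 1) ^ m) (eval k₃ x) (eval w x) ⟩
        (x ∸ 1) ^ m * (eval w x * eval k₃ x)    ≡⟨ cong ((x ∸ 1) ^ m *_) (eval-s x) ⟨
        (x ∸ 1) ^ m * eval s x                  ≡⟨ eval-y m x ⟨
        eval (mul-x-1 m s) x                    ∎) ⟩
      eval (cycle m ⊛ w) x + eval (mul-x-1 m s) x             ≡⟨ eval-⊕ (cycle m ⊛ w) (mul-x-1 m s) x ⟨
      eval ((cycle m ⊛ w) ⊕ mul-x-1 m s) x                    ∎
      where open ≡-Reasoning

  -- x e(m, y) = y^(m+1) ∓ y with the sign alternating in m.
  x*e-odd : ∀ i x → x * e (suc (2 * i)) (x ∸ 1) ≡ (x ∸ 1) ^ (2 + 2 * i) + (x ∸ 1)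
  x*e-even : ∀ i x → x * e (2 * i) (x ∸ 1) + (x ∸ 1) ≡ (x ∸ 1) ^ (1 + 2 * i)
  x*e-odd i zero    = refl
  x*e-odd i (suc y) = +-cancelˡ-≡ (y ^ suc (2 * i)) _ _ (begin
    y ^ suc (2 * i) + suc y * e₁                         ≡⟨ cong (_+ suc y * e₁) (sym (x*e-even i (suc y))) ⟩
    suc y * e₀ + y + suc y * e₁                          ≡⟨ lem y e₀ e₁ ⟩
    suc y * (e₀ + e₁) + y                                ≡⟨ cong (λ t → suc y * t + y) (e+e (2 * i) y) ⟩
    suc y * y ^ suc (2 * i) + y                          ≡⟨ lem′ y (y ^ suc (2 * i)) ⟩
    y ^ suc (2 * i) + (y ^ (2 + 2 * i) + y)              ∎)
    where
    open ≡-Reasoning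
    e₀ = e (2 * i) y
    e₁ = e (suc (2 * i)) y
    lem : ∀ y a b → suc y * a + y + suc y * b ≡ suc y * (a + b) + y
    lem = solve-∀
    lem′ : ∀ y a → suc y * a + y ≡ a + (y * a + y)
    lem′ = solve-∀
  x*e-even zero    x = trans (cong (_+ (x ∸ 1)) (*-zeroʳ x)) (sym (*-identityʳ (x ∸ 1)))
  x*e-even (suc i) zero    = refl
  x*e-even (suc i) (suc y) = subst (λ n → suc y * e n y + y ≡ y ^ suc n) (sym (*-suc 2 i)) (+-cancelˡ-≡ (y ^ (2 + 2 * i)) _ _ (begin
    y ^ (2 + 2 * i) + (suc y * e₂ + y)                   ≡⟨ lem y (y ^ (2 + 2 * i)) e₂ ⟩
    y ^ (2 + 2 * i) + y + suc y * e₂                     ≡⟨ cong (_+ suc y * e₂) (sym (x*e-odd i (suc y))) ⟩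
    suc y * e₁ + suc y * e₂                              ≡⟨ *-distribˡ-+ (suc y) e₁ e₂ ⟨
    suc y * (e₁ + e₂)                                    ≡⟨ cong (suc y *_) (e+e (suc (2 * i)) y) ⟩
    suc y * y ^ (2 + 2 * i)                              ≡⟨⟩
    y ^ (2 + 2 * i) + y * y ^ (2 + 2 * i)                ∎))
    where
    open ≡-Reasoning
    e₁ = e (suc (2 * i)) y
    e₂ = e (2 + 2 * i) y
    lem : ∀ y a b → a + (suc y * b + y) ≡ a + y + suc y * b
    lem = solve-∀

  -- The value to be reached: K₃ beside the cycle on n + 1 vertices, in the context w.
  g : ℕ → ℕ × ℕ
  g n = pr ((k₃ ⊛ cycle n) ⊛ w)

  eval-g : ∀ n x → eval ((k₃ ⊛ cycle n) ⊛ w) x ≡ x * e n (x ∸ 1) * eval s x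
  eval-g n x = begin
    eval ((k₃ ⊛ cycle n) ⊛ w) x                    ≡⟨ eval-⊛ (k₃ ⊛ cycle n) w x ⟩
    eval (k₃ ⊛ cycle n) x * eval w x               ≡⟨ cong (_* eval w x) (eval-⊛ k₃ (cycle n) x) ⟩
    eval k₃ x * eval (cycle n) x * eval w x        ≡⟨ lem (eval k₃ x) (eval (cycle n) x) (eval w x) ⟩
    eval (cycle n) x * (eval w x * eval k₃ x)      ≡⟨ cong₂ _*_ (eval-cycle n x) (sym (eval-s x)) ⟩
    x * e n (x ∸ 1) * eval s x                     ∎
    where
    open ≡-Reasoning
    lem : ∀ a b c → a * b * c ≡ b * (c * a)
    lem = solve-∀

  g-odd : ∀ i → g (suc (2 * i)) ≡ p (2 + 2 * i) ⊹ p 1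
  g-odd i = trans (pr-≈ ((k₃ ⊛ cycle (suc (2 * i))) ⊛ w) (mul-x-1 (2 + 2 * i) s ⊕ mul-x-1 1 s) eq)
    (trans (pr-⊕ (mul-x-1 (2 + 2 * i) s) (mul-x-1 1 s)) (cong₂ _⊹_ (pr≡p (2 + 2 * i)) (pr≡p 1)))
    where
    lem : ∀ a y c → (a + y) * c ≡ a * c + y * 1 * c
    lem = solve-∀
    eq : (k₃ ⊛ cycle (suc (2 * i))) ⊛ w ≈ mul-x-1 (2 + 2 * i) s ⊕ mul-x-1 1 s
    eq x = begin
      eval ((k₃ ⊛ cycle (suc (2 * i))) ⊛ w) x                ≡⟨ eval-g (suc (2 * i)) x ⟩
      x * e (suc (2 * i)) (x ∸ 1) * eval s x                 ≡⟨ cong (_* eval s x) (x*e-odd i x) ⟩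
      ((x ∸ 1) ^ (2 + 2 * i) + (x ∸ 1)) * eval s x           ≡⟨ lem ((x ∸ 1) ^ (2 + 2 * i)) (x ∸ 1) (eval s x) ⟩
      (x ∸ 1) ^ (2 + 2 * i) * eval s x + (x ∸ 1) ^ 1 * eval s x ≡⟨ cong₂ _+_ (eval-y (2 + 2 * i) x) (eval-y 1 x) ⟨
      eval (mul-x-1 (2 + 2 * i) s) x + eval (mul-x-1 1 s) x  ≡⟨ eval-⊕ (mul-x-1 (2 + 2 * i) s) (mul-x-1 1 s) x ⟨
      eval (mul-x-1 (2 + 2 * i) s ⊕ mul-x-1 1 s) x           ∎
      where open ≡-Reasoning

  -- For an odd number of vertices the closed form is y^(1+2i) - y; adding `p 1` to both sides
  -- avoids the subtraction.
  g-even : ∀ i → g (2 * i) ⊹ p 1 ≡ p (1 + 2 * i)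
  g-even i = trans (sym (trans (pr-⊕ ((k₃ ⊛ cycle (2 * i)) ⊛ w) (mul-x-1 1 s)) (cong (g (2 * i) ⊹_) (pr≡p 1))))
    (trans (pr-≈ (((k₃ ⊛ cycle (2 * i)) ⊛ w) ⊕ mul-x-1 1 s) (mul-x-1 (1 + 2 * i) s) eq) (pr≡p (1 + 2 * i)))
    where
    lem : ∀ a y c → a * c + y * 1 * c ≡ (a + y) * c
    lem = solve-∀
    eq : ((k₃ ⊛ cycle (2 * i)) ⊛ w) ⊕ mul-x-1 1 s ≈ mul-x-1 (1 + 2 * i) s
    eq x = begin
      eval (((k₃ ⊛ cycle (2 * i)) ⊛ w) ⊕ mul-x-1 1 s) x      ≡⟨ eval-⊕ ((k₃ ⊛ cycle (2 * i)) ⊛ w) (mul-x-1 1 s) x ⟩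
      eval ((k₃ ⊛ cycle (2 * i)) ⊛ w) x + eval (mul-x-1 1 s) x ≡⟨ cong₂ _+_ (eval-g (2 * i) x) (eval-y 1 x) ⟩
      x * e (2 * i) (x ∸ 1) * eval s x + (x ∸ 1) ^ 1 * eval s x ≡⟨ lem (x * e (2 * i) (x ∸ 1)) (x ∸ 1) (eval s x) ⟩
      (x * e (2 * i) (x ∸ 1) + (x ∸ 1)) * eval s x           ≡⟨ cong (_* eval s x) (x*e-even i x) ⟩
      (x ∸ 1) ^ (1 + 2 * i) * eval s x                       ≡⟨ eval-y (1 + 2 * i) x ⟨
      eval (mul-x-1 (1 + 2 * i) s) x                         ∎
      where open ≡-Reasoning

  odd-sum-⊏ : ∀ q n → pr z ⊏ q → (∀ j → j < n → p (1 + 2 * j) ⊏ q) → pr (cycle (1 + 2 * n) ⊛ w) ⊏ q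
  odd-sum-⊏ q zero    hz h = subst (_⊏ q) (pr-≈ z (k₂ ⊛ w) eq) hz
    where
    eq : z ≈ k₂ ⊛ w
    eq x = trans (eval-⊛ w k₂ x) (trans (*-comm (eval w x) _) (sym (eval-⊛ k₂ w x)))
  odd-sum-⊏ q (suc n) hz h = subst (λ m → pr (cycle (suc m) ⊛ w) ⊏ q) (sym (*-suc 2 n))
    (subst (_⊏ q) (sym (pr-cycle-step (suc (2 * n)))) (⊏-⊹ˡ (pr (cycle (1 + 2 * n) ⊛ w)) (p (1 + 2 * n)) q (odd-sum-⊏ q n hz (λ j h′ → h j (m<n⇒m<1+n h′))) (h n ≤-refl)))

  -- The cycle is the sum of z and the terms `p (1 + 2 * j)`, the last of which is `p a`. The target
  -- G is `p a` with `p 1` taken away; as `p 1` has the smaller mean, this raises the mean, so every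
  -- single term lies below G.
  cycle-odd : ∀ i → pr (cycle (5 + 2 * i) ⊛ w) ⊏ g (2 + 2 * i)
  cycle-odd i = subst (λ n → pr (cycle (suc n) ⊛ w) ⊏ g (2 + 2 * i)) (lem i)
    (odd-sum-⊏ (g (2 + 2 * i)) (2 + i) (⊏-trans (pr z) (p 0) (g (2 + 2 * i)) z⊏p₀ (⊏-trans (p 0) (p 1) (g (2 + 2 * i)) (p-step 0) p₁⊏g)) pⱼ⊏g)
    where
    lem : ∀ i → 2 * (2 + i) ≡ 4 + 2 * i
    lem = solve-∀
    a = 3 + 2 * i
    G = g (2 + 2 * i)
    g-eq : G ⊹ p 1 ≡ p a
    g-eq = subst (λ n → g n ⊹ p 1 ≡ p (suc n)) (*-suc 2 i) (g-even (suc i))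
    p₁⊏g : p 1 ⊏ G
    p₁⊏g = +-cancelʳ-< (M 2 * M 1) _ _ (subst₂ _<_ (*-distribˡ-+ (M 2) (proj₂ G) (M 1)) (*-distribʳ-+ (M 1) (proj₁ G) (M 2))
      (subst (p 1 ⊏_) (sym g-eq) (p-increasing 1 (suc (2 * i)))))
    pₐ⊏g : p a ⊏ G
    pₐ⊏g = subst (_⊏ G) (trans (cong₂ _,_ (+-comm (M 2) (proj₁ G)) (+-comm (M 1) (proj₂ G))) g-eq)
      (⊏-self-⊹ (p 1) G p₁⊏g)
    pⱼ⊏g : ∀ j → j < 2 + i → p (1 + 2 * j) ⊏ G
    pⱼ⊏g j (s≤s h) with m≤n⇒m<n∨m≡n h
    ... | inj₂ refl = subst (λ n → p (suc n) ⊏ G) (sym (*-suc 2 i)) pₐ⊏g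
    ... | inj₁ h′   = ⊏-trans (p (1 + 2 * j)) (p a) G (p-< (s≤s (≤-trans (*-monoʳ-< 2 h′) (≤-reflexive (*-suc 2 i))))) pₐ⊏g

  -- The cycle on five vertices contributes s (y² + 1) = s (y² - y + 1) + s y. The split releases
  -- one `p 1`, which the target of the odd cycles contains.
  r⊹p₁ : R.p 0 ⊹ p 1 ≡ p 2 ⊹ p 0
  r⊹p₁ = trans (sym (trans (pr-⊕ r (mul-x-1 1 s)) (cong₂ _⊹_ (R.pr≡p 0) (pr≡p 1))))
    (trans (pr-≈ (r ⊕ mul-x-1 1 s) (mul-x-1 2 s ⊕ s) eq) (trans (pr-⊕ (mul-x-1 2 s) s) (cong₂ _⊹_ (pr≡p 2) (pr≡p 0))))
    where
    lem : ∀ x c → ((x ∸ 2) * (x ∸ 1) + 1) * c + (x ∸ 1) ^ 1 * c ≡ (x ∸ 1) ^ 2 * c + c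
    lem zero          = solve-∀
    lem (suc zero)    = solve-∀
    lem (suc (suc x)) = lem′ x
      where
      lem′ : ∀ x c → (x * suc x + 1) * c + suc x * 1 * c ≡ suc x * (suc x * 1) * c + c
      lem′ = solve-∀
    eq : r ⊕ mul-x-1 1 s ≈ mul-x-1 2 s ⊕ s
    eq x = trans (eval-⊕ r (mul-x-1 1 s) x) (trans (cong₂ _+_ (eval-r x) (eval-y 1 x))
      (trans (lem x (eval s x)) (sym (trans (eval-⊕ (mul-x-1 2 s) s x) (cong (_+ eval s x) (eval-y 2 x))))))

  -- From (y² + y)(y² - y + 1) = y⁴ + y: the smallest target is made of y² r and y r.
  r⊹r : R.p 2 ⊹ R.p 1 ≡ p 4 ⊹ p 1
  r⊹r = trans (sym (trans (pr-⊕ (mul-x-1 2 r) (mul-x-1 1 r)) (cong₂ _⊹_ (R.pr≡p 2) (R.pr≡p 1))))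
    (trans (pr-≈ (mul-x-1 2 r ⊕ mul-x-1 1 r) (mul-x-1 4 s ⊕ mul-x-1 1 s) eq)
           (trans (pr-⊕ (mul-x-1 4 s) (mul-x-1 1 s)) (cong₂ _⊹_ (pr≡p 4) (pr≡p 1))))
    where
    eval-yr : ∀ j x → eval (mul-x-1 j r) x ≡ (x ∸ 1) ^ j * (((x ∸ 2) * (x ∸ 1) + 1) * eval s x)
    eval-yr j x = trans (eval-mul-x-1 j r r-supp x) (cong ((x ∸ 1) ^ j *_) (eval-r x))
    lem : ∀ x c → (x ∸ 1) ^ 2 * (((x ∸ 2) * (x ∸ 1) + 1) * c) + (x ∸ 1) ^ 1 * (((x ∸ 2) * (x ∸ 1) + 1) * c) ≡
          (x ∸ 1) ^ 4 * c + (x ∸ 1) ^ 1 * c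
    lem zero          = solve-∀
    lem (suc zero)    = solve-∀
    lem (suc (suc x)) = lem′ x
      where
      lem′ : ∀ x c → suc x * (suc x * 1) * ((x * suc x + 1) * c) + suc x * 1 * ((x * suc x + 1) * c) ≡
             suc x * (suc x * (suc x * (suc x * 1))) * c + suc x * 1 * c
      lem′ = solve-∀
    eq : mul-x-1 2 r ⊕ mul-x-1 1 r ≈ mul-x-1 4 s ⊕ mul-x-1 1 s
    eq x = trans (eval-⊕ (mul-x-1 2 r) (mul-x-1 1 r) x) (trans (cong₂ _+_ (eval-yr 2 x) (eval-yr 1 x))
      (trans (lem x (eval s x)) (sym (trans (eval-⊕ (mul-x-1 4 s) (mul-x-1 1 s) x) (cong₂ _+_ (eval-y 4 x) (eval-y 1 x))))))

  -- For d = 0 the target consists of higher moments of r itself; raising d only increases its mean.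
  r⊏g : ∀ d → R.p 0 ⊏ p (4 + d) ⊹ p 1
  r⊏g zero    = subst (R.p 0 ⊏_) r⊹r (⊏-⊹ʳ (R.p 2) (R.p 1) (R.p 0) (R.p-increasing 0 1) (R.p-step 0))
  r⊏g (suc d) = ⊏-⊑-trans (R.p 0) (p (4 + d) ⊹ p 1) (p (5 + d) ⊹ p 1)
    (≤-trans (M-pos 1) (m≤n+m (M 1) _)) (r⊏g d) (p⊹p₁-step (2 + d))

  -- The cycle is 1 + y² + y⁴ + ⋯ times s. One summand `p 1` is set apart, and the remainder l is
  -- compared with q term by term.
  even-sum-⊏ : ∀ q n → R.p 0 ⊏ q → (∀ j → j < n → p (4 + 2 * j) ⊏ q) →
    Σ (ℕ × ℕ) λ l → (pr (cycle (4 + 2 * n) ⊛ w) ≡ l ⊹ p 1) × l ⊏ q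
  even-sum-⊏ q zero    hr h = R.p 0 , trans (pr-cycle-step 2) (trans (cong (_⊹ p 2) (pr-cycle-step 0))
    (trans (cong₂ _,_ (+-comm (M 1) (M 3)) (+-comm (M 0) (M 2))) (sym r⊹p₁))) , hr
  even-sum-⊏ q (suc n) hr h with even-sum-⊏ q n hr (λ j h′ → h j (m<n⇒m<1+n h′))
  ... | l , eq , l⊏q = l ⊹ p (4 + 2 * n) ,
    trans (cong (λ m → pr (cycle (4 + m) ⊛ w)) (*-suc 2 n))
      (trans (pr-cycle-step (4 + 2 * n)) (trans (cong (_⊹ p (4 + 2 * n)) eq)
        (cong₂ _,_ (lem (proj₁ l) _ _) (lem (proj₂ l) _ _)))) ,
    ⊏-⊹ˡ l (p (4 + 2 * n)) q l⊏q (h n ≤-refl)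
    where
    lem : ∀ a b c → a + b + c ≡ a + c + b
    lem = solve-∀

  -- The summand set apart and the last term `p (4 + 2 * i)` together are exactly the target, so the
  -- cycle is the mediant of l and the target and lies below the target as soon as l does. The
  -- remaining terms of l are handled by `p-⊏-p⊹p₁`.
  cycle-even : ∀ i → pr (cycle (6 + 2 * i) ⊛ w) ⊏ g (3 + 2 * i)
  cycle-even i with even-sum-⊏ (p (4 + 2 * i) ⊹ p 1) i (r⊏g (2 * i)) pⱼ⊏g
    where
    pⱼ⊏g : ∀ j → j < i → p (4 + 2 * j) ⊏ p (4 + 2 * i) ⊹ p 1
    pⱼ⊏g j h with m≤n⇒∃[o]m+o≡n h
    ... | d , refl = subst (λ n → p (4 + 2 * j) ⊏ p n ⊹ p 1) (lem j d) (p-⊏-p⊹p₁ (4 + 2 * j) (2 * d) (s≤s z≤n))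
      where
      lem : ∀ j d → 2 + (4 + 2 * j) + 2 * d ≡ 4 + 2 * suc (j + d)
      lem = solve-∀
  ... | l , eq , l⊏g = subst₂ _⊏_
    (sym (trans (pr-cycle-step (4 + 2 * i)) (trans (cong (_⊹ p (4 + 2 * i)) eq) (cong₂ _,_ (lem (proj₁ l) _ _) (lem (proj₂ l) _ _)))))
    (sym (subst (λ n → g (suc n) ≡ p (2 + n) ⊹ p 1) (*-suc 2 i) (g-odd (suc i))))
    (⊏-self-⊹ l (p (4 + 2 * i) ⊹ p 1) l⊏g)
    where
    lem : ∀ a b c → a + b + c ≡ a + (c + b)
    lem = solve-∀

even⊎odd : ∀ n → (∃ λ i → n ≡ 2 * i) ⊎ (∃ λ i → n ≡ suc (2 * i))
even⊎odd zero    = inj₁ (0 , refl)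
even⊎odd (suc n) with even⊎odd n
... | inj₁ (i , refl) = inj₂ (i , refl)
... | inj₂ (i , refl) = inj₁ (suc i , sym (*-suc 2 i))

cycle-≺ : ∀ i → cycle (5 + i) ≺ k₃ ⊛ cycle (2 + i)
cycle-≺ i with even⊎odd i
... | inj₁ (j , refl) = ≺-intro λ w w>0 → CycleReduction.cycle-odd w w>0 j
... | inj₂ (j , refl) = ≺-intro λ w w>0 → CycleReduction.cycle-even w w>0 j

-- K₃ ∪ K₁ against C₄

Cub : Seq → ℕ
Cub []      = 0
Cub (a ∷ s) = sum s + 3 * T s + 3 * Q s + Cub s

T²≤Q*sum : ∀ s → T s * T s ≤ Q s * sum s
T²≤Q*sum s = subst (T s * T s ≤_) (*-comm (sum s) (Q s)) (T²≤sum*Q s)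

-- The difference is half the double sum of (k + l)(k - l)² sₖ sₗ.
Q*T≤Cub*sum : ∀ s → Q s * T s ≤ Cub s * sum s
Q*T≤Cub*sum []      = z≤n
Q*T≤Cub*sum (a ∷ s) = begin
  (b + 2 * t + q) * (b + t)                                                  ≡⟨ lem b t q ⟩
  q * t + 2 * (t * t) + (b * b + 3 * (b * t) + b * q)
    ≤⟨ +-monoˡ-≤ _ (+-mono-≤ (Q*T≤Cub*sum s) (*-monoʳ-≤ 2 (T²≤Q*sum s))) ⟩
  c * b + 2 * (q * b) + (b * b + 3 * (b * t) + b * q)
    ≤⟨ m≤m+n _ (a * (b + 3 * t + 3 * q + c)) ⟩
  c * b + 2 * (q * b) + (b * b + 3 * (b * t) + b * q) + a * (b + 3 * t + 3 * q + c)
    ≡⟨ lem′ a b t q c ⟩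
  (b + 3 * t + 3 * q + c) * (a + b)                                          ∎
  where
  open ≤-Reasoning
  b = sum s
  t = T s
  q = Q s
  c = Cub s
  lem : ∀ b t q → (b + 2 * t + q) * (b + t) ≡ q * t + 2 * (t * t) + (b * b + 3 * (b * t) + b * q)
  lem = solve-∀
  lem′ : ∀ a b t q c → c * b + 2 * (q * b) + (b * b + 3 * (b * t) + b * q) + a * (b + 3 * t + 3 * q + c) ≡
         (b + 3 * t + 3 * q + c) * (a + b)
  lem′ = solve-∀

-- The difference is half the double sum of k l (k - l)² sₖ sₗ.
Q²≤Cub*T : ∀ s → Q s * Q s ≤ Cub s * T s
Q²≤Cub*T []      = z≤n
Q²≤Cub*T (a ∷ s) = begin
  (b + 2 * t + q) * (b + 2 * t + q)    ≡⟨ lem b t q ⟩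
  q * q + q * t + t * t + R            ≤⟨ +-monoˡ-≤ R (+-mono-≤ (+-mono-≤ (Q²≤Cub*T s) (Q*T≤Cub*sum s)) (T²≤Q*sum s)) ⟩
  c * t + c * b + q * b + R            ≡⟨ lem′ b t q c ⟩
  (b + 3 * t + 3 * q + c) * (b + t)    ∎
  where
  open ≤-Reasoning
  b = sum s
  t = T s
  q = Q s
  c = Cub s
  R = b * b + 4 * (b * t) + 2 * (b * q) + 3 * (t * t) + 3 * (t * q)
  lem : ∀ b t q → (b + 2 * t + q) * (b + 2 * t + q) ≡
        q * q + q * t + t * t + (b * b + 4 * (b * t) + 2 * (b * q) + 3 * (t * t) + 3 * (t * q))
  lem = solve-∀
  lem′ : ∀ b t q c → c * t + c * b + q * b + (b * b + 4 * (b * t) + 2 * (b * q) + 3 * (t * t) + 3 * (t * q)) ≡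
         (b + 3 * t + 3 * q + c) * (b + t)
  lem′ = solve-∀

sum-mulx : ∀ s → sum (mulSub 0 s) ≡ T s + sum s
sum-mulx s = trans (sym (+-identityʳ _)) (sum-mulSub 0 s tt)

T-mulx : ∀ s → T (mulSub 0 s) ≡ Q s + T s + sum s
T-mulx s = trans (sym (+-identityʳ _)) (T-mulSub 0 s tt)

Q-⊕ : ∀ s t → Q (s ⊕ t) ≡ Q s + Q t
Q-⊕ []      t       = refl
Q-⊕ (a ∷ s) []      = sym (+-identityʳ _)
Q-⊕ (a ∷ s) (b ∷ t) rewrite sum-⊕ s t | T-⊕ s t | Q-⊕ s t = lem (sum s) (sum t) (T s) (T t) (Q s) (Q t)
  where
  lem : ∀ a b c d e f → a + b + 2 * (c + d) + (e + f) ≡ a + 2 * c + e + (b + 2 * d + f)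
  lem = solve-∀

Q-mulx : ∀ s → Q (mulSub 0 s) ≡ Cub s + Q s + 2 * T s + sum s
Q-mulx []      = refl
Q-mulx (a ∷ s)
  rewrite sum-⊕ (a ∷ []) (s ⊕ mulSub zero s) | sum-⊕ s (mulSub zero s)
        | T-⊕ (a ∷ []) (s ⊕ mulSub zero s) | T-⊕ s (mulSub zero s)
        | Q-⊕ (a ∷ []) (s ⊕ mulSub zero s) | Q-⊕ s (mulSub zero s)
        | sum-mulx s | T-mulx s | Q-mulx s = lem a (sum s) (T s) (Q s) (Cub s)
  where
  lem : ∀ a b t q c →
    a + 0 + (b + (t + b)) + 2 * (0 + (t + (q + t + b))) + (0 + (q + (c + q + 2 * t + b))) ≡
    b + 3 * t + 3 * q + c + (b + 2 * t + q) + 2 * (b + t) + (a + b)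
  lem = solve-∀

-- Twice the difference of the two sides is E(u − v)²(uv − 3) under the product of the weight
-- with itself: only the pairs involving the coefficient at 0 contribute negatively.
moments-< : ∀ a b s → 0 < a → 7 * a ≤ b →
  let W  = a ∷ b ∷ s
      m₀ = sum W
      m₁ = sum (mulSub 0 W)
      m₂ = sum (mulSub 0 (mulSub 0 W))
      m₃ = sum (mulSub 0 (mulSub 0 (mulSub 0 W)))
  in m₂ * m₂ + 3 * (m₂ * m₀) < m₃ * m₁ + 3 * (m₁ * m₁)
moments-< (suc a) b s _ h with m≤n⇒∃[o]m+o≡n h
... | d , refl = subst₂ _<_
  (sym (cong₂ (λ x y → y * y + 3 * (y * x)) eq₀ eq₂))
  (sym (cong₂ (λ x y → y * x + 3 * (x * x)) eq₁ eq₃))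
  (+-cancelʳ-< (n₂ * n₂ + 3 * (n₂ * n₁) + 3 * (n₁ * n₁)) _ _ (begin-strict
    m₂ * m₂ + 3 * (m₂ * m₀) + (n₂ * n₂ + 3 * (n₂ * n₁) + 3 * (n₁ * n₁))
      ≤⟨ +-monoʳ-≤ (m₂ * m₂ + 3 * (m₂ * m₀))
           (+-mono-≤ (+-mono-≤ (Q²≤Cub*T s) (*-monoʳ-≤ 3 (Q*T≤Cub*sum s))) (*-monoʳ-≤ 3 (T²≤Q*sum s))) ⟩
    m₂ * m₂ + 3 * (m₂ * m₀) + (n₃ * n₁ + 3 * (n₃ * n₀) + 3 * (n₂ * n₀))
      <⟨ m<m+n _ (s≤s z≤n) ⟩
    m₂ * m₂ + 3 * (m₂ * m₀) + (n₃ * n₁ + 3 * (n₃ * n₀) + 3 * (n₂ * n₀)) + rest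
      ≡⟨ lem (suc a) d n₀ n₁ n₂ n₃ ⟩
    m₃ * m₁ + 3 * (m₁ * m₁) + (n₂ * n₂ + 3 * (n₂ * n₁) + 3 * (n₁ * n₁)) ∎))
  where
  open ≤-Reasoning
  n₀ = sum s
  n₁ = T s
  n₂ = Q s
  n₃ = Cub s
  -- For j = 0, 1, 2, 3 the coefficients of xʲ x^k̲ sum to 1, k + 1, k² + 2k + 2 and k³ + 3k² + 6k +
  -- 5. The entries at k = 0 and k = 1 are one and seven times `suc a`, the latter plus d; the list
  -- s begins at k = 2.
  m₀ = (8 * suc a + d + n₀)
  m₁ = (15 * suc a + 2 * d + 3 * n₀ + n₁)
  m₂ = (37 * suc a + 5 * d + 10 * n₀ + 6 * n₁ + n₂)
  m₃ = (110 * suc a + 15 * d + 37 * n₀ + 30 * n₁ + 9 * n₂ + n₃)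
  -- All terms are nonnegative thanks to b ≥ 7a: the entries a at 0 and b at 1 contribute -2a² - 4ab
  -- + 2b², which gives 68 = -2 - 28 + 98 for a², and seven times the entry at 1 likewise outweighs
  -- the entry at 0 in the products with s.
  rest = (68 * (suc a * suc a) + 24 * (suc a * d) + 62 * (suc a * n₁) + 64 * (suc a * n₀) + 2 * (d * d) + 9 * (d * n₁)
     + 10 * (d * n₀) + 15 * (suc a * n₃) + 2 * (d * n₃) + 37 * (suc a * n₂) + 5 * (d * n₂) + n₀ * n₂ + 7 * (n₀ * n₁) + 8 * (n₀ * n₀))
  W = suc a ∷ 7 * suc a + d ∷ s
  lem₀ : ∀ a d n₀ → a + (7 * a + d + n₀) ≡ 8 * a + d + n₀
  lem₀ = solve-∀
  lem₁ : ∀ a d n₀ n₁ → 7 * a + d + n₀ + (n₀ + n₁) + (a + (7 * a + d + n₀)) ≡ 15 * a + 2 * d + 3 * n₀ + n₁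
  lem₁ = solve-∀
  lem₂ : ∀ a d n₀ n₁ n₂ →
    7 * a + d + n₀ + 2 * (n₀ + n₁) + (n₀ + 2 * n₁ + n₂) + (7 * a + d + n₀ + (n₀ + n₁)) + (a + (7 * a + d + n₀))
    + (15 * a + 2 * d + 3 * n₀ + n₁) ≡ 37 * a + 5 * d + 10 * n₀ + 6 * n₁ + n₂
  lem₂ = solve-∀
  lem₃ : ∀ a d n₀ n₁ n₂ n₃ →
    (7 * a + d + n₀ + 3 * (n₀ + n₁) + 3 * (n₀ + 2 * n₁ + n₂) + (n₀ + 3 * n₁ + 3 * n₂ + n₃)
     + (7 * a + d + n₀ + 2 * (n₀ + n₁) + (n₀ + 2 * n₁ + n₂)) + 2 * (7 * a + d + n₀ + (n₀ + n₁)) + (a + (7 * a + d + n₀))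
     + (7 * a + d + n₀ + 2 * (n₀ + n₁) + (n₀ + 2 * n₁ + n₂) + (7 * a + d + n₀ + (n₀ + n₁)) + (a + (7 * a + d + n₀)))
     + (15 * a + 2 * d + 3 * n₀ + n₁)) + (37 * a + 5 * d + 10 * n₀ + 6 * n₁ + n₂) ≡
    110 * a + 15 * d + 37 * n₀ + 30 * n₁ + 9 * n₂ + n₃
  lem₃ = solve-∀
  eq₀ : sum W ≡ m₀
  eq₀ = lem₀ (suc a) d n₀
  eq₁ : sum (mulSub 0 W) ≡ m₁
  eq₁ = trans (sum-mulx W) (lem₁ (suc a) d n₀ n₁)
  eq₂ : sum (mulSub 0 (mulSub 0 W)) ≡ m₂
  eq₂ = trans (sum-mulx (mulSub 0 W)) (trans (cong₂ _+_ (T-mulx W) eq₁) (lem₂ (suc a) d n₀ n₁ n₂))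
  eq₃ : sum (mulSub 0 (mulSub 0 (mulSub 0 W))) ≡ m₃
  eq₃ = trans (sum-mulx (mulSub 0 (mulSub 0 W))) (trans (cong₂ _+_ (trans (T-mulx (mulSub 0 W))
    (cong₂ _+_ (cong₂ _+_ (Q-mulx W) (T-mulx W)) eq₁)) eq₂) (lem₃ (suc a) d n₀ n₁ n₂ n₃))
  lem : ∀ a d n₀ n₁ n₂ n₃ →
    (37 * a + 5 * d + 10 * n₀ + 6 * n₁ + n₂) * (37 * a + 5 * d + 10 * n₀ + 6 * n₁ + n₂) + 3 * ((37 * a + 5 * d + 10 * n₀ + 6 * n₁ + n₂) * (8 * a + d + n₀))
    + (n₃ * n₁ + 3 * (n₃ * n₀) + 3 * (n₂ * n₀)) +
    (68 * (a * a) + 24 * (a * d) + 62 * (a * n₁) + 64 * (a * n₀) + 2 * (d * d) + 9 * (d * n₁)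
     + 10 * (d * n₀) + 15 * (a * n₃) + 2 * (d * n₃) + 37 * (a * n₂) + 5 * (d * n₂) + n₀ * n₂ + 7 * (n₀ * n₁) + 8 * (n₀ * n₀)) ≡
    (110 * a + 15 * d + 37 * n₀ + 30 * n₁ + 9 * n₂ + n₃) * (15 * a + 2 * d + 3 * n₀ + n₁) + 3 * ((15 * a + 2 * d + 3 * n₀ + n₁) * (15 * a + 2 * d + 3 * n₀ + n₁))
    + (n₂ * n₂ + 3 * (n₂ * n₁) + 3 * (n₁ * n₁))
  lem = solve-∀

k₃^ : ℕ → Seq
k₃^ zero    = 1 ∷ []
k₃^ (suc n) = k₃ ⊛ k₃^ n

eval-k₃^ : ∀ n x → eval (k₃^ n) x ≡ eval k₃ x ^ n
eval-k₃^ zero    x = eval-[-] 1 x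
eval-k₃^ (suc n) x = trans (eval-⊛ k₃ (k₃^ n) x) (cong (eval k₃ x *_) (eval-k₃^ n x))

module _ (q : ℕ) where

  -- In the variable u = x − 3: k₃^(q+2) k₂ divided by k₃.
  private
    t₃ t₂ : Seq
    t₃ = 6 ∷ 18 ∷ 9 ∷ 1 ∷ []
    t₂ = 6 ∷ 6 ∷ 1 ∷ []

    t₃^ : ℕ → Seq
    t₃^ zero    = t₂
    t₃^ (suc n) = t₃ ⊛ t₃^ n

    -- F and G are W times x(x - 2) and W times x² - 3x + 3. Up to a common factor k₃ they are the
    -- polynomials of the two graphs to be compared.
    W F G : Seq
    W = t₃^ (suc q)
    F = mulSub 0 (mulSub 0 W) ⊕ (4 · mulSub 0 W ⊕ 3 · W)
    G = mulSub 0 (mulSub 0 W) ⊕ (3 · mulSub 0 W ⊕ 3 · W)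

    eval-t₂ : ∀ u → eval t₂ u ≡ (3 + u) * (2 + u)
    eval-t₂ zero          = refl
    eval-t₂ (suc zero)    = refl
    eval-t₂ (suc (suc u)) = trans (cong (λ z → 6 + (2 + u) * (6 + suc u * z)) (eval-[-] 1 u)) (lem u)
      where
      lem : ∀ u → 6 + (2 + u) * (6 + suc u * 1) ≡ (5 + u) * (4 + u)
      lem = solve-∀

    eval-t₃ : ∀ u → eval t₃ u ≡ (3 + u) * ((2 + u) * (1 + u))
    eval-t₃ zero                = refl
    eval-t₃ (suc zero)          = refl
    eval-t₃ (suc (suc zero))    = refl
    eval-t₃ (suc (suc (suc u))) =
      trans (cong (λ z → 6 + (3 + u) * (18 + (2 + u) * (9 + suc u * z))) (eval-[-] 1 u)) (lem u)
      where
      lem : ∀ u → 6 + (3 + u) * (18 + (2 + u) * (9 + suc u * 1)) ≡ (6 + u) * ((5 + u) * (4 + u))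
      lem = solve-∀

    eval-t₃^ : ∀ n u → eval (t₃^ n) u ≡ ((3 + u) * ((2 + u) * (1 + u))) ^ n * ((3 + u) * (2 + u))
    eval-t₃^ zero    u = trans (eval-t₂ u) (sym (*-identityˡ _))
    eval-t₃^ (suc n) u = trans (eval-⊛ t₃ (t₃^ n) u)
      (trans (cong₂ _*_ (eval-t₃ u) (eval-t₃^ n u)) (sym (*-assoc ((3 + u) * ((2 + u) * (1 + u))) (((3 + u) * ((2 + u) * (1 + u))) ^ n) ((3 + u) * (2 + u)))))

    eval-W-0 : eval W 0 ≡ 36 * 6 ^ q
    eval-W-0 = trans (eval-t₃^ (suc q) 0) (lem (6 ^ q))
      where
      lem : ∀ a → 6 * a * 6 ≡ 36 * a
      lem = solve-∀

    -- This is where the 7 in `moments-<` comes from: the value at 1 is the sum of the first two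
    -- coefficients, and the ratio of the two values is exactly 288/36 = 8 when q = 0.
    eval-W-1 : 8 * eval W 0 ≤ eval W 1
    eval-W-1 = begin
      8 * eval W 0        ≡⟨ cong (8 *_) eval-W-0 ⟩
      8 * (36 * 6 ^ q)    ≡⟨ *-assoc 8 36 (6 ^ q) ⟨
      288 * 6 ^ q         ≤⟨ *-monoʳ-≤ 288 (^-monoˡ-≤ q (≤ᵇ⇒≤ 6 24 tt)) ⟩
      288 * 24 ^ q        ≡⟨ lem (24 ^ q) ⟩
      24 * 24 ^ q * 12    ≡⟨ eval-t₃^ (suc q) 1 ⟨
      eval W 1            ∎
      where
      open ≤-Reasoning
      lem : ∀ a → 288 * a ≡ 24 * a * 12
      lem = solve-∀

    moments-W : ∀ V → 0 < eval V 0 → 8 * eval V 0 ≤ eval V 1 →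
      let m₀ = sum V
          m₁ = sum (mulSub 0 V)
          m₂ = sum (mulSub 0 (mulSub 0 V))
          m₃ = sum (mulSub 0 (mulSub 0 (mulSub 0 V)))
      in m₂ * m₂ + 3 * (m₂ * m₀) < m₃ * m₁ + 3 * (m₁ * m₁)
    moments-W (a ∷ R) h h′ = go R (+-cancelˡ-≤ a _ _ (≤-trans h′ (≤-reflexive (cong (a +_) (+-identityʳ (eval R 0))))))
      where
      go : ∀ R → 7 * a ≤ eval R 0 →
        let V = a ∷ R in sum (mulSub 0 (mulSub 0 V)) * sum (mulSub 0 (mulSub 0 V)) + 3 * (sum (mulSub 0 (mulSub 0 V)) * sum V) <
          sum (mulSub 0 (mulSub 0 (mulSub 0 V))) * sum (mulSub 0 V) + 3 * (sum (mulSub 0 V) * sum (mulSub 0 V))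
      go []       h″ with () ← ≤-trans h (m+n≤o⇒m≤o a h″)
      go (b ∷ R′) h″ = moments-< a b R′ h h″

    eval-mulx : ∀ s x → eval (mulSub 0 s) x ≡ x * eval s x
    eval-mulx s = eval-mulSub 0 s tt

    eval-F : ∀ u → eval F u ≡ eval W u * ((1 + u) * (3 + u))
    eval-F u rewrite eval-⊕ (mulSub 0 (mulSub 0 W)) (4 · mulSub 0 W ⊕ 3 · W) u | eval-⊕ (4 · mulSub 0 W) (3 · W) u
      | eval-· 4 (mulSub 0 W) u | eval-· 3 W u | eval-mulx (mulSub 0 W) u | eval-mulx W u = lem u (eval W u)
      where
      lem : ∀ u w → u * (u * w) + (4 * (u * w) + 3 * w) ≡ w * ((1 + u) * (3 + u))
      lem = solve-∀

    eval-G : ∀ u → eval G u ≡ eval W u * (u * u + 3 * u + 3)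
    eval-G u rewrite eval-⊕ (mulSub 0 (mulSub 0 W)) (3 · mulSub 0 W ⊕ 3 · W) u | eval-⊕ (3 · mulSub 0 W) (3 · W) u
      | eval-· 3 (mulSub 0 W) u | eval-· 3 W u | eval-mulx (mulSub 0 W) u | eval-mulx W u = lem u (eval W u)
      where
      lem : ∀ u w → u * (u * w) + (3 * (u * w) + 3 * w) ≡ w * (u * u + 3 * u + 3)
      lem = solve-∀

    0∷0∷0∷ : Seq → Seq
    0∷0∷0∷ s = 0 ∷ 0 ∷ 0 ∷ s

    P : ℕ → ℕ
    P u = (3 + u) * ((2 + u) * (1 + u))

    0∷0∷0∷-≈ : ∀ s t n → (∀ u → (3 + u) * ((2 + u) * ((1 + u) * eval s u)) ≡ P u ^ suc n * eval t (3 + u)) →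
      0∷0∷0∷ s ≈ k₃^ (suc n) ⊛ t
    0∷0∷0∷-≈ s t n h x = trans (go x) (sym (trans (eval-⊛ (k₃^ (suc n)) t x) (cong (_* eval t x) (eval-k₃^ (suc n) x))))
      where
      go : ∀ x → eval (0∷0∷0∷ s) x ≡ eval k₃ x ^ suc n * eval t x
      go zero                = refl
      go (suc zero)          = refl
      go (suc (suc zero))    = refl
      go (suc (suc (suc u))) = trans (h u) (cong (λ z → z ^ suc n * eval t (3 + u)) (sym (eval-k₃ (3 + u))))

    F≈ : 0∷0∷0∷ F ≈ k₃^ (3 + q) ⊛ k₁
    F≈ = 0∷0∷0∷-≈ F k₁ (2 + q) λ u → trans
      (cong (λ z → (3 + u) * ((2 + u) * ((1 + u) * z))) (trans (eval-F u) (cong (_* ((1 + u) * (3 + u))) (eval-t₃^ (suc q) u))))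
      (trans (lem u (P u ^ q)) (cong (P u ^ (3 + q) *_) (sym (eval-k₁ (3 + u)))))
      where
      lem : ∀ u a → (3 + u) * ((2 + u) * ((1 + u) * ((3 + u) * ((2 + u) * (1 + u)) * a * ((3 + u) * (2 + u)) * ((1 + u) * (3 + u))))) ≡
        (3 + u) * ((2 + u) * (1 + u)) * ((3 + u) * ((2 + u) * (1 + u)) * ((3 + u) * ((2 + u) * (1 + u)) * a)) * (3 + u)
      lem = solve-∀

    G≈ : 0∷0∷0∷ G ≈ k₃^ (2 + q) ⊛ cycle 3
    G≈ = 0∷0∷0∷-≈ G (cycle 3) (1 + q) λ u → trans
      (cong (λ z → (3 + u) * ((2 + u) * ((1 + u) * z))) (trans (eval-G u) (cong (_* (u * u + 3 * u + 3)) (eval-t₃^ (suc q) u))))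
      (trans (lem u (P u ^ q)) (cong (P u ^ (2 + q) *_) (sym (eval-cycle 3 (3 + u)))))
      where
      lem : ∀ u a → (3 + u) * ((2 + u) * ((1 + u) * ((3 + u) * ((2 + u) * (1 + u)) * a * ((3 + u) * (2 + u)) * (u * u + 3 * u + 3)))) ≡
        (3 + u) * ((2 + u) * (1 + u)) * ((3 + u) * ((2 + u) * (1 + u)) * a)
        * ((3 + u) * ((2 + u) * ((2 + u) * 1 + (1 + u) * ((1 + u) * 1))))
      lem = solve-∀

  -- Since F = G + u W, the claim is that u W has a smaller mean than G. Cross-multiplied and with
  -- common terms cancelled, that is the inequality m₂² + 3 m₂ m₀ < m₃ m₁ + 3 m₁² of `moments-<`.
  k₃^-k₁-⊏ : pr (k₃^ (3 + q) ⊛ k₁) ⊏ pr (k₃^ (2 + q) ⊛ cycle 3)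
  k₃^-k₁-⊏ = subst₂ _⊏_ (pr-≈ (0∷0∷0∷ F) (k₃^ (3 + q) ⊛ k₁) F≈) (pr-≈ (0∷0∷0∷ G) (k₃^ (2 + q) ⊛ cycle 3) G≈) shifted
    where
    m₀ = sum W
    m₁ = sum (mulSub 0 W)
    m₂ = sum (mulSub 0 (mulSub 0 W))
    m₃ = sum (mulSub 0 (mulSub 0 (mulSub 0 W)))
    sum-combination : ∀ c → sum (mulSub 0 (mulSub 0 W) ⊕ (c · mulSub 0 W ⊕ 3 · W)) ≡ m₂ + (c * m₁ + 3 * m₀)
    sum-combination c = trans (sum-⊕ (mulSub 0 (mulSub 0 W)) (c · mulSub 0 W ⊕ 3 · W)) (cong (m₂ +_)
      (trans (sum-⊕ (c · mulSub 0 W) (3 · W)) (cong₂ _+_ (sum-· c (mulSub 0 W)) (sum-· 3 W))))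
    T-combination : ∀ c → T (mulSub 0 (mulSub 0 W) ⊕ (c · mulSub 0 W ⊕ 3 · W)) ≡
      T (mulSub 0 (mulSub 0 W)) + (c * T (mulSub 0 W) + 3 * T W)
    T-combination c = trans (T-⊕ (mulSub 0 (mulSub 0 W)) (c · mulSub 0 W ⊕ 3 · W)) (cong (T (mulSub 0 (mulSub 0 W)) +_)
      (trans (T-⊕ (c · mulSub 0 W) (3 · W)) (cong₂ _+_ (T-· c (mulSub 0 W)) (T-· 3 W))))
    numerator : ∀ c s → sum s ≡ m₂ + (c * m₁ + 3 * m₀) →
      T s ≡ T (mulSub 0 (mulSub 0 W)) + (c * T (mulSub 0 W) + 3 * T W) → T s + sum s ≡ m₃ + (c * m₂ + 3 * m₁)
    numerator c s eq eq′ rewrite eq | eq′ = trans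
      (lem (T (mulSub 0 (mulSub 0 W))) c (T (mulSub 0 W)) (T W) m₂ m₁ m₀)
      (cong₂ _+_ (sym (sum-mulx (mulSub 0 (mulSub 0 W)))) (cong₂ (λ y z → c * y + 3 * z) (sym (sum-mulx (mulSub 0 W))) (sym (sum-mulx W))))
      where
      lem : ∀ t₂ c t₁ t₀ m₂ m₁ m₀ → t₂ + (c * t₁ + 3 * t₀) + (m₂ + (c * m₁ + 3 * m₀)) ≡
        t₂ + m₂ + (c * (t₁ + m₁) + 3 * (t₀ + m₀))
      lem = solve-∀
    NF : T F + sum F ≡ m₃ + (4 * m₂ + 3 * m₁)
    NF = numerator 4 F (sum-combination 4) (T-combination 4)
    NG : T G + sum G ≡ m₃ + (3 * m₂ + 3 * m₁)
    NG = numerator 3 G (sum-combination 3) (T-combination 3)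
    key : (T F + sum F) * sum G < (T G + sum G) * sum F
    key = subst₂ _<_ (sym (cong₂ _*_ NF (sum-combination 3))) (sym (cong₂ _*_ NG (sum-combination 4))) (begin-strict
      (m₃ + (4 * m₂ + 3 * m₁)) * (m₂ + (3 * m₁ + 3 * m₀))  ≡⟨ lem m₀ m₁ m₂ m₃ ⟩
      m₂ * m₂ + 3 * (m₂ * m₀) + (m₃ * m₂ + 3 * (m₃ * m₁) + 3 * (m₃ * m₀) + 3 * (m₂ * m₂) + 15 * (m₁ * m₂)
        + 9 * (m₂ * m₀) + 9 * (m₁ * m₁) + 9 * (m₁ * m₀))
        <⟨ +-monoˡ-< _ (moments-W W (subst (0 <_) (sym eval-W-0) (*-mono-< {0} {36} (s≤s z≤n) (m^n>0 6 q))) eval-W-1) ⟩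
      m₃ * m₁ + 3 * (m₁ * m₁) + (m₃ * m₂ + 3 * (m₃ * m₁) + 3 * (m₃ * m₀) + 3 * (m₂ * m₂) + 15 * (m₁ * m₂)
        + 9 * (m₂ * m₀) + 9 * (m₁ * m₁) + 9 * (m₁ * m₀))
        ≡⟨ lem′ m₀ m₁ m₂ m₃ ⟩
      (m₃ + (3 * m₂ + 3 * m₁)) * (m₂ + (4 * m₁ + 3 * m₀))  ∎)
      where
      open ≤-Reasoning
      lem : ∀ a b c d → (d + (4 * c + 3 * b)) * (c + (3 * b + 3 * a)) ≡
        c * c + 3 * (c * a) + (d * c + 3 * (d * b) + 3 * (d * a) + 3 * (c * c) + 15 * (b * c) + 9 * (c * a) + 9 * (b * b) + 9 * (b * a))
      lem = solve-∀
      lem′ : ∀ a b c d → d * b + 3 * (b * b) + (d * c + 3 * (d * b) + 3 * (d * a) + 3 * (c * c) + 15 * (b * c) + 9 * (c * a) + 9 * (b * b) + 9 * (b * a)) ≡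
        (d + (3 * c + 3 * b)) * (c + (4 * b + 3 * a))
      lem′ = solve-∀
    -- Restoring the factor k₃ adds 3 to every index. One unit makes T + sum, the coefficient sum
    -- after multiplication by u; the other two add the same constant to both means.
    T-shift : ∀ s → T (0∷0∷0∷ s) ≡ T s + sum s + 2 * sum s
    T-shift s = lem (T s) (sum s)
      where
      lem : ∀ t b → b + (b + (b + t)) ≡ t + b + 2 * b
      lem = solve-∀
    shifted : pr (0∷0∷0∷ F) ⊏ pr (0∷0∷0∷ G)
    shifted = subst₂ (λ y z → y * sum G < z * sum F) (sym (T-shift F)) (sym (T-shift G))
      (subst₂ _<_ (sym (*-distribʳ-+ (sum G) (T F + sum F) (2 * sum F)))
        (trans (cong ((T G + sum G) * sum F +_) (lem (sum F) (sum G))) (sym (*-distribʳ-+ (sum F) (T G + sum G) (2 * sum G))))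
        (+-monoˡ-< (2 * sum F * sum G) key))
      where
      lem : ∀ a b → 2 * a * b ≡ 2 * b * a
      lem = solve-∀

-- Colourings and partitions

sum-concatMap : ∀ {A B : Set} (g : B → ℕ) (f : A → List B) xs →
  sum (map g (concatMap f xs)) ≡ sum (map (λ x → sum (map g (f x))) xs)
sum-concatMap g f []       = refl
sum-concatMap g f (x ∷ xs) = trans (cong sum (map-++ g (f x) (concatMap f xs)))
  (trans (sum-++ (map g (f x)) (map g (concatMap f xs))) (cong (_ +_) (sum-concatMap g f xs)))

Σ< : ℕ → (ℕ → ℕ) → ℕ
Σ< zero    h = 0
Σ< (suc x) h = h 0 + Σ< x (λ a → h (suc a))

Σ<-cong : ∀ x {g h : ℕ → ℕ} → (∀ a → a < x → g a ≡ h a) → Σ< x g ≡ Σ< x h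
Σ<-cong zero    e = refl
Σ<-cong (suc x) e = cong₂ _+_ (e 0 (s≤s z≤n)) (Σ<-cong x (λ a h → e (suc a) (s≤s h)))

Σ<-* : ∀ x c h → Σ< x (λ a → c * h a) ≡ c * Σ< x h
Σ<-* zero    c h = sym (*-zeroʳ c)
Σ<-* (suc x) c h = trans (cong (_ +_) (Σ<-* x c _)) (sym (*-distribˡ-+ c (h 0) _))

Σ<-+ : ∀ x g h → Σ< x (λ a → g a + h a) ≡ Σ< x g + Σ< x h
Σ<-+ zero    g h = refl
Σ<-+ (suc x) g h = trans (cong (_ +_) (Σ<-+ x _ _)) (lem (g 0) (h 0) _ _)
  where
  lem : ∀ a b c d → a + b + (c + d) ≡ a + c + (b + d)
  lem = solve-∀

Σ<-0 : ∀ x → Σ< x (λ _ → 0) ≡ 0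
Σ<-0 zero    = refl
Σ<-0 (suc x) = Σ<-0 x

Σ<-last : ∀ x h → Σ< (suc x) h ≡ Σ< x h + h x
Σ<-last zero    h = +-identityʳ (h 0)
Σ<-last (suc x) h = trans (cong (h 0 +_) (Σ<-last x _)) (sym (+-assoc (h 0) _ _))

sum-applyUpTo : ∀ h (f : ℕ → ℕ) n → sum (map h (applyUpTo f n)) ≡ Σ< n (λ a → h (f a))
sum-applyUpTo h f zero    = refl
sum-applyUpTo h f (suc n) = cong (h (f 0) +_) (sum-applyUpTo h (λ a → f (suc a)) n)

-- The transposition of j and j + 1.
τ : ℕ → ℕ → ℕ
τ zero    zero          = 1
τ zero    (suc zero)    = 0
τ zero    (suc (suc z)) = suc (suc z)
τ (suc j) zero          = zero
τ (suc j) (suc z)       = suc (τ j z)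

τ-involutive : ∀ j z → τ j (τ j z) ≡ z
τ-involutive zero    zero          = refl
τ-involutive zero    (suc zero)    = refl
τ-involutive zero    (suc (suc z)) = refl
τ-involutive (suc j) zero          = refl
τ-involutive (suc j) (suc z)       = cong suc (τ-involutive j z)

τ-< : ∀ {j z} → z < j → τ j z ≡ z
τ-< {suc j} {zero}  h       = refl
τ-< {suc j} {suc z} (s≤s h) = cong suc (τ-< h)

τ-self : ∀ j → τ j j ≡ suc j
τ-self zero    = refl
τ-self (suc j) = cong suc (τ-self j)

Σ<-τ : ∀ x j h → suc j < x → Σ< x (λ a → h (τ j a)) ≡ Σ< x h
Σ<-τ (suc (suc x)) zero    h _       = lem (h 1) (h 0) _
  where
  lem : ∀ a b c → a + (b + c) ≡ b + (a + c)
  lem = solve-∀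
Σ<-τ (suc x)       (suc j) h (s≤s p) = cong (h 0 +_) (Σ<-τ x j (λ a → h (suc a)) p)

-- The sum of F over all colourings of n vertices with x colours.
csum : ℕ → (n : ℕ) → (Vec ℕ n → ℕ) → ℕ
csum x zero    F = F []
csum x (suc n) F = Σ< x (λ a → csum x n (λ c → F (a ∷ c)))

csum-cong : ∀ x n {F G : Vec ℕ n → ℕ} → (∀ c → F c ≡ G c) → csum x n F ≡ csum x n G
csum-cong x zero    e = e []
csum-cong x (suc n) e = Σ<-cong x (λ a _ → csum-cong x n (λ c → e (a ∷ c)))

csum-* : ∀ x n c F → csum x n (λ v → c * F v) ≡ c * csum x n F
csum-* x zero    c F = refl
csum-* x (suc n) c F = trans (Σ<-cong x (λ a _ → csum-* x n c _)) (Σ<-* x c _)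

-- `partitions` adds vertices at the end, `csum` at the front.
csum-snoc : ∀ x n F → csum x (suc n) F ≡ csum x n (λ c → Σ< x (λ a → F (c ∷ʳ a)))
csum-snoc x zero    F = refl
csum-snoc x (suc n) F = Σ<-cong x (λ a _ → csum-snoc x n (λ c → F (a ∷ c)))

ff : ℕ → ℕ → ℕ
ff x       zero    = 1
ff zero    (suc k) = 0
ff (suc x) (suc k) = suc x * ff x k

ff-suc : ∀ x k → ff x (suc k) ≡ ff x k * (x ∸ k)
ff-suc zero    zero    = refl
ff-suc zero    (suc k) = refl
ff-suc (suc x) zero    = trans (*-identityʳ (suc x)) (sym (*-identityˡ (suc x)))
ff-suc (suc x) (suc k) = trans (cong (suc x *_) (ff-suc x k)) (sym (*-assoc (suc x) (ff x k) (x ∸ k)))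

ff-zero : ∀ {x k} → x < k → ff x k ≡ 0
ff-zero {zero}  {suc k} h       = refl
ff-zero {suc x} {suc k} (s≤s h) = trans (cong (suc x *_) (ff-zero h)) (*-zeroʳ (suc x))

Σ<-eventually-constant : ∀ k x h → k ≤ x → (∀ a → k ≤ a → suc a < x → h (suc a) ≡ h a) →
  Σ< x h ≡ Σ< k h + (x ∸ k) * h k
Σ<-eventually-constant zero    zero          h p e = refl
Σ<-eventually-constant zero    (suc zero)    h p e = refl
Σ<-eventually-constant zero    (suc (suc x)) h p e = cong (h 0 +_)
  (trans (Σ<-eventually-constant zero (suc x) (λ a → h (suc a)) z≤n (λ a _ q → e (suc a) z≤n (s≤s q)))
         (cong (suc x *_) (e 0 z≤n (s≤s (s≤s z≤n)))))
Σ<-eventually-constant (suc k) (suc x) h (s≤s p) e = trans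
  (cong (h 0 +_) (Σ<-eventually-constant k x (λ a → h (suc a)) p (λ a q r → e (suc a) (s≤s q) (s≤s r))))
  (sym (+-assoc (h 0) _ _))

ff-extend : ∀ x k h → (∀ a → k ≤ a → suc a < x → h (suc a) ≡ h a) →
  ff x k * Σ< x h ≡ Σ< (suc k) (λ b → ff x (k ⊔ suc b) * h b)
ff-extend x k h e with k ≤? x
... | yes p = begin
  ff x k * Σ< x h                                  ≡⟨ cong (ff x k *_) (Σ<-eventually-constant k x h p e) ⟩
  ff x k * (Σ< k h + (x ∸ k) * h k)                ≡⟨ lem (ff x k) (Σ< k h) (x ∸ k) (h k) ⟩
  ff x k * Σ< k h + ff x k * (x ∸ k) * h k         ≡⟨ cong₂ _+_ (sym (Σ<-* k (ff x k) h)) (cong (_* h k) (sym (ff-suc x k))) ⟩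
  Σ< k (λ b → ff x k * h b) + ff x (suc k) * h k   ≡⟨ cong₂ _+_ (Σ<-cong k (λ b q → cong (λ z → ff x z * h b) (sym (m≥n⇒m⊔n≡m q))))
                                                       (cong (λ z → ff x z * h k) (sym (m≤n⇒m⊔n≡n (n≤1+n k)))) ⟩
  Σ< k (λ b → ff x (k ⊔ suc b) * h b) + ff x (k ⊔ suc k) * h k ≡⟨ Σ<-last k _ ⟨
  Σ< (suc k) (λ b → ff x (k ⊔ suc b) * h b)        ∎
  where
  open ≡-Reasoning
  lem : ∀ a b c d → a * (b + c * d) ≡ a * b + a * c * d
  lem = solve-∀
... | no ¬p = trans (cong (_* Σ< x h) (ff-zero (≰⇒> ¬p)))
  (sym (trans (Σ<-cong (suc k) (λ b _ → cong (_* h b) (ff-zero (≤-trans (≰⇒> ¬p) (m≤m⊔n k (suc b)))))) (Σ<-0 (suc k))))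

-- Equivalent to all labels being less than k, in the form in which colour symmetry is applied.
Fixed : ∀ {n} → ℕ → Vec ℕ n → Set
Fixed k v = ∀ j → k ≤ j → Vec.map (τ j) v ≡ v

Fixed-∷ʳ : ∀ {n} {v : Vec ℕ n} {k b} → Fixed k v → Fixed (k ⊔ suc b) (v ∷ʳ b)
Fixed-∷ʳ {v = v} {k} {b} f j h = trans (map-∷ʳ (τ j) b v)
  (cong₂ _∷ʳ_ (f j (≤-trans (m≤m⊔n k (suc b)) h)) (τ-< (≤-trans (m≤n⊔m k (suc b)) h)))

-- The bounds on k place the number of blocks in the range 1, ..., n over which `𝓑` and `𝓣` sum.
WellFormed : ∀ {n} → Vec ℕ n × ℕ → Set
WellFormed {n} (v , k) = Fixed k v × k ≤ n × (0 < n → 0 < k)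

partitions-wellFormed : ∀ n → All WellFormed (partitions n)
partitions-wellFormed zero    = ((λ j _ → refl) , z≤n , id) ∷ []
partitions-wellFormed (suc n) = All.concat⁺ (All.map⁺ (All.map extend (partitions-wellFormed n)))
  where
  extend : ∀ {p} → WellFormed p → All WellFormed (map (λ b → proj₁ p ∷ʳ b , proj₂ p ⊔ suc b) (upTo (suc (proj₂ p))))
  extend {v , k} (f , h , _) = All.map⁺ (All.applyUpTo⁺₁ id (suc k) λ {b} b≤k →
    Fixed-∷ʳ f , ⊔-lub (m≤n⇒m≤1+n h) (≤-trans b≤k (s≤s h)) , λ _ → ≤-trans (s≤s z≤n) (m≤n⊔m k (suc b)))

-- A colouring with x colours is a partition together with an injective labelling of its blocks.
csum-partitions : ∀ x n F → (∀ j → suc j < x → ∀ c → F (Vec.map (τ j) c) ≡ F c) →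
  csum x n F ≡ sum (map (λ p → ff x (proj₂ p) * F (proj₁ p)) (partitions n))
csum-partitions x zero    F inv = sym (trans (+-identityʳ _) (+-identityʳ _))
csum-partitions x (suc n) F inv = begin
  csum x (suc n) F                                                     ≡⟨ csum-snoc x n F ⟩
  csum x n F′                                                          ≡⟨ csum-partitions x n F′ inv′ ⟩
  sum (map (λ p → ff x (proj₂ p) * F′ (proj₁ p)) (partitions n))
    ≡⟨ cong sum (map-cong-local (All.map step (partitions-wellFormed n))) ⟩
  sum (map (λ p → sum (map g (ext p))) (partitions n))                 ≡⟨ sum-concatMap g ext (partitions n) ⟨
  sum (map g (partitions (suc n)))                                     ∎
  where
  open ≡-Reasoning
  F′ : Vec ℕ n → ℕ
  F′ c = Σ< x (λ a → F (c ∷ʳ a))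
  inv′ : ∀ j → suc j < x → ∀ c → F′ (Vec.map (τ j) c) ≡ F′ c
  inv′ j h c = trans (sym (Σ<-τ x j (λ a → F (Vec.map (τ j) c ∷ʳ a)) h))
    (Σ<-cong x (λ a _ → trans (cong F (sym (map-∷ʳ (τ j) a c))) (inv j h (c ∷ʳ a))))
  g : Vec ℕ (suc n) × ℕ → ℕ
  g p = ff x (proj₂ p) * F (proj₁ p)
  ext : Vec ℕ n × ℕ → List (Vec ℕ (suc n) × ℕ)
  ext ck = map (λ b → (proj₁ ck ∷ʳ b , proj₂ ck ⊔ suc b)) (upTo (suc (proj₂ ck)))
  step : ∀ {p} → WellFormed p → ff x (proj₂ p) * F′ (proj₁ p) ≡ sum (map g (ext p))
  step {v , k} (f , _) = trans
    -- For a ≥ k neither a nor a + 1 occurs in v, so exchanging these colours moves only the new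
    -- vertex.
    (ff-extend x k (λ a → F (v ∷ʳ a)) λ a k≤a h → trans (cong F (sym (trans (map-∷ʳ (τ a) a v) (cong₂ _∷ʳ_ (f a k≤a) (τ-self a))))) (inv a h (v ∷ʳ a)))
    (sym (trans (cong sum (sym (map-∘ (upTo (suc k))))) (sum-applyUpTo _ id (suc k))))

true-ext : ∀ {b c} → (b ≡ true → c ≡ true) → (c ≡ true → b ≡ true) → b ≡ c
true-ext {true}  {c}     f g = sym (f refl)
true-ext {false} {false} f g = refl
true-ext {false} {true}  f g = g refl

and-++ : ∀ xs ys → and xs ≡ true → and ys ≡ true → and (xs ++ ys) ≡ true
and-++ []          ys p q = q
and-++ (true ∷ xs) ys p q = and-++ xs ys p q

and-++⁻ : ∀ xs ys → and (xs ++ ys) ≡ true → (and xs ≡ true) × (and ys ≡ true)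
and-++⁻ []          ys p = refl , p
and-++⁻ (true ∷ xs) ys p = and-++⁻ xs ys p

and-tabulate : ∀ {A : Set} n (g : A → Bool) (f : Fin n → A) → (∀ i → g (f i) ≡ true) → and (map g (tabulate f)) ≡ true
and-tabulate zero    g f h = refl
and-tabulate (suc n) g f h rewrite h zero = and-tabulate n g (λ i → f (suc i)) (λ i → h (suc i))

and-tabulate⁻ : ∀ {A : Set} n (g : A → Bool) (f : Fin n → A) → and (map g (tabulate f)) ≡ true → ∀ i → g (f i) ≡ true
and-tabulate⁻ (suc n) g f h zero    = proj₁ (∧-true h)
and-tabulate⁻ (suc n) g f h (suc i) = and-tabulate⁻ n g (λ i → f (suc i)) (proj₂ (∧-true {g (f zero)} h)) i

and-concatMap : ∀ {A : Set} n (g : A → List Bool) (f : Fin n → A) → (∀ i → and (g (f i)) ≡ true) →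
  and (concatMap g (tabulate f)) ≡ true
and-concatMap zero    g f h = refl
and-concatMap (suc n) g f h = and-++ (g (f zero)) _ (h zero) (and-concatMap n g (λ i → f (suc i)) (λ i → h (suc i)))

and-concatMap⁻ : ∀ {A : Set} n (g : A → List Bool) (f : Fin n → A) → and (concatMap g (tabulate f)) ≡ true →
  ∀ i → and (g (f i)) ≡ true
and-concatMap⁻ (suc n) g f h zero    = proj₁ (and-++⁻ (g (f zero)) _ h)
and-concatMap⁻ (suc n) g f h (suc i) = and-concatMap⁻ n g (λ i → f (suc i)) (proj₂ (and-++⁻ (g (f zero)) _ h)) i

Proper : (G : Graph) → Vec ℕ (order G) → Set
Proper G c = ∀ i j → adj G i j ≡ true → lookup c i ≢ lookup c j

≡ᵇ-refl : ∀ a → (a ≡ᵇ a) ≡ true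
≡ᵇ-refl zero    = refl
≡ᵇ-refl (suc a) = ≡ᵇ-refl a

≡ᵇ-true : ∀ a b → (a ≡ᵇ b) ≡ true → a ≡ b
≡ᵇ-true a b h = ≡ᵇ⇒≡ a b (subst IsTrue (sym h) tt)

proper⇒stable : ∀ G c → Proper G c → isStablePartition G c ≡ true
proper⇒stable G c h = and-concatMap _ _ id λ i → and-tabulate _ _ id λ j → go i j
  where
  go : ∀ i j → (not (adj G i j) ∨ not (lookup c i ≡ᵇ lookup c j)) ≡ true
  go i j with adj G i j in eq | lookup c i ≡ᵇ lookup c j in eq′
  ... | false | _     = refl
  ... | true  | false = refl
  ... | true  | true  = ⊥-elim (h i j eq (≡ᵇ-true _ _ eq′))

stable⇒proper : ∀ G c → isStablePartition G c ≡ true → Proper G c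
stable⇒proper G c h i j a e with and-tabulate⁻ _ _ id (and-concatMap⁻ _ _ id h i) j
... | p rewrite a | e | ≡ᵇ-refl (lookup c j) with () ← p

stable-cong : ∀ G H c d → (Proper G c → Proper H d) → (Proper H d → Proper G c) →
  isStablePartition G c ≡ isStablePartition H d
stable-cong G H c d f g = true-ext (λ h → proper⇒stable H d (f (stable⇒proper G c h)))
                                   (λ h → proper⇒stable G c (g (stable⇒proper H d h)))

χ : (G : Graph) → Vec ℕ (order G) → ℕ
χ G c = 𝟙 (isStablePartition G c)

chromatic : Graph → ℕ → ℕ
chromatic G x = csum x (order G) (χ G)

unit : ℕ → Seq
unit zero    = 1 ∷ []
unit (suc k) = 0 ∷ unit k

eval-unit : ∀ k x → eval (unit k) x ≡ ff x k
eval-unit zero    x       = eval-[-] 1 x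
eval-unit (suc k) zero    = refl
eval-unit (suc k) (suc x) = cong (suc x *_) (eval-unit k x)

sum-unit : ∀ k → sum (unit k) ≡ 1
sum-unit zero    = refl
sum-unit (suc k) = sum-unit k

T-unit : ∀ k → T (unit k) ≡ k
T-unit zero    = refl
T-unit (suc k) = cong₂ _+_ (sum-unit k) (T-unit k)

collect : ∀ {A : Set} → (A → ℕ) → List (A × ℕ) → Seq
collect f []       = []
collect f (p ∷ ps) = f (proj₁ p) · unit (proj₂ p) ⊕ collect f ps

eval-collect : ∀ {A : Set} (f : A → ℕ) ps x →
  eval (collect f ps) x ≡ sum (map (λ p → ff x (proj₂ p) * f (proj₁ p)) ps)
eval-collect f []       x = refl
eval-collect f (p ∷ ps) x = trans (eval-⊕ (f (proj₁ p) · unit (proj₂ p)) (collect f ps) x)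
  (cong₂ _+_ (trans (eval-· (f (proj₁ p)) (unit (proj₂ p)) x)
    (trans (cong (f (proj₁ p) *_) (eval-unit (proj₂ p) x)) (*-comm (f (proj₁ p)) _))) (eval-collect f ps x))

sum-collect : ∀ {A : Set} (f : A → ℕ) ps → sum (collect f ps) ≡ sum (map (λ p → 1 * f (proj₁ p)) ps)
sum-collect f []       = refl
sum-collect f (p ∷ ps) = trans (sum-⊕ (f (proj₁ p) · unit (proj₂ p)) (collect f ps))
  (cong₂ _+_ (trans (sum-· (f (proj₁ p)) (unit (proj₂ p))) (trans (cong (f (proj₁ p) *_) (sum-unit (proj₂ p))) (*-comm (f (proj₁ p)) 1)))
    (sum-collect f ps))

T-collect : ∀ {A : Set} (f : A → ℕ) ps → T (collect f ps) ≡ sum (map (λ p → proj₂ p * f (proj₁ p)) ps)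
T-collect f []       = refl
T-collect f (p ∷ ps) = trans (T-⊕ (f (proj₁ p) · unit (proj₂ p)) (collect f ps))
  (cong₂ _+_ (trans (T-· (f (proj₁ p)) (unit (proj₂ p))) (trans (cong (f (proj₁ p) *_) (T-unit (proj₂ p))) (*-comm (f (proj₁ p)) _)))
    (T-collect f ps))

-- The chromatic polynomial in the falling factorial basis: coefficient k is S(G, k). It is
-- assembled partition by partition, so that its values can be matched with counts of colourings.
σ : Graph → Seq
σ G = collect (χ G) (partitions (order G))

eval-σ : ∀ G x → eval (σ G) x ≡ chromatic G x
eval-σ G x = trans (eval-collect (χ G) (partitions (order G)) x) (sym (csum-partitions x (order G) (χ G) inv))
  where
  inv : ∀ j → suc j < x → ∀ c → χ G (Vec.map (τ j) c) ≡ χ G c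
  inv j _ c = cong 𝟙 (stable-cong G G (Vec.map (τ j) c) c
    (λ h i k a e → h i k a (trans (lookup-map i (τ j) c) (trans (cong (τ j) e) (sym (lookup-map k (τ j) c)))))
    (λ h i k a e → h i k a (trans (sym (τ-involutive j (lookup c i)))
      (trans (cong (τ j) (trans (sym (lookup-map i (τ j) c)) (trans e (lookup-map k (τ j) c)))) (τ-involutive j (lookup c k))))))

length-filter : ∀ {A : Set} {b : A → Bool} (P? : ∀ a → Dec (b a ≡ true)) xs → length (filter P? xs) ≡ sum (map (λ a → 𝟙 (b a)) xs)
length-filter         P? []       = refl
length-filter {b = b} P? (x ∷ xs) with P? x
... | yes e rewrite e = cong suc (length-filter P? xs)
... | no ¬e with b x
...   | false = length-filter P? xs
...   | true  = ⊥-elim (¬e refl)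

Σ<-sum : ∀ {A : Set} n (f : ℕ → A → ℕ) xs → Σ< n (λ j → sum (map (f j) xs)) ≡ sum (map (λ a → Σ< n (λ j → f j a)) xs)
Σ<-sum n f []       = Σ<-0 n
Σ<-sum n f (x ∷ xs) = trans (Σ<-+ n (λ j → f j x) _) (cong (Σ< n (λ j → f j x) +_) (Σ<-sum n f xs))

Σ<-select : ∀ n k b (g : ℕ → ℕ) → k < n → Σ< n (λ j → g j * 𝟙 ((k ≡ᵇ j) ∧ b)) ≡ g k * 𝟙 b
Σ<-select (suc n) zero    b g h       = trans (cong (g 0 * 𝟙 b +_) (trans (Σ<-cong n (λ j _ → *-zeroʳ (g (suc j)))) (Σ<-0 n))) (+-identityʳ _)
Σ<-select (suc n) (suc k) b g (s≤s h) = trans (cong (_+ Σ< n (λ j → g (suc j) * 𝟙 ((k ≡ᵇ j) ∧ b))) (*-zeroʳ (g 0))) (Σ<-select n k b (λ j → g (suc j)) h)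

-- The constant weight 1 gives `𝓑`, the identity gives `𝓣`.
sum-g*S : ∀ G (g : ℕ → ℕ) → 0 < order G →
  sum (map (λ k → g k * S G k) (map suc (upTo (order G)))) ≡
  sum (map (λ p → g (proj₂ p) * χ G (proj₁ p)) (partitions (order G)))
sum-g*S G g n>0 = begin
  sum (map (λ k → g k * S G k) (map suc (upTo n)))               ≡⟨ cong sum (sym (map-∘ (upTo n))) ⟩
  sum (map (λ j → g (suc j) * S G (suc j)) (upTo n))             ≡⟨ sum-applyUpTo (λ j → g (suc j) * S G (suc j)) id n ⟩
  Σ< n (λ j → g (suc j) * S G (suc j))
    ≡⟨ Σ<-cong n (λ j _ → trans (cong (g (suc j) *_) (length-filter _ (partitions n))) (sum-*ˡ (g (suc j)) _ (partitions n))) ⟩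
  Σ< n (λ j → sum (map (λ p → g (suc j) * 𝟙 ((proj₂ p ≡ᵇ suc j) ∧ isStablePartition G (proj₁ p))) (partitions n)))
    ≡⟨ Σ<-sum n _ (partitions n) ⟩
  sum (map (λ p → Σ< n (λ j → g (suc j) * 𝟙 ((proj₂ p ≡ᵇ suc j) ∧ isStablePartition G (proj₁ p)))) (partitions n))
    ≡⟨ cong sum (map-cong-local (All.map select (partitions-wellFormed n))) ⟩
  sum (map (λ p → g (proj₂ p) * χ G (proj₁ p)) (partitions n))   ∎
  where
  open ≡-Reasoning
  n = order G
  sum-*ˡ : ∀ {A : Set} c (f : A → ℕ) xs → c * sum (map f xs) ≡ sum (map (λ a → c * f a) xs)
  sum-*ˡ c f []       = *-zeroʳ c
  sum-*ˡ c f (x ∷ xs) = trans (*-distribˡ-+ c (f x) _) (cong (c * f x +_) (sum-*ˡ c f xs))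
  select : ∀ {p} → WellFormed p →
    Σ< n (λ j → g (suc j) * 𝟙 ((proj₂ p ≡ᵇ suc j) ∧ isStablePartition G (proj₁ p))) ≡ g (proj₂ p) * χ G (proj₁ p)
  select {v , zero}  (_ , _ , h) with () ← h n>0
  select {v , suc k} (_ , h , _) = Σ<-select n k (isStablePartition G v) (λ j → g (suc j)) h

𝓑≡sum : ∀ G → 0 < order G → 𝓑 G ≡ sum (σ G)
𝓑≡sum G h = trans (cong sum (map-cong (λ k → sym (*-identityˡ (S G k))) (map suc (upTo (order G)))))
  (trans (sum-g*S G (λ _ → 1) h) (sym (sum-collect (χ G) (partitions (order G)))))

𝓣≡T : ∀ G → 0 < order G → 𝓣 G ≡ T (σ G)
𝓣≡T G h = trans (sum-g*S G id h) (sym (T-collect (χ G) (partitions (order G))))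

-- Chromatic polynomials of unions, paths and cycles

Σ<-swap : ∀ x y (h : ℕ → ℕ → ℕ) → Σ< x (λ a → Σ< y (h a)) ≡ Σ< y (λ b → Σ< x (λ a → h a b))
Σ<-swap zero    y h = sym (Σ<-0 y)
Σ<-swap (suc x) y h = trans (cong (Σ< y (h 0) +_) (Σ<-swap x y (λ a → h (suc a)))) (sym (Σ<-+ y (h 0) _))

csum-insertAt : ∀ x n (i : Fin (suc n)) F → csum x (suc n) F ≡ Σ< x (λ a → csum x n (λ c → F (Vec.insertAt c i a)))
csum-insertAt x n       zero    F = refl
csum-insertAt x (suc n) (suc i) F = trans
  (Σ<-cong x (λ b _ → csum-insertAt x n i (λ c → F (b ∷ c))))
  (Σ<-swap x x (λ b a → csum x n (λ c → F (b ∷ Vec.insertAt c i a))))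

lookup-insertAt : ∀ {n} (c : Vec ℕ n) i a → lookup (Vec.insertAt c i a) i ≡ a
lookup-insertAt c       zero    a = refl
lookup-insertAt (b ∷ c) (suc i) a = lookup-insertAt c i a

lookup-insertAt-punchIn : ∀ {n} (c : Vec ℕ n) i a j → lookup (Vec.insertAt c i a) (punchIn i j) ≡ lookup c j
lookup-insertAt-punchIn c       zero    a j       = refl
lookup-insertAt-punchIn (b ∷ c) (suc i) a zero    = refl
lookup-insertAt-punchIn (b ∷ c) (suc i) a (suc j) = lookup-insertAt-punchIn c i a j

permute : ∀ {m n} → Permutation m n → Vec ℕ n → Vec ℕ m
permute π c = Vec.tabulate (λ i → lookup c (π ⟨$⟩ʳ i))

-- The colour of vertex 0 sits at position π 0 on the other side. It is summed over there, and
-- `remove zero π` handles the remaining vertices.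
csum-permute : ∀ x {m n} (π : Permutation m n) (F : Vec ℕ m → ℕ) → csum x m F ≡ csum x n (λ c → F (permute π c))
csum-permute x {m} {n} π F with ↔⇒≡ π
csum-permute x {zero}  π F | refl = refl
csum-permute x {suc m} π F | refl = begin
  Σ< x (λ a → csum x m (λ c → F (a ∷ c)))
    ≡⟨ Σ<-cong x (λ a _ → csum-permute x (remove zero π) (λ c → F (a ∷ c))) ⟩
  Σ< x (λ a → csum x m (λ c → F (a ∷ permute (remove zero π) c)))
    ≡⟨ Σ<-cong x (λ a _ → csum-cong x m (λ c → cong F (sym (permute-insertAt c a)))) ⟩
  Σ< x (λ a → csum x m (λ c → F (permute π (Vec.insertAt c (π ⟨$⟩ʳ zero) a))))
    ≡⟨ csum-insertAt x m (π ⟨$⟩ʳ zero) (λ c → F (permute π c)) ⟨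
  csum x (suc m) (λ c → F (permute π c)) ∎
  where
  open ≡-Reasoning
  permute-insertAt : ∀ c a → permute π (Vec.insertAt c (π ⟨$⟩ʳ zero) a) ≡ a ∷ permute (remove zero π) c
  permute-insertAt c a = cong₂ _∷_ (lookup-insertAt c (π ⟨$⟩ʳ zero) a)
    (tabulate-cong λ j → trans (cong (lookup (Vec.insertAt c (π ⟨$⟩ʳ zero) a)) (punchIn-permute π zero j))
                               (lookup-insertAt-punchIn c (π ⟨$⟩ʳ zero) a (remove zero π ⟨$⟩ʳ j)))

chromatic-≅ : ∀ G H → G ≅ H → ∀ x → chromatic G x ≡ chromatic H x
chromatic-≅ G H (π , adj-eq) x = trans (csum-permute x π (χ G))
  (csum-cong x (order H) (λ c → cong 𝟙 (stable-cong G H (permute π c) c (to c) (from c))))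
  where
  to : ∀ c → Proper G (permute π c) → Proper H c
  to c h i j a e = h (π ⟨$⟩ˡ i) (π ⟨$⟩ˡ j)
    (trans (sym (adj-eq (π ⟨$⟩ˡ i) (π ⟨$⟩ˡ j))) (trans (cong₂ (adj H) (inverseʳ π) (inverseʳ π)) a))
    (trans (lookup∘tabulate _ (π ⟨$⟩ˡ i)) (trans (cong (lookup c) (inverseʳ π)) (trans e
      (sym (trans (lookup∘tabulate _ (π ⟨$⟩ˡ j)) (cong (lookup c) (inverseʳ π)))))))
  from : ∀ c → Proper H c → Proper G (permute π c)
  from c h i j a e = h (π ⟨$⟩ʳ i) (π ⟨$⟩ʳ j) (trans (adj-eq i j) a)
    (trans (sym (lookup∘tabulate _ i)) (trans e (lookup∘tabulate _ j)))

csum-++ : ∀ x m n F → csum x (m + n) F ≡ csum x m (λ c → csum x n (λ d → F (c Vec.++ d)))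
csum-++ x zero    n F = refl
csum-++ x (suc m) n F = Σ<-cong x (λ a _ → csum-++ x m n (λ c → F (a ∷ c)))

proper-∪ : ∀ G H c d → Proper G c → Proper H d → Proper (G ∪ᴳ H) (c Vec.++ d)
proper-∪ G H c d p q i j a e
  with splitAt (order G) i | lookup-splitAt (order G) c d i | splitAt (order G) j | lookup-splitAt (order G) c d j
... | inj₁ i′ | eq | inj₁ j′ | eq′ = p i′ j′ a (trans (sym eq) (trans e eq′))
... | inj₂ i′ | eq | inj₂ j′ | eq′ = q i′ j′ a (trans (sym eq) (trans e eq′))
... | inj₁ i′ | eq | inj₂ j′ | eq′ with () ← a
... | inj₂ i′ | eq | inj₁ j′ | eq′ with () ← a

adj-∪ˡ : ∀ G H i j → adj (G ∪ᴳ H) (i ↑ˡ order H) (j ↑ˡ order H) ≡ adj G i j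
adj-∪ˡ G H i j rewrite splitAt-↑ˡ (order G) i (order H) | splitAt-↑ˡ (order G) j (order H) = refl

adj-∪ʳ : ∀ G H i j → adj (G ∪ᴳ H) (order G ↑ʳ i) (order G ↑ʳ j) ≡ adj H i j
adj-∪ʳ G H i j rewrite splitAt-↑ʳ (order G) (order H) i | splitAt-↑ʳ (order G) (order H) j = refl

proper-∪⁻ˡ : ∀ G H c d → Proper (G ∪ᴳ H) (c Vec.++ d) → Proper G c
proper-∪⁻ˡ G H c d p i j a e = p (i ↑ˡ order H) (j ↑ˡ order H) (trans (adj-∪ˡ G H i j) a)
  (trans (lookup-++ˡ c d i) (trans e (sym (lookup-++ˡ c d j))))

proper-∪⁻ʳ : ∀ G H c d → Proper (G ∪ᴳ H) (c Vec.++ d) → Proper H d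
proper-∪⁻ʳ G H c d p i j a e = p (order G ↑ʳ i) (order G ↑ʳ j) (trans (adj-∪ʳ G H i j) a)
  (trans (lookup-++ʳ c d i) (trans e (sym (lookup-++ʳ c d j))))

𝟙-∧ : ∀ b c → 𝟙 (b ∧ c) ≡ 𝟙 b * 𝟙 c
𝟙-∧ true  c = sym (*-identityˡ _)
𝟙-∧ false c = refl

χ-∪ : ∀ G H c d → χ (G ∪ᴳ H) (c Vec.++ d) ≡ χ G c * χ H d
χ-∪ G H c d = trans (cong 𝟙 (true-ext
  (λ h → let p = stable⇒proper (G ∪ᴳ H) (c Vec.++ d) h in
    cong₂ _∧_ (proper⇒stable G c (proper-∪⁻ˡ G H c d p)) (proper⇒stable H d (proper-∪⁻ʳ G H c d p)))
  (λ h → let (p , q) = ∧-true {isStablePartition G c} h in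
    proper⇒stable (G ∪ᴳ H) (c Vec.++ d) (proper-∪ G H c d (stable⇒proper G c p) (stable⇒proper H d q)))))
  (𝟙-∧ (isStablePartition G c) (isStablePartition H d))

chromatic-∪ : ∀ G H x → chromatic (G ∪ᴳ H) x ≡ chromatic G x * chromatic H x
chromatic-∪ G H x = begin
  chromatic (G ∪ᴳ H) x                                            ≡⟨ csum-++ x (order G) (order H) (χ (G ∪ᴳ H)) ⟩
  csum x (order G) (λ c → csum x (order H) (λ d → χ (G ∪ᴳ H) (c Vec.++ d)))
    ≡⟨ csum-cong x (order G) (λ c → trans (csum-cong x (order H) (χ-∪ G H c))
         (trans (csum-* x (order H) (χ G c) (χ H)) (*-comm (χ G c) _))) ⟩
  csum x (order G) (λ c → chromatic H x * χ G c)                  ≡⟨ csum-* x (order G) (chromatic H x) (χ G) ⟩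
  chromatic H x * chromatic G x                                   ≡⟨ *-comm (chromatic H x) _ ⟩
  chromatic G x * chromatic H x                                   ∎
  where open ≡-Reasoning

σ-≅ : ∀ G H → G ≅ H → σ G ≈ σ H
σ-≅ G H f x = trans (eval-σ G x) (trans (chromatic-≅ G H f x) (sym (eval-σ H x)))

σ-∪ : ∀ G H → σ (G ∪ᴳ H) ≈ σ G ⊛ σ H
σ-∪ G H x = trans (eval-σ (G ∪ᴳ H) x) (trans (chromatic-∪ G H x)
  (sym (trans (eval-⊛ (σ G) (σ H) x) (cong₂ _*_ (eval-σ G x) (eval-σ H x)))))

order-≅ : ∀ {G H} → G ≅ H → order G ≡ order H
order-≅ (π , _) = ↔⇒≡ π

pathNext : ∀ {m} → Fin m → Fin m → Bool
pathNext i j = suc (toℕ i) ≡ᵇ toℕ j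

cycleNext : ∀ {m} → Fin m → Fin m → Bool
cycleNext {m} i j = (suc (toℕ i) ≡ᵇ toℕ j) ∨ ((suc (toℕ i) ≡ᵇ m) ∧ (toℕ j ≡ᵇ 0))

pathGraph : ℕ → Graph
pathGraph m = mkGraph m pathNext

mkGraph-adj : ∀ {n} R (i j : Fin n) → adj (mkGraph n R) i j ≡ true → i ≢ j × ((R i j ≡ true) ⊎ (R j i ≡ true))
mkGraph-adj R i j h with i Fin.≟ j
... | yes _  with () ← h
... | no i≢j with R i j in eq | R j i in eq′ | h
...   | true  | _    | _ = i≢j , inj₁ refl
...   | false | true | _ = i≢j , inj₂ refl

mkGraph-adj⁺ : ∀ {n} R (i j : Fin n) → i ≢ j → (R i j ≡ true) ⊎ (R j i ≡ true) → adj (mkGraph n R) i j ≡ true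
mkGraph-adj⁺ R i j i≢j h with i Fin.≟ j
... | yes i≡j = ⊥-elim (i≢j i≡j)
mkGraph-adj⁺ R i j i≢j (inj₁ h) | no _ rewrite h = refl
mkGraph-adj⁺ R i j i≢j (inj₂ h) | no _ rewrite h with R i j
... | true  = refl
... | false = refl

Adjacent : (G : Graph) → Fin (order G) → Fin (order G) → Set
Adjacent G i j = adj G i j ≡ true

path-adj : ∀ m {i j : Fin m} → Adjacent (pathGraph m) i j → (suc (toℕ i) ≡ toℕ j) ⊎ (suc (toℕ j) ≡ toℕ i)
path-adj m {i} {j} h with mkGraph-adj pathNext i j h
... | _ , inj₁ e = inj₁ (≡ᵇ-true _ _ e)
... | _ , inj₂ e = inj₂ (≡ᵇ-true _ _ e)

1+n≡n⇒⊥ : ∀ {n : ℕ} {A : Set} → suc n ≡ n → A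
1+n≡n⇒⊥ ()

path-adj⁺ : ∀ m {i j : Fin m} → (suc (toℕ i) ≡ toℕ j) ⊎ (suc (toℕ j) ≡ toℕ i) → Adjacent (pathGraph m) i j
path-adj⁺ m {i} {j} (inj₁ e) = mkGraph-adj⁺ pathNext i j (λ { refl → 1+n≡n⇒⊥ e }) (inj₁ (trans (cong (_≡ᵇ toℕ j) e) (≡ᵇ-refl (toℕ j))))
path-adj⁺ m {i} {j} (inj₂ e) = mkGraph-adj⁺ pathNext i j (λ { refl → 1+n≡n⇒⊥ e }) (inj₂ (trans (cong (_≡ᵇ toℕ i) e) (≡ᵇ-refl (toℕ i))))

Next : ℕ → ℕ → ℕ → Set
Next m i j = (suc i ≡ j) ⊎ ((suc i ≡ m) × (j ≡ 0))

next-true : ∀ m i j → ((suc i ≡ᵇ j) ∨ ((suc i ≡ᵇ m) ∧ (j ≡ᵇ 0))) ≡ true → Next m i j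
next-true m i j h with suc i ≡ᵇ j in eq
... | true  = inj₁ (≡ᵇ-true (suc i) j eq)
... | false with ∧-true {suc i ≡ᵇ m} h
...   | p , q = inj₂ (≡ᵇ-true (suc i) m p , ≡ᵇ-true j 0 q)

next-true⁺ : ∀ m i j → Next m i j → ((suc i ≡ᵇ j) ∨ ((suc i ≡ᵇ m) ∧ (j ≡ᵇ 0))) ≡ true
next-true⁺ m i .(suc i) (inj₁ refl) rewrite ≡ᵇ-refl i = refl
next-true⁺ .(suc i) i .0 (inj₂ (refl , refl)) rewrite ≡ᵇ-refl i = refl

cycle-adj : ∀ m {i j : Fin m} → Adjacent (C m) i j → Next m (toℕ i) (toℕ j) ⊎ Next m (toℕ j) (toℕ i)
cycle-adj m {i} {j} h with mkGraph-adj cycleNext i j h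
... | _ , inj₁ e = inj₁ (next-true m _ _ e)
... | _ , inj₂ e = inj₂ (next-true m _ _ e)

next-irrefl : ∀ {m i} → Next (2 + m) i i → ∀ {A : Set} → A
next-irrefl (inj₁ e) = 1+n≡n⇒⊥ e
next-irrefl (inj₂ (e , refl)) with () ← e

cycle-adj⁺ : ∀ m {i j : Fin (2 + m)} → Next (2 + m) (toℕ i) (toℕ j) ⊎ Next (2 + m) (toℕ j) (toℕ i) → Adjacent (C (2 + m)) i j
cycle-adj⁺ m {i} {j} (inj₁ e) = mkGraph-adj⁺ cycleNext i j (λ { refl → next-irrefl e }) (inj₁ (next-true⁺ (2 + m) _ _ e))
cycle-adj⁺ m {i} {j} (inj₂ e) = mkGraph-adj⁺ cycleNext i j (λ { refl → next-irrefl e }) (inj₂ (next-true⁺ (2 + m) _ _ e))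

pathColoured : ∀ {n} → Vec ℕ (suc n) → Bool
pathColoured (a ∷ [])    = true
pathColoured (a ∷ b ∷ c) = not (a ≡ᵇ b) ∧ pathColoured (b ∷ c)

end : ∀ {n} → Vec ℕ (suc n) → ℕ
end (a ∷ [])    = a
end (a ∷ b ∷ c) = end (b ∷ c)

lookup-end : ∀ {n} (c : Vec ℕ (suc n)) i → suc (toℕ i) ≡ suc n → lookup c i ≡ end c
lookup-end (a ∷ [])    zero    e = refl
lookup-end (a ∷ b ∷ c) (suc i) e = lookup-end (b ∷ c) i (suc-injective e)

not-≡ᵇ : ∀ a b → not (a ≡ᵇ b) ≡ true → a ≢ b
not-≡ᵇ a .a h refl rewrite ≡ᵇ-refl a with () ← h

not-≡ᵇ⁺ : ∀ a b → a ≢ b → not (a ≡ᵇ b) ≡ true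
not-≡ᵇ⁺ a b h with a ≡ᵇ b in eq
... | true  = ⊥-elim (h (≡ᵇ-true a b eq))
... | false = refl

pathColoured-≢ : ∀ {n} (c : Vec ℕ (suc n)) → pathColoured c ≡ true → ∀ i j → suc (toℕ i) ≡ toℕ j → lookup c i ≢ lookup c j
pathColoured-≢ (a ∷ b ∷ c) h zero    (suc zero) e = not-≡ᵇ a b (proj₁ (∧-true h))
pathColoured-≢ (a ∷ b ∷ c) h (suc i) (suc j)    e = pathColoured-≢ (b ∷ c) (proj₂ (∧-true {not (a ≡ᵇ b)} h)) i j (suc-injective e)
pathColoured-≢ (a ∷ [])    h zero    zero       ()

pathColoured-≢⁺ : ∀ {n} (c : Vec ℕ (suc n)) → (∀ i j → suc (toℕ i) ≡ toℕ j → lookup c i ≢ lookup c j) → pathColoured c ≡ true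
pathColoured-≢⁺ (a ∷ [])    h = refl
pathColoured-≢⁺ (a ∷ b ∷ c) h = cong₂ _∧_ (not-≡ᵇ⁺ a b (h zero (suc zero) refl))
  (pathColoured-≢⁺ (b ∷ c) (λ i j e → h (suc i) (suc j) (cong suc e)))

stable-path : ∀ {n} (c : Vec ℕ (suc n)) → isStablePartition (pathGraph (suc n)) c ≡ pathColoured c
stable-path {n} c = true-ext
  (λ h → pathColoured-≢⁺ c (λ i j e → stable⇒proper (pathGraph (suc n)) c h i j (path-adj⁺ (suc n) (inj₁ e))))
  (λ h → proper⇒stable (pathGraph (suc n)) c (λ i j a e → go h i j e (path-adj (suc n) a)))
  where
  go : pathColoured c ≡ true → ∀ i j → lookup c i ≡ lookup c j → ¬ ((suc (toℕ i) ≡ toℕ j) ⊎ (suc (toℕ j) ≡ toℕ i))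
  go h i j e (inj₁ p) = pathColoured-≢ c h i j p e
  go h i j e (inj₂ p) = pathColoured-≢ c h j i p (sym e)

stable-cycle : ∀ {n} a (c : Vec ℕ (2 + n)) →
  isStablePartition (C (3 + n)) (a ∷ c) ≡ pathColoured (a ∷ c) ∧ not (end (a ∷ c) ≡ᵇ a)
stable-cycle {n} a c = true-ext
  (λ h → let p = stable⇒proper (C (3 + n)) (a ∷ c) h in cong₂ _∧_
    (pathColoured-≢⁺ (a ∷ c) (λ i j e → p i j (cycle-adj⁺ (suc n) (inj₁ (inj₁ e)))))
    (not-≡ᵇ⁺ _ a λ e → p (fromℕ (2 + n)) zero (cycle-adj⁺ (suc n) {fromℕ (2 + n)} {zero} (inj₁ (inj₂ (cong suc (toℕ-fromℕ (2 + n)) , refl))))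
      (trans (lookup-end (a ∷ c) (fromℕ (2 + n)) (cong suc (toℕ-fromℕ (2 + n)))) e)))
  (λ h → proper⇒stable (C (3 + n)) (a ∷ c) (λ i j a′ e → go (∧-true h) i j e (cycle-adj (3 + n) a′)))
  where
  step : (pathColoured (a ∷ c) ≡ true) × (not (end (a ∷ c) ≡ᵇ a) ≡ true) →
    ∀ i j → lookup (a ∷ c) i ≡ lookup (a ∷ c) j → ¬ Next (3 + n) (toℕ i) (toℕ j)
  step (h , _)  i j    e (inj₁ p)       = pathColoured-≢ (a ∷ c) h i j p e
  step (_ , h′) i zero e (inj₂ (p , _)) = not-≡ᵇ _ a h′ (trans (sym (lookup-end (a ∷ c) i p)) e)
  go : (pathColoured (a ∷ c) ≡ true) × (not (end (a ∷ c) ≡ᵇ a) ≡ true) →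
    ∀ i j → lookup (a ∷ c) i ≡ lookup (a ∷ c) j → ¬ (Next (3 + n) (toℕ i) (toℕ j) ⊎ Next (3 + n) (toℕ j) (toℕ i))
  go h i j e (inj₁ p) = step h i j e p
  go h i j e (inj₂ p) = step h j i (sym e) p

Σ<-≢ : ∀ x a h → a < x → Σ< x (λ b → 𝟙 (not (a ≡ᵇ b)) * h b) + h a ≡ Σ< x h
Σ<-≢ (suc x) zero    h _       = trans (cong (_+ h 0) (Σ<-cong x (λ b _ → *-identityˡ (h (suc b))))) (+-comm _ (h 0))
Σ<-≢ (suc x) (suc a) h (s≤s p) = trans (cong (λ z → z + Σ< x (λ b → 𝟙 (not (a ≡ᵇ b)) * h (suc b)) + h (suc a)) (*-identityˡ (h 0)))
  (trans (+-assoc (h 0) _ _) (cong (h 0 +_) (Σ<-≢ x a (λ b → h (suc b)) p)))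

Σ<-const : ∀ x c → Σ< x (λ _ → c) ≡ x * c
Σ<-const zero    c = refl
Σ<-const (suc x) c = cong (c +_) (Σ<-const x c)

Σ<-if : ∀ x z E O → z < x → Σ< x (λ b → if b ≡ᵇ z then E else O) + O ≡ x * O + E
Σ<-if (suc x) zero    E O _       = trans (cong (λ t → E + t + O) (Σ<-const x O)) (lem E O (x * O))
  where
  lem : ∀ e o t → e + t + o ≡ o + t + e
  lem = solve-∀
Σ<-if (suc x) (suc z) E O (s≤s p) = trans (+-assoc O _ O) (trans (cong (O +_) (Σ<-if x z E O p)) (sym (+-assoc O (x * O) E)))

csum-path : ∀ x m a → a < x → csum x m (λ c → 𝟙 (pathColoured (a ∷ c))) ≡ (x ∸ 1) ^ m
csum-path x       zero    a h = refl
csum-path (suc y) (suc m) a h = begin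
  Σ< (suc y) (λ b → csum (suc y) m (λ c → 𝟙 (not (a ≡ᵇ b) ∧ pathColoured (b ∷ c))))
    ≡⟨ Σ<-cong (suc y) (λ b p → trans (csum-cong (suc y) m (λ c → 𝟙-∧ (not (a ≡ᵇ b)) (pathColoured (b ∷ c))))
        (trans (csum-* (suc y) m (𝟙 (not (a ≡ᵇ b))) _) (cong (𝟙 (not (a ≡ᵇ b)) *_) (csum-path (suc y) m b p)))) ⟩
  Σ< (suc y) (λ b → 𝟙 (not (a ≡ᵇ b)) * y ^ m)
    ≡⟨ +-cancelʳ-≡ (y ^ m) _ _ (trans (Σ<-≢ (suc y) a (λ _ → y ^ m) h) (trans (Σ<-const (suc y) (y ^ m)) (+-comm (y ^ m) _))) ⟩
  y * y ^ m ∎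
  where open ≡-Reasoning

chromatic-path : ∀ m x → chromatic (pathGraph (suc m)) x ≡ x * (x ∸ 1) ^ m
chromatic-path m x = trans (Σ<-cong x (λ a h → trans (csum-cong x m (λ c → cong 𝟙 (stable-path (a ∷ c)))) (csum-path x m a h)))
  (Σ<-const x _)

≡ᵇ-false : ∀ a b → (a ≡ᵇ b) ≡ false → a ≢ b
≡ᵇ-false a .a h refl rewrite ≡ᵇ-refl a with () ← h

two-colours : ∀ {y a z} → a < suc y → z < suc y → a ≢ z → ∃ λ y′ → y ≡ suc y′
two-colours {zero}  (s≤s z≤n) (s≤s z≤n) a≢z = ⊥-elim (a≢z refl)
two-colours {suc y} _         _         _   = y , refl

-- The forbidden end colour z is kept independent of the start a, because the induction moves the
-- start along the path while z stays.
csum-cycle : ∀ x m a z → a < x → z < x →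
  csum x m (λ c → 𝟙 (pathColoured (a ∷ c) ∧ not (end (a ∷ c) ≡ᵇ z))) ≡ (if a ≡ᵇ z then e m (x ∸ 1) else o m (x ∸ 1))
csum-cycle x zero    a z h h′ with a ≡ᵇ z
... | true  = refl
... | false = refl
csum-cycle (suc y) (suc m) a z h h′ = trans step finish
  where
  E O : ℕ
  E = e m y
  O = o m y
  g : ℕ → ℕ
  g b = if b ≡ᵇ z then E else O
  ∧-assoc′ : ∀ p q r → 𝟙 ((p ∧ q) ∧ r) ≡ 𝟙 p * 𝟙 (q ∧ r)
  ∧-assoc′ true  q r = sym (*-identityˡ _)
  ∧-assoc′ false q r = refl
  step : csum (suc y) (suc m) (λ c → 𝟙 (pathColoured (a ∷ c) ∧ not (end (a ∷ c) ≡ᵇ z))) ≡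
         Σ< (suc y) (λ b → 𝟙 (not (a ≡ᵇ b)) * g b)
  step = Σ<-cong (suc y) λ b p → trans
    (csum-cong (suc y) m (λ c → ∧-assoc′ (not (a ≡ᵇ b)) (pathColoured (b ∷ c)) (not (end (b ∷ c) ≡ᵇ z))))
    (trans (csum-* (suc y) m (𝟙 (not (a ≡ᵇ b))) _) (cong (𝟙 (not (a ≡ᵇ b)) *_) (csum-cycle (suc y) m b z p h′)))
  H : ℕ
  H = Σ< (suc y) (λ b → 𝟙 (not (a ≡ᵇ b)) * g b)
  -- The terms excluded by b ≠ a and b = z are added back instead of being subtracted.
  total : H + g a + O ≡ suc y * O + E
  total = trans (cong (_+ O) (Σ<-≢ (suc y) a g h)) (Σ<-if (suc y) z E O h′)
  finish : H ≡ (if a ≡ᵇ z then e (suc m) y else o (suc m) y)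
  finish with a ≡ᵇ z in eq | total
  ... | true  | t = +-cancelʳ-≡ (E + O) _ _ (trans (sym (+-assoc H E O)) (trans t (lem y E O)))
    where
    lem : ∀ y e o → o + y * o + e ≡ y * o + (e + o)
    lem = solve-∀
  ... | false | t with two-colours h h′ (≡ᵇ-false a z eq)
  ...   | y′ , refl = +-cancelʳ-≡ (O + O) _ _ (trans (sym (+-assoc H O O)) (trans t (lem y′ E O)))
    where
    lem : ∀ y e o → o + (o + y * o) + e ≡ e + y * o + (o + o)
    lem = solve-∀

chromatic-cycle : ∀ m x → chromatic (C (3 + m)) x ≡ x * e (2 + m) (x ∸ 1)
chromatic-cycle m x = trans (Σ<-cong x λ a h → trans
    (csum-cong x (2 + m) (λ c → cong 𝟙 (stable-cycle a c)))
    (trans (csum-cycle x (2 + m) a a h h) (cong (λ b → if b then e (2 + m) (x ∸ 1) else o (2 + m) (x ∸ 1)) (≡ᵇ-refl a))))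
  (Σ<-const x _)

σ-path : ∀ m → σ (pathGraph (suc m)) ≈ path m
σ-path m x = trans (eval-σ (pathGraph (suc m)) x) (trans (chromatic-path m x) (sym (eval-path m x)))

σ-cycle : ∀ m → σ (C (3 + m)) ≈ cycle (2 + m)
σ-cycle m x = trans (eval-σ (C (3 + m)) x) (trans (chromatic-cycle m x) (sym (eval-cycle (2 + m) x)))

-- Decomposition into paths and cycles

-- With arbitrary vertex types a disjoint union is a sum type, and components can be rearranged
-- without index arithmetic in `Fin`.
record Rel : Set₁ where
  field
    V : Set
    E : V → V → Set
open Rel

infix 4 _≃_
record _≃_ (A B : Rel) : Set where
  field
    to      : V A → V B
    from    : V B → V A
    to-from : ∀ b → to (from b) ≡ b
    from-to : ∀ a → from (to a) ≡ a
    E-to    : ∀ {a a′} → E A a a′ → E B (to a) (to a′)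
    E-from  : ∀ {a a′} → E B (to a) (to a′) → E A a a′
open _≃_

≃-refl : ∀ {A} → A ≃ A
≃-refl = record { to = id ; from = id ; to-from = λ _ → refl ; from-to = λ _ → refl ; E-to = id ; E-from = id }

≃-sym : ∀ {A B} → A ≃ B → B ≃ A
≃-sym {A} {B} f = record
  { to      = from f
  ; from    = to f
  ; to-from = from-to f
  ; from-to = to-from f
  ; E-to    = λ {b} {b′} h → E-from f (subst₂ (E B) (sym (to-from f b)) (sym (to-from f b′)) h)
  ; E-from  = λ {b} {b′} h → subst₂ (E B) (to-from f b) (to-from f b′) (E-to f h)
  }

≃-trans : ∀ {A B C} → A ≃ B → B ≃ C → A ≃ C
≃-trans f g = record
  { to      = λ a → to g (to f a)
  ; from    = λ c → from f (from g c)
  ; to-from = λ c → trans (cong (to g) (to-from f (from g c))) (to-from g c)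
  ; from-to = λ a → trans (cong (from f) (from-to g (to f a))) (from-to f a)
  ; E-to    = λ h → E-to g (E-to f h)
  ; E-from  = λ h → E-from f (E-from g h)
  }

⟪_⟫ : Graph → Rel
⟪ G ⟫ = record { V = Fin (order G) ; E = Adjacent G }

≃⇒≅ : ∀ {G H} → ⟪ G ⟫ ≃ ⟪ H ⟫ → G ≅ H
≃⇒≅ f = mk↔ₛ′ (to f) (from f) (to-from f) (from-to f) , λ i j → true-ext (E-from f) (E-to f)

≅⇒≃ : ∀ {G H} → G ≅ H → ⟪ G ⟫ ≃ ⟪ H ⟫
≅⇒≃ (π , eq) = record
  { to = Inverse.to π ; from = Inverse.from π
  ; to-from = λ b → Inverse.inverseˡ π refl ; from-to = λ a → Inverse.inverseʳ π refl
  ; E-to = λ {i} {j} h → trans (eq i j) h ; E-from = λ {i} {j} h → trans (sym (eq i j)) h }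

infixr 5 _⊎ᴿ_
_⊎ᴿ_ : Rel → Rel → Rel
A ⊎ᴿ B = record { V = V A ⊎ V B ; E = E′ }
  where
  E′ : V A ⊎ V B → V A ⊎ V B → Set
  E′ (inj₁ a) (inj₁ a′) = E A a a′
  E′ (inj₂ b) (inj₂ b′) = E B b b′
  E′ _        _         = ⊥

∅ᴿ : Rel
∅ᴿ = record { V = ⊥ ; E = λ _ _ → ⊥ }

⊎ᴿ-cong : ∀ {A A′ B B′} → A ≃ A′ → B ≃ B′ → A ⊎ᴿ B ≃ A′ ⊎ᴿ B′
⊎ᴿ-cong f g = record
  { to      = λ { (inj₁ a) → inj₁ (to f a) ; (inj₂ b) → inj₂ (to g b) }
  ; from    = λ { (inj₁ a) → inj₁ (from f a) ; (inj₂ b) → inj₂ (from g b) }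
  ; to-from = λ { (inj₁ a) → cong inj₁ (to-from f a) ; (inj₂ b) → cong inj₂ (to-from g b) }
  ; from-to = λ { (inj₁ a) → cong inj₁ (from-to f a) ; (inj₂ b) → cong inj₂ (from-to g b) }
  ; E-to    = λ { {inj₁ a} {inj₁ a′} h → E-to f h ; {inj₂ a} {inj₂ a′} h → E-to g h }
  ; E-from  = λ { {inj₁ a} {inj₁ a′} h → E-from f h ; {inj₂ a} {inj₂ a′} h → E-from g h }
  }

⊎ᴿ-comm : ∀ {A B} → A ⊎ᴿ B ≃ B ⊎ᴿ A
⊎ᴿ-comm = record
  { to      = λ { (inj₁ a) → inj₂ a ; (inj₂ b) → inj₁ b }
  ; from    = λ { (inj₁ a) → inj₂ a ; (inj₂ b) → inj₁ b }
  ; to-from = λ { (inj₁ a) → refl ; (inj₂ b) → refl }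
  ; from-to = λ { (inj₁ a) → refl ; (inj₂ b) → refl }
  ; E-to    = λ { {inj₁ a} {inj₁ a′} h → h ; {inj₂ a} {inj₂ a′} h → h }
  ; E-from  = λ { {inj₁ a} {inj₁ a′} h → h ; {inj₂ a} {inj₂ a′} h → h }
  }

⊎ᴿ-assoc : ∀ {A B C} → (A ⊎ᴿ B) ⊎ᴿ C ≃ A ⊎ᴿ B ⊎ᴿ C
⊎ᴿ-assoc = record
  { to      = λ { (inj₁ (inj₁ a)) → inj₁ a ; (inj₁ (inj₂ b)) → inj₂ (inj₁ b) ; (inj₂ c) → inj₂ (inj₂ c) }
  ; from    = λ { (inj₁ a) → inj₁ (inj₁ a) ; (inj₂ (inj₁ b)) → inj₁ (inj₂ b) ; (inj₂ (inj₂ c)) → inj₂ c }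
  ; to-from = λ { (inj₁ a) → refl ; (inj₂ (inj₁ b)) → refl ; (inj₂ (inj₂ c)) → refl }
  ; from-to = λ { (inj₁ (inj₁ a)) → refl ; (inj₁ (inj₂ b)) → refl ; (inj₂ c) → refl }
  ; E-to    = λ { {inj₁ (inj₁ a)} {inj₁ (inj₁ a′)} h → h ; {inj₁ (inj₂ a)} {inj₁ (inj₂ a′)} h → h ; {inj₂ a} {inj₂ a′} h → h }
  ; E-from  = λ { {inj₁ (inj₁ a)} {inj₁ (inj₁ a′)} h → h ; {inj₁ (inj₂ a)} {inj₁ (inj₂ a′)} h → h
                ; {inj₂ a} {inj₂ a′} h → h
                ; {inj₁ (inj₁ a)} {inj₁ (inj₂ a′)} () ; {inj₁ (inj₂ a)} {inj₁ (inj₁ a′)} ()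
                ; {inj₁ (inj₁ a)} {inj₂ a′} () ; {inj₁ (inj₂ a)} {inj₂ a′} ()
                ; {inj₂ a} {inj₁ (inj₁ a′)} () ; {inj₂ a} {inj₁ (inj₂ a′)} () }
  }

⊎ᴿ-∅ : ∀ {A} → A ⊎ᴿ ∅ᴿ ≃ A
⊎ᴿ-∅ = record
  { to      = λ { (inj₁ a) → a }
  ; from    = inj₁
  ; to-from = λ _ → refl
  ; from-to = λ { (inj₁ a) → refl }
  ; E-to    = λ { {inj₁ a} {inj₁ a′} h → h }
  ; E-from  = λ { {inj₁ a} {inj₁ a′} h → h }
  }

⟪∪⟫ : ∀ G H → ⟪ G ∪ᴳ H ⟫ ≃ ⟪ G ⟫ ⊎ᴿ ⟪ H ⟫
⟪∪⟫ G H = record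
  { to      = splitAt (order G)
  ; from    = join (order G) (order H)
  ; to-from = splitAt-join (order G) (order H)
  ; from-to = join-splitAt (order G) (order H)
  ; E-to    = λ {i} {j} → to′ i j
  ; E-from  = λ {i} {j} → from′ i j
  }
  where
  to′ : ∀ i j → Adjacent (G ∪ᴳ H) i j → E (⟪ G ⟫ ⊎ᴿ ⟪ H ⟫) (splitAt (order G) i) (splitAt (order G) j)
  to′ i j h with splitAt (order G) i | splitAt (order G) j
  ... | inj₁ _ | inj₁ _ = h
  ... | inj₂ _ | inj₂ _ = h
  ... | inj₁ _ | inj₂ _ with () ← h
  ... | inj₂ _ | inj₁ _ with () ← h
  from′ : ∀ i j → E (⟪ G ⟫ ⊎ᴿ ⟪ H ⟫) (splitAt (order G) i) (splitAt (order G) j) → Adjacent (G ∪ᴳ H) i j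
  from′ i j h with splitAt (order G) i | splitAt (order G) j
  ... | inj₁ _ | inj₁ _ = h
  ... | inj₂ _ | inj₂ _ = h

⟪∅⟫ : ⟪ emptyGraph ⟫ ≃ ∅ᴿ
⟪∅⟫ = record { to = λ () ; from = λ () ; to-from = λ () ; from-to = λ () ; E-to = λ { {()} } ; E-from = λ { {()} } }

data Component : Set where
  pathᶜ cycleᶜ : ℕ → Component

componentGraph : Component → Graph
componentGraph (pathᶜ m)  = pathGraph (suc m)
componentGraph (cycleᶜ m) = C (3 + m)

⋃ : List Component → Graph
⋃ []       = emptyGraph
⋃ (c ∷ cs) = componentGraph c ∪ᴳ ⋃ cs

⋃ᴿ : List Component → Rel
⋃ᴿ []       = ∅ᴿ
⋃ᴿ (c ∷ cs) = ⟪ componentGraph c ⟫ ⊎ᴿ ⋃ᴿ cs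

⟪⋃⟫ : ∀ cs → ⟪ ⋃ cs ⟫ ≃ ⋃ᴿ cs
⟪⋃⟫ []       = ⟪∅⟫
⟪⋃⟫ (c ∷ cs) = ≃-trans (⟪∪⟫ (componentGraph c) (⋃ cs)) (⊎ᴿ-cong ≃-refl (⟪⋃⟫ cs))

infixl 6 _+[_,_]
_+[_,_] : (A : Rel) → V A → V A → Rel
A +[ p , q ] = record { V = V A ; E = λ u v → E A u v ⊎ ((u ≡ p × v ≡ q) ⊎ (u ≡ q × v ≡ p)) }

+-cong : ∀ {A B} (f : A ≃ B) p q → A +[ p , q ] ≃ B +[ to f p , to f q ]
+-cong f p q = record
  { to = to f ; from = from f ; to-from = to-from f ; from-to = from-to f
  ; E-to = λ { (inj₁ h) → inj₁ (E-to f h)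
             ; (inj₂ (inj₁ (refl , refl))) → inj₂ (inj₁ (refl , refl))
             ; (inj₂ (inj₂ (refl , refl))) → inj₂ (inj₂ (refl , refl)) }
  ; E-from = λ { (inj₁ h) → inj₁ (E-from f h)
               ; (inj₂ (inj₁ (e , e′))) → inj₂ (inj₁ (injective e , injective e′))
               ; (inj₂ (inj₂ (e , e′))) → inj₂ (inj₂ (injective e , injective e′)) }
  }
  where
  injective : ∀ {a b} → to f a ≡ to f b → a ≡ b
  injective {a} {b} e = trans (sym (from-to f a)) (trans (cong (from f) e) (from-to f b))

+-comm′ : ∀ {A} p q → A +[ p , q ] ≃ A +[ q , p ]
+-comm′ p q = record
  { to = id ; from = id ; to-from = λ _ → refl ; from-to = λ _ → refl
  ; E-to = λ { (inj₁ h) → inj₁ h ; (inj₂ (inj₁ h)) → inj₂ (inj₂ h) ; (inj₂ (inj₂ h)) → inj₂ (inj₁ h) }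
  ; E-from = λ { (inj₁ h) → inj₁ h ; (inj₂ (inj₁ h)) → inj₂ (inj₂ h) ; (inj₂ (inj₂ h)) → inj₂ (inj₁ h) } }

+-⊎ᴿ : ∀ {A B} p q → (A ⊎ᴿ B) +[ inj₁ p , inj₁ q ] ≃ (A +[ p , q ]) ⊎ᴿ B
+-⊎ᴿ p q = record
  { to = id ; from = id ; to-from = λ _ → refl ; from-to = λ _ → refl
  ; E-to = λ { {inj₁ a} {inj₁ a′} (inj₁ h) → inj₁ h
             ; {inj₂ b} {inj₂ b′} (inj₁ h) → h
             ; (inj₂ (inj₁ (refl , refl))) → inj₂ (inj₁ (refl , refl))
             ; (inj₂ (inj₂ (refl , refl))) → inj₂ (inj₂ (refl , refl)) }
  ; E-from = λ { {inj₁ a} {inj₁ a′} (inj₁ h) → inj₁ h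
               ; {inj₁ a} {inj₁ a′} (inj₂ (inj₁ (refl , refl))) → inj₂ (inj₁ (refl , refl))
               ; {inj₁ a} {inj₁ a′} (inj₂ (inj₂ (refl , refl))) → inj₂ (inj₂ (refl , refl))
               ; {inj₂ b} {inj₂ b′} h → inj₁ h } }

extract : ∀ cs (p : V (⋃ᴿ cs)) → Σ Component λ c → Σ (List Component) λ cs′ →
  Σ (⋃ᴿ cs ≃ ⋃ᴿ (c ∷ cs′)) λ f → Σ (V ⟪ componentGraph c ⟫) λ i → to f p ≡ inj₁ i
extract (c ∷ cs) (inj₁ i) = c , cs , ≃-refl , i , refl
extract (c ∷ cs) (inj₂ p) with extract cs p
... | c′ , cs′ , f , i , eq = c′ , c ∷ cs′ ,
  ≃-trans (⊎ᴿ-cong ≃-refl f) (≃-trans (≃-sym ⊎ᴿ-assoc) (≃-trans (⊎ᴿ-cong ⊎ᴿ-comm ≃-refl) ⊎ᴿ-assoc)) ,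
  i , cong (λ z → to ⊎ᴿ-assoc (to (⊎ᴿ-cong ⊎ᴿ-comm ≃-refl) (from ⊎ᴿ-assoc (inj₂ z)))) eq

-- Degree at most 1, so that one more edge may end at p.
Free : (A : Rel) → V A → Set
Free A p = ∀ a b → E A p a → E A p b → a ≡ b

Free-≃ : ∀ {A B} (f : A ≃ B) {p} → Free A p → Free B (to f p)
Free-≃ {A} {B} f {p} h a b x y = trans (sym (to-from f a)) (trans (cong (to f) (h (from f a) (from f b)
  (E-from f (subst (E B (to f p)) (sym (to-from f a)) x)) (E-from f (subst (E B (to f p)) (sym (to-from f b)) y)))) (to-from f b))

Free-inj₁ : ∀ {A B i} → Free (A ⊎ᴿ B) (inj₁ i) → Free A i
Free-inj₁ h a b x y with h (inj₁ a) (inj₁ b) x y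
... | refl = refl

Free-inj₂ : ∀ {A B i} → Free (A ⊎ᴿ B) (inj₂ i) → Free B i
Free-inj₂ h a b x y with h (inj₂ a) (inj₂ b) x y
... | refl = refl

free-path : ∀ m (i : Fin (suc m)) → Free ⟪ pathGraph (suc m) ⟫ i → (toℕ i ≡ 0) ⊎ (toℕ i ≡ m)
free-path m zero    h = inj₁ refl
free-path m (suc i) h with suc (toℕ i) ≟ m
... | yes e = inj₂ e
... | no ¬e = ⊥-elim (n≢2+n (trans (sym (toℕ-fromℕ< p)) (trans (cong toℕ (h (fromℕ< p) (fromℕ< q)
    (path-adj⁺ (suc m) (inj₂ (cong suc (toℕ-fromℕ< p))))
    (path-adj⁺ (suc m) (inj₁ (sym (toℕ-fromℕ< q)))))) (toℕ-fromℕ< q))))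
  where
  p : toℕ i < suc m
  p = m<n⇒m<1+n (toℕ<n i)
  q : suc (suc (toℕ i)) < suc m
  q = s≤s (≤∧≢⇒< (toℕ<n i) ¬e)
  n≢2+n : ∀ {n} → n ≢ suc (suc n)
  n≢2+n ()

¬free-cycle : ∀ m (i : Fin (3 + m)) → ¬ Free ⟪ C (3 + m) ⟫ i
¬free-cycle m zero h with h (suc zero) (fromℕ (2 + m)) (cycle-adj⁺ (suc m) {zero} {suc zero} (inj₁ (inj₁ refl)))
  (cycle-adj⁺ (suc m) {zero} {fromℕ (2 + m)} (inj₂ (inj₂ (cong suc (toℕ-fromℕ (2 + m)) , refl))))
... | ()
¬free-cycle m (suc i) h with suc (toℕ i) ≟ 2 + m
... | yes e = absurd (trans (sym (toℕ-fromℕ< p)) (cong toℕ (h (fromℕ< p) zero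
    (cycle-adj⁺ (suc m) (inj₂ (inj₁ (cong suc (toℕ-fromℕ< p)))))
    (cycle-adj⁺ (suc m) {suc i} {zero} (inj₁ (inj₂ (cong suc e , refl)))))))
  where
  p : toℕ i < 3 + m
  p = m<n⇒m<1+n (toℕ<n i)
  absurd : toℕ i ≡ 0 → ⊥
  absurd e′ with () ← trans (sym e) (cong suc e′)
... | no ¬e = n≢2+n (trans (sym (toℕ-fromℕ< p)) (trans (cong toℕ (h (fromℕ< p) (fromℕ< q)
    (cycle-adj⁺ (suc m) (inj₂ (inj₁ (cong suc (toℕ-fromℕ< p)))))
    (cycle-adj⁺ (suc m) (inj₁ (inj₁ (sym (toℕ-fromℕ< q))))))) (toℕ-fromℕ< q)))
  where
  p : toℕ i < 3 + m
  p = m<n⇒m<1+n (toℕ<n i)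
  q : suc (suc (toℕ i)) < 3 + m
  q = s≤s (≤∧≢⇒< (toℕ<n i) ¬e)
  n≢2+n : ∀ {n} → n ≢ suc (suc n)
  n≢2+n ()

reverse-path : ∀ m → ⟪ pathGraph (suc m) ⟫ ≃ ⟪ pathGraph (suc m) ⟫
reverse-path m = record
  { to = opposite ; from = opposite ; to-from = opposite-involutive ; from-to = opposite-involutive
  ; E-to = λ {i} {j} → go i j
  ; E-from = λ {i} {j} h → subst₂ (Adjacent (pathGraph (suc m))) (opposite-involutive i) (opposite-involutive j) (go (opposite i) (opposite j) h)
  }
  where
  ∸-flip : ∀ i j → suc i ≡ j → j < suc m → suc (m ∸ j) ≡ m ∸ i
  ∸-flip i .(suc i) refl (s≤s h) = sym (+-∸-assoc 1 h)
  flip : ∀ (i j : Fin (suc m)) → suc (toℕ i) ≡ toℕ j → suc (toℕ (opposite j)) ≡ toℕ (opposite i)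
  flip i j e = trans (cong suc (opposite-prop j)) (trans (∸-flip (toℕ i) (toℕ j) e (toℕ<n j)) (sym (opposite-prop i)))
  go : ∀ i j → Adjacent (pathGraph (suc m)) i j → Adjacent (pathGraph (suc m)) (opposite i) (opposite j)
  go i j h with path-adj (suc m) h
  ... | inj₁ e = path-adj⁺ (suc m) (inj₂ (flip i j e))
  ... | inj₂ e = path-adj⁺ (suc m) (inj₁ (flip j i e))

close-path : ∀ m (i j : Fin (3 + m)) → toℕ i ≡ 0 → toℕ j ≡ 2 + m → ⟪ pathGraph (3 + m) ⟫ +[ i , j ] ≃ ⟪ C (3 + m) ⟫
close-path m i j i0 jm = record
  { to = id ; from = id ; to-from = λ _ → refl ; from-to = λ _ → refl
  ; E-to = to′ ; E-from = λ h → from′ (cycle-adj (3 + m) h) }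
  where
  to′ : ∀ {a b} → E (⟪ pathGraph (3 + m) ⟫ +[ i , j ]) a b → Adjacent (C (3 + m)) a b
  to′ {a} {b} (inj₁ h) with path-adj (3 + m) {a} {b} h
  ... | inj₁ e = cycle-adj⁺ (suc m) (inj₁ (inj₁ e))
  ... | inj₂ e = cycle-adj⁺ (suc m) (inj₂ (inj₁ e))
  to′ (inj₂ (inj₁ (refl , refl))) = cycle-adj⁺ (suc m) (inj₂ (inj₂ (cong suc jm , i0)))
  to′ (inj₂ (inj₂ (refl , refl))) = cycle-adj⁺ (suc m) (inj₁ (inj₂ (cong suc jm , i0)))
  from′ : ∀ {a b} → Next (3 + m) (toℕ a) (toℕ b) ⊎ Next (3 + m) (toℕ b) (toℕ a) → E (⟪ pathGraph (3 + m) ⟫ +[ i , j ]) a b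
  from′ (inj₁ (inj₁ e)) = inj₁ (path-adj⁺ (3 + m) (inj₁ e))
  from′ (inj₂ (inj₁ e)) = inj₁ (path-adj⁺ (3 + m) (inj₂ e))
  from′ (inj₁ (inj₂ (e , e′))) = inj₂ (inj₂ (toℕ-injective (trans (suc-injective e) (sym jm)) , toℕ-injective (trans e′ (sym i0))))
  from′ (inj₂ (inj₂ (e , e′))) = inj₂ (inj₁ (toℕ-injective (trans e′ (sym i0)) , toℕ-injective (trans (suc-injective e) (sym jm))))

join-paths : ∀ m n (i : Fin (suc m)) (j : Fin (suc n)) → toℕ i ≡ m → toℕ j ≡ 0 →
  (⟪ pathGraph (suc m) ⟫ ⊎ᴿ ⟪ pathGraph (suc n) ⟫) +[ inj₁ i , inj₂ j ] ≃ ⟪ pathGraph (suc m + suc n) ⟫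
join-paths m n i j im j0 = record
  { to = join (suc m) (suc n) ; from = splitAt (suc m)
  ; to-from = join-splitAt (suc m) (suc n) ; from-to = splitAt-join (suc m) (suc n)
  ; E-to = λ {a} {b} → to′ a b ; E-from = λ {a} {b} h → from′ a b (path-adj (suc m + suc n) h) }
  where
  L : ∀ (a : Fin (suc m)) → toℕ (a ↑ˡ suc n) ≡ toℕ a
  L a = toℕ-↑ˡ a (suc n)
  R : ∀ (b : Fin (suc n)) → toℕ (suc m ↑ʳ b) ≡ suc m + toℕ b
  R b = toℕ-↑ʳ (suc m) b
  shift : ∀ {b b′ : Fin (suc n)} → suc (toℕ b) ≡ toℕ b′ → suc (toℕ (suc m ↑ʳ b)) ≡ toℕ (suc m ↑ʳ b′)
  shift {b} {b′} e = trans (cong suc (R b)) (trans (sym (+-suc (suc m) (toℕ b))) (trans (cong (suc m +_) e) (sym (R b′))))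
  unshift : ∀ {b b′ : Fin (suc n)} → suc (toℕ (suc m ↑ʳ b)) ≡ toℕ (suc m ↑ʳ b′) → suc (toℕ b) ≡ toℕ b′
  unshift {b} {b′} e = +-cancelˡ-≡ (suc m) _ _ (trans (+-suc (suc m) (toℕ b)) (trans (cong suc (sym (R b))) (trans e (R b′))))
  bridge : suc (toℕ (i ↑ˡ suc n)) ≡ toℕ (suc m ↑ʳ j)
  bridge = trans (cong suc (trans (L i) im)) (sym (trans (R j) (trans (cong (suc m +_) j0) (+-identityʳ (suc m)))))
  A : Rel
  A = (⟪ pathGraph (suc m) ⟫ ⊎ᴿ ⟪ pathGraph (suc n) ⟫) +[ inj₁ i , inj₂ j ]
  to′ : ∀ a b → E A a b → Adjacent (pathGraph (suc m + suc n)) (join (suc m) (suc n) a) (join (suc m) (suc n) b)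
  to′ (inj₁ a) (inj₁ b) (inj₁ h) with path-adj (suc m) {a} {b} h
  ... | inj₁ e = path-adj⁺ (suc m + suc n) (inj₁ (trans (cong suc (L a)) (trans e (sym (L b)))))
  ... | inj₂ e = path-adj⁺ (suc m + suc n) (inj₂ (trans (cong suc (L b)) (trans e (sym (L a)))))
  to′ (inj₂ a) (inj₂ b) (inj₁ h) with path-adj (suc n) {a} {b} h
  ... | inj₁ e = path-adj⁺ (suc m + suc n) (inj₁ (shift e))
  ... | inj₂ e = path-adj⁺ (suc m + suc n) (inj₂ (shift e))
  to′ _ _ (inj₂ (inj₁ (refl , refl))) = path-adj⁺ (suc m + suc n) (inj₁ bridge)
  to′ _ _ (inj₂ (inj₂ (refl , refl))) = path-adj⁺ (suc m + suc n) (inj₂ bridge)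
  unbridge : ∀ (a : Fin (suc m)) (b : Fin (suc n)) → suc (toℕ (a ↑ˡ suc n)) ≡ toℕ (suc m ↑ʳ b) → (a ≡ i) × (b ≡ j)
  unbridge a b e = toℕ-injective (trans (trans a≡m+b (trans (cong (m +_) b≡0) (+-identityʳ m))) (sym im)) ,
                   toℕ-injective (trans b≡0 (sym j0))
    where
    a≡m+b : toℕ a ≡ m + toℕ b
    a≡m+b = suc-injective (trans (cong suc (sym (L a))) (trans e (R b)))
    b≡0 : toℕ b ≡ 0
    b≡0 = n≤0⇒n≡0 (+-cancelˡ-≤ m _ _ (≤-trans (≤-reflexive (sym a≡m+b)) (≤-trans (s≤s⁻¹ (toℕ<n a)) (≤-reflexive (sym (+-identityʳ m))))))
  wrong : ∀ (a : Fin (suc m)) (b : Fin (suc n)) → suc (toℕ (suc m ↑ʳ b)) ≢ toℕ (a ↑ˡ suc n)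
  wrong a b e = <⇒≱ (toℕ<n a) (≤-trans (m≤m+n (suc m) (toℕ b)) (≤-trans (n≤1+n _) (≤-reflexive (trans (cong suc (sym (R b))) (trans e (L a))))))
  from′ : ∀ a b → (suc (toℕ (join (suc m) (suc n) a)) ≡ toℕ (join (suc m) (suc n) b)) ⊎ (suc (toℕ (join (suc m) (suc n) b)) ≡ toℕ (join (suc m) (suc n) a)) → E A a b
  from′ (inj₁ a) (inj₁ b) (inj₁ e) = inj₁ (path-adj⁺ (suc m) (inj₁ (trans (cong suc (sym (L a))) (trans e (L b)))))
  from′ (inj₁ a) (inj₁ b) (inj₂ e) = inj₁ (path-adj⁺ (suc m) (inj₂ (trans (cong suc (sym (L b))) (trans e (L a)))))
  from′ (inj₂ a) (inj₂ b) (inj₁ e) = inj₁ (path-adj⁺ (suc n) (inj₁ (unshift e)))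
  from′ (inj₂ a) (inj₂ b) (inj₂ e) = inj₁ (path-adj⁺ (suc n) (inj₂ (unshift e)))
  from′ (inj₁ a) (inj₂ b) (inj₁ e) with unbridge a b e
  ... | refl , refl = inj₂ (inj₁ (refl , refl))
  from′ (inj₂ b) (inj₁ a) (inj₂ e) with unbridge a b e
  ... | refl , refl = inj₂ (inj₂ (refl , refl))
  from′ (inj₁ a) (inj₂ b) (inj₂ e) = ⊥-elim (wrong a b e)
  from′ (inj₂ b) (inj₁ a) (inj₁ e) = ⊥-elim (wrong a b e)

absorb : ∀ {A p q} → E A p q → E A q p → A +[ p , q ] ≃ A
absorb h h′ = record
  { to = id ; from = id ; to-from = λ _ → refl ; from-to = λ _ → refl
  ; E-to = λ { (inj₁ x) → x ; (inj₂ (inj₁ (refl , refl))) → h ; (inj₂ (inj₂ (refl , refl))) → h′ }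
  ; E-from = inj₁ }

toℕ-reverse : ∀ m (i : Fin (suc m)) → toℕ i ≡ 0 → toℕ (opposite i) ≡ m
toℕ-reverse m i e = trans (opposite-prop i) (cong (m ∸_) e)

toℕ-reverse′ : ∀ m (i : Fin (suc m)) → toℕ i ≡ m → toℕ (opposite i) ≡ 0
toℕ-reverse′ m i e = trans (opposite-prop i) (trans (cong (m ∸_) e) (n∸n≡0 m))

Extension : (A : Rel) → V A → V A → Set
Extension A p q = Σ (List Component) λ cs → A +[ p , q ] ≃ ⋃ᴿ cs

via : ∀ {A B p q} (f : A ≃ B) → Extension B (to f p) (to f q) → Extension A p q
via f (cs , g) = cs , ≃-trans (+-cong f _ _) g

-- Cycles have no free vertex, so i and j are ends of one path. They are opposite ends, since they
-- differ, and the path has at least three vertices, since they are not adjacent; the edge closes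
-- it.
extend-same : ∀ c cs i j → i ≢ j → ¬ E ⟪ componentGraph c ⟫ i j → Free ⟪ componentGraph c ⟫ i → Free ⟪ componentGraph c ⟫ j →
  Extension (⋃ᴿ (c ∷ cs)) (inj₁ i) (inj₁ j)
extend-same (cycleᶜ m) cs i j i≢j ¬h fi fj = ⊥-elim (¬free-cycle m i fi)
extend-same (pathᶜ m)  cs i j i≢j ¬h fi fj with free-path m i fi | free-path m j fj
... | inj₁ a | inj₁ b = ⊥-elim (i≢j (toℕ-injective (trans a (sym b))))
... | inj₂ a | inj₂ b = ⊥-elim (i≢j (toℕ-injective (trans a (sym b))))
... | inj₁ a | inj₂ b = close m i j i≢j ¬h a b
  where
  close : ∀ m i j → i ≢ j → ¬ E ⟪ pathGraph (suc m) ⟫ i j → toℕ i ≡ 0 → toℕ j ≡ m → Extension (⋃ᴿ (pathᶜ m ∷ cs)) (inj₁ i) (inj₁ j)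
  close zero          i j i≢j ¬h a b = ⊥-elim (i≢j (toℕ-injective (trans a (sym b))))
  close (suc zero)    i j i≢j ¬h a b = ⊥-elim (¬h (path-adj⁺ 2 (inj₁ (trans (cong suc a) (sym b)))))
  close (suc (suc m)) i j i≢j ¬h a b = cycleᶜ m ∷ cs , ≃-trans (+-⊎ᴿ i j) (⊎ᴿ-cong (close-path m i j a b) ≃-refl)
... | inj₂ a | inj₁ b = close m i j i≢j ¬h a b
  where
  close : ∀ m i j → i ≢ j → ¬ E ⟪ pathGraph (suc m) ⟫ i j → toℕ i ≡ m → toℕ j ≡ 0 → Extension (⋃ᴿ (pathᶜ m ∷ cs)) (inj₁ i) (inj₁ j)
  close zero          i j i≢j ¬h a b = ⊥-elim (i≢j (toℕ-injective (trans a (sym b))))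
  close (suc zero)    i j i≢j ¬h a b = ⊥-elim (¬h (path-adj⁺ 2 (inj₂ (trans (cong suc b) (sym a)))))
  close (suc (suc m)) i j i≢j ¬h a b = cycleᶜ m ∷ cs ,
    ≃-trans (+-comm′ (inj₁ i) (inj₁ j)) (≃-trans (+-⊎ᴿ j i) (⊎ᴿ-cong (close-path m j i b a) ≃-refl))

extend-different : ∀ c c′ cs i j → Free ⟪ componentGraph c ⟫ i → Free ⟪ componentGraph c′ ⟫ j →
  Extension (⋃ᴿ (c ∷ c′ ∷ cs)) (inj₁ i) (inj₂ (inj₁ j))
extend-different (cycleᶜ m) c′         cs i j fi fj = ⊥-elim (¬free-cycle m i fi)
extend-different (pathᶜ m)  (cycleᶜ n) cs i j fi fj = ⊥-elim (¬free-cycle n j fj)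
extend-different (pathᶜ m)  (pathᶜ n)  cs i j fi fj with free-path m i fi | free-path n j fj
... | p | q = orient-i p (orient-j q)
  where
  joined : ∀ i j → toℕ i ≡ m → toℕ j ≡ 0 → Extension (⋃ᴿ (pathᶜ m ∷ pathᶜ n ∷ cs)) (inj₁ i) (inj₂ (inj₁ j))
  joined i j a b = pathᶜ (m + suc n) ∷ cs ,
    ≃-trans (+-cong (≃-sym ⊎ᴿ-assoc) (inj₁ i) (inj₂ (inj₁ j)))
      (≃-trans (+-⊎ᴿ (inj₁ i) (inj₂ j)) (⊎ᴿ-cong (join-paths m n i j a b) ≃-refl))
  orient-j : (toℕ j ≡ 0) ⊎ (toℕ j ≡ n) → ∀ i → toℕ i ≡ m → Extension (⋃ᴿ (pathᶜ m ∷ pathᶜ n ∷ cs)) (inj₁ i) (inj₂ (inj₁ j))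
  orient-j (inj₁ b) i a = joined i j a b
  orient-j (inj₂ b) i a = via (⊎ᴿ-cong ≃-refl (⊎ᴿ-cong (reverse-path n) ≃-refl)) (joined i (opposite j) a (toℕ-reverse′ n j b))
  orient-i : (toℕ i ≡ 0) ⊎ (toℕ i ≡ m) → (∀ i → toℕ i ≡ m → Extension (⋃ᴿ (pathᶜ m ∷ pathᶜ n ∷ cs)) (inj₁ i) (inj₂ (inj₁ j))) →
    Extension (⋃ᴿ (pathᶜ m ∷ pathᶜ n ∷ cs)) (inj₁ i) (inj₂ (inj₁ j))
  orient-i (inj₂ a) k = k i a
  orient-i (inj₁ a) k = via (⊎ᴿ-cong (reverse-path m) ≃-refl) (k (opposite i) (toℕ-reverse m i a))

-- p and q are ends of paths: the new edge closes a path or concatenates two.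
extend : ∀ {A} cs (f : A ≃ ⋃ᴿ cs) p q → p ≢ q → ¬ E A p q → Free A p → Free A q → Extension A p q
extend {A} cs f p q p≢q ¬h fp fq with extract cs (to f p)
... | c , cs′ , g , i , eq = go (to (≃-trans f g) p) (to (≃-trans f g) q) refl refl eq
  where
  F : A ≃ ⋃ᴿ (c ∷ cs′)
  F = ≃-trans f g
  go : ∀ p′ q′ → to F p ≡ p′ → to F q ≡ q′ → p′ ≡ inj₁ i → Extension A p q
  go .(inj₁ i) (inj₁ j) ep eq refl = via F (subst₂ (Extension (⋃ᴿ (c ∷ cs′))) (sym ep) (sym eq)
    (extend-same c cs′ i j
      (λ { refl → p≢q (trans (sym (from-to F p)) (trans (cong (from F) (trans ep (sym eq))) (from-to F q))) })
      (λ h → ¬h (E-from F (subst₂ (E (⋃ᴿ (c ∷ cs′))) (sym ep) (sym eq) h)))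
      (Free-inj₁ (subst (Free (⋃ᴿ (c ∷ cs′))) ep (Free-≃ F fp)))
      (Free-inj₁ (subst (Free (⋃ᴿ (c ∷ cs′))) eq (Free-≃ F fq)))))
  go .(inj₁ i) (inj₂ q′) ep eq refl with extract cs′ q′
  ... | c′ , cs″ , h , j , eq′ = via F (subst₂ (Extension (⋃ᴿ (c ∷ cs′))) (sym ep) (sym eq)
    (via (⊎ᴿ-cong ≃-refl h) (subst (λ z → Extension (⋃ᴿ (c ∷ c′ ∷ cs″)) (inj₁ i) (inj₂ z)) (sym eq′)
      (extend-different c c′ cs″ i j
        (Free-inj₁ (subst (Free (⋃ᴿ (c ∷ cs′))) ep (Free-≃ F fp)))
        (Free-inj₁ (subst (Free (⋃ᴿ (c′ ∷ cs″))) eq′ (Free-≃ h (Free-inj₂ (subst (Free (⋃ᴿ (c ∷ cs′))) eq (Free-≃ F fq))))))))))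

≤2-neighbours : (G : Graph) → Set
≤2-neighbours G = ∀ p a b c → Adjacent G p a → Adjacent G p b → Adjacent G p c → (a ≡ b) ⊎ ((b ≡ c) ⊎ (a ≡ c))

edgeless : ℕ → Rel
edgeless n = record { V = Fin n ; E = λ _ _ → ⊥ }

edgeless-≃ : ∀ n → edgeless n ≃ ⋃ᴿ (replicate n (pathᶜ 0))
edgeless-≃ zero    = record { to = λ () ; from = λ () ; to-from = λ () ; from-to = λ () ; E-to = λ () ; E-from = λ { {()} } }
edgeless-≃ (suc n) = record
  { to      = λ { zero → inj₁ zero ; (suc i) → inj₂ (to f i) }
  ; from    = λ { (inj₁ _) → zero ; (inj₂ v) → suc (from f v) }
  ; to-from = λ { (inj₁ zero) → refl ; (inj₂ v) → cong inj₂ (to-from f v) }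
  ; from-to = λ { zero → refl ; (suc i) → cong suc (from-to f i) }
  ; E-to    = λ ()
  ; E-from  = λ { {zero} {zero} () ; {zero} {suc j} () ; {suc i} {zero} () ; {suc i} {suc j} h → E-from f h }
  }
  where
  f : edgeless n ≃ ⋃ᴿ (replicate n (pathᶜ 0))
  f = edgeless-≃ n

module _ (G : Graph) (bounded : ≤2-neighbours G) where

  private
    Edge : List (Fin (order G) × Fin (order G)) → Fin (order G) → Fin (order G) → Set
    Edge []             u v = ⊥
    Edge ((a , b) ∷ es) u v = Edge es u v ⊎ ((u ≡ a × v ≡ b) ⊎ (u ≡ b × v ≡ a))

    edges : List (Fin (order G) × Fin (order G)) → Rel
    edges es = record { V = Fin (order G) ; E = Edge es }

    Edge-sym : ∀ es {u v} → Edge es u v → Edge es v u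
    Edge-sym (_ ∷ es) (inj₁ h)               = inj₁ (Edge-sym es h)
    Edge-sym (_ ∷ es) (inj₂ (inj₁ (e , e′))) = inj₂ (inj₂ (e′ , e))
    Edge-sym (_ ∷ es) (inj₂ (inj₂ (e , e′))) = inj₂ (inj₁ (e′ , e))

    Edge? : ∀ es u v → Dec (Edge es u v)
    Edge? []             u v = no id
    Edge? ((a , b) ∷ es) u v = Edge? es u v ⊎-dec (((u Fin.≟ a) ×-dec (v Fin.≟ b)) ⊎-dec ((u Fin.≟ b) ×-dec (v Fin.≟ a)))

    IsEdge : Fin (order G) × Fin (order G) → Set
    IsEdge (a , b) = Adjacent G a b

    Adjacent-sym : ∀ {u v} → Adjacent G u v → Adjacent G v u
    Adjacent-sym {u} {v} h = trans (adj-sym G v u) h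

    Edge-sound : ∀ es → All IsEdge es → ∀ {u v} → Edge es u v → Adjacent G u v
    Edge-sound (_ ∷ es) (h ∷ hs) (inj₁ x)                    = Edge-sound es hs x
    Edge-sound (_ ∷ es) (h ∷ hs) (inj₂ (inj₁ (refl , refl))) = h
    Edge-sound (_ ∷ es) (h ∷ hs) (inj₂ (inj₂ (refl , refl))) = Adjacent-sym h

    Edge-complete : ∀ es {u v} → (u , v) ∈ es → Edge es u v
    Edge-complete ((a , b) ∷ es) (here refl) = inj₂ (inj₁ (refl , refl))
    Edge-complete ((a , b) ∷ es) (there h)   = inj₁ (Edge-complete es h)

    irreflexive : ∀ {u v} → Adjacent G u v → u ≢ v
    irreflexive {u} h refl with () ← trans (sym h) (adj-irrefl G u)

    -- In G the vertex a has at most two neighbours, and one of them, b, is not yet joined to it; at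
    -- most one neighbour is left among the edges inserted so far.
    free : ∀ es → All IsEdge es → ∀ a b → Adjacent G a b → ¬ Edge es a b → Free (edges es) a
    free es hs a b h ¬e u v x y with bounded a b u v h (Edge-sound es hs x) (Edge-sound es hs y)
    ... | inj₁ refl        = ⊥-elim (¬e x)
    ... | inj₂ (inj₁ u≡v)  = u≡v
    ... | inj₂ (inj₂ refl) = ⊥-elim (¬e y)

    -- Edges are inserted one at a time into the graph without edges, and every stage is a union of
    -- paths and cycles.
    components : ∀ es → All IsEdge es → Σ (List Component) λ cs → edges es ≃ ⋃ᴿ cs
    components []             []       = replicate (order G) (pathᶜ 0) , edgeless-≃ (order G)
    components ((a , b) ∷ es) (h ∷ hs) with components es hs | Edge? es a b
    -- The list of edges contains both orientations; whichever comes second changes nothing.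
    ... | cs , f | yes e = cs , ≃-trans (absorb e (Edge-sym es e)) f
    ... | cs , f | no ¬e = extend cs f a b (irreflexive h) ¬e (free es hs a b h ¬e)
      (free es hs b a (Adjacent-sym h) (λ e → ¬e (Edge-sym es e)))

    isEdge? : ∀ e → Dec (IsEdge e)
    isEdge? (a , b) = adj G a b ≟ᵇ true

    allEdges : List (Fin (order G) × Fin (order G))
    allEdges = filter isEdge? (cartesianProduct (allFin (order G)) (allFin (order G)))

    sound : All IsEdge allEdges
    sound = All.all-filter isEdge? (cartesianProduct (allFin (order G)) (allFin (order G)))

  decompose : Σ (List Component) λ cs → G ≅ ⋃ cs
  decompose with components allEdges sound
  ... | cs , f = cs , ≃⇒≅ {G} {⋃ cs} (≃-trans G≃edges (≃-trans f (≃-sym (⟪⋃⟫ cs))))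
    where
    G≃edges : ⟪ G ⟫ ≃ edges allEdges
    G≃edges = record
      { to = id ; from = id ; to-from = λ _ → refl ; from-to = λ _ → refl
      ; E-to = λ {u} {v} h → Edge-complete allEdges (∈-filter⁺ isEdge? (∈-cartesianProduct⁺ (∈-allFin u) (∈-allFin v)) h)
      ; E-from = Edge-sound allEdges sound }

three-distinct : ∀ {n} (i j k : Fin n) → i ≢ j → j ≢ k → i ≢ k → 3 ≤ n
three-distinct {suc zero}          zero       zero       k          p q r = ⊥-elim (p refl)
three-distinct {suc (suc zero)}    zero       zero       k          p q r = ⊥-elim (p refl)
three-distinct {suc (suc zero)}    zero       (suc zero) zero       p q r = ⊥-elim (r refl)
three-distinct {suc (suc zero)}    zero       (suc zero) (suc zero) p q r = ⊥-elim (q refl)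
three-distinct {suc (suc zero)}    (suc zero) zero       zero       p q r = ⊥-elim (q refl)
three-distinct {suc (suc zero)}    (suc zero) zero       (suc zero) p q r = ⊥-elim (r refl)
three-distinct {suc (suc zero)}    (suc zero) (suc zero) k          p q r = ⊥-elim (p refl)
three-distinct {suc (suc (suc n))} _          _          _          p q r = s≤s (s≤s (s≤s z≤n))

three-members : ∀ {A : Set} {xs : List A} {a b c} → a ∈ xs → b ∈ xs → c ∈ xs → a ≢ b → b ≢ c → a ≢ c → 3 ≤ length xs
three-members {xs = xs} a∈ b∈ c∈ p q r = three-distinct (index a∈) (index b∈) (index c∈)
  (λ e → p (same a∈ b∈ e)) (λ e → q (same b∈ c∈ e)) (λ e → r (same a∈ c∈ e))
  where
  same : ∀ {a b} (a∈ : a ∈ xs) (b∈ : b ∈ xs) → index a∈ ≡ index b∈ → a ≡ b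
  same a∈ b∈ e = trans (lookup-index a∈) (trans (cong (List.lookup xs) e) (sym (lookup-index b∈)))

∈⇒≤max : ∀ {x} xs → x ∈ xs → x ≤ foldr _⊔_ 0 xs
∈⇒≤max (x ∷ xs) (here refl) = m≤m⊔n x _
∈⇒≤max (y ∷ xs) (there h)   = ≤-trans (∈⇒≤max xs h) (m≤n⊔m y _)

maxDegree≤2⇒≤2-neighbours : ∀ G → maxDegree G ≤ 2 → ≤2-neighbours G
maxDegree≤2⇒≤2-neighbours G Δ≤2 p a b c ha hb hc with a Fin.≟ b | b Fin.≟ c | a Fin.≟ c
... | yes e | _     | _     = inj₁ e
... | no _  | yes e | _     = inj₂ (inj₁ e)
... | no _  | no _  | yes e = inj₂ (inj₂ e)
... | no ab | no bc | no ac = ⊥-elim (<⇒≱ (≤-trans (three-members (∈-filter⁺ _ (∈-allFin a) ha) (∈-filter⁺ _ (∈-allFin b) hb) (∈-filter⁺ _ (∈-allFin c) hc) ab bc ac)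
  (∈⇒≤max (map (deg G) (allFin (order G))) (∈-map⁺ (deg G) (∈-allFin p)))) Δ≤2)

-- Reduction to triangles

≅-refl : ∀ G → G ≅ G
≅-refl G = ≃⇒≅ {G} {G} ≃-refl

≅-trans : ∀ G H J → G ≅ H → H ≅ J → G ≅ J
≅-trans G H J f g = ≃⇒≅ {G} {J} (≃-trans (≅⇒≃ {G} {H} f) (≅⇒≃ {H} {J} g))

∪-cong : ∀ G G′ H H′ → G ≅ G′ → H ≅ H′ → (G ∪ᴳ H) ≅ (G′ ∪ᴳ H′)
∪-cong G G′ H H′ f g = ≃⇒≅ {G ∪ᴳ H} {G′ ∪ᴳ H′}
  (≃-trans (⟪∪⟫ G H) (≃-trans (⊎ᴿ-cong (≅⇒≃ {G} {G′} f) (≅⇒≃ {H} {H′} g)) (≃-sym (⟪∪⟫ G′ H′))))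

∪-comm : ∀ G H → (G ∪ᴳ H) ≅ (H ∪ᴳ G)
∪-comm G H = ≃⇒≅ {G ∪ᴳ H} {H ∪ᴳ G} (≃-trans (⟪∪⟫ G H) (≃-trans ⊎ᴿ-comm (≃-sym (⟪∪⟫ H G))))

∪-assoc : ∀ G H J → ((G ∪ᴳ H) ∪ᴳ J) ≅ (G ∪ᴳ (H ∪ᴳ J))
∪-assoc G H J = ≃⇒≅ {(G ∪ᴳ H) ∪ᴳ J} {G ∪ᴳ (H ∪ᴳ J)}
  (≃-trans (⟪∪⟫ (G ∪ᴳ H) J) (≃-trans (⊎ᴿ-cong (⟪∪⟫ G H) ≃-refl) (≃-trans ⊎ᴿ-assoc
    (≃-trans (⊎ᴿ-cong ≃-refl (≃-sym (⟪∪⟫ H J))) (≃-sym (⟪∪⟫ G (H ∪ᴳ J)))))))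

∪-assoc⁻¹ : ∀ G H J → (G ∪ᴳ (H ∪ᴳ J)) ≅ ((G ∪ᴳ H) ∪ᴳ J)
∪-assoc⁻¹ G H J = ≃⇒≅ {G ∪ᴳ (H ∪ᴳ J)} {(G ∪ᴳ H) ∪ᴳ J}
  (≃-sym (≅⇒≃ {(G ∪ᴳ H) ∪ᴳ J} {G ∪ᴳ (H ∪ᴳ J)} (∪-assoc G H J)))

∪-∅ : ∀ G → (G ∪ᴳ emptyGraph) ≅ G
∪-∅ G = ≃⇒≅ {G ∪ᴳ emptyGraph} {G} (≃-trans (⟪∪⟫ G emptyGraph) (≃-trans (⊎ᴿ-cong ≃-refl ⟪∅⟫) ⊎ᴿ-∅))

∅-∪ : ∀ G → (emptyGraph ∪ᴳ G) ≅ G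
∅-∪ G = ≅-trans (emptyGraph ∪ᴳ G) (G ∪ᴳ emptyGraph) G (∪-comm emptyGraph G) (∪-∅ G)

copies-+ : ∀ p q H → (copies p H ∪ᴳ copies q H) ≅ copies (p + q) H
copies-+ zero    q H = ∅-∪ (copies q H)
copies-+ (suc p) q H = ≅-trans ((H ∪ᴳ copies p H) ∪ᴳ copies q H) (H ∪ᴳ (copies p H ∪ᴳ copies q H)) (H ∪ᴳ copies (p + q) H)
  (∪-assoc H (copies p H) (copies q H))
  (∪-cong H H (copies p H ∪ᴳ copies q H) (copies (p + q) H) (≅-refl H) (copies-+ p q H))

infix 4 _≼_
-- The alternative "isomorphic" is carried through the whole chain; at its end it yields the case of
-- equality.
record _≼_ (G H : Graph) : Set where
  constructor _,ᵒ_
  field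
    same-order : order G ≡ order H
    iso⊎below  : (G ≅ H) ⊎ (σ G ≺ σ H)

≅⇒≼ : ∀ G H → G ≅ H → G ≼ H
≅⇒≼ G H f = order-≅ {G} {H} f ,ᵒ inj₁ f

≼-trans : ∀ {G H J} → G ≼ H → H ≼ J → G ≼ J
≼-trans {G} {H} {J} (e ,ᵒ p) (e′ ,ᵒ q) = trans e e′ ,ᵒ go p q
  where
  go : (G ≅ H) ⊎ (σ G ≺ σ H) → (H ≅ J) ⊎ (σ H ≺ σ J) → (G ≅ J) ⊎ (σ G ≺ σ J)
  go (inj₁ f) (inj₁ g) = inj₁ (≅-trans G H J f g)
  go (inj₁ f) (inj₂ g) = inj₂ (≺-resp-≈ (λ x → sym (σ-≅ G H f x)) (λ _ → refl) g)
  go (inj₂ f) (inj₁ g) = inj₂ (≺-resp-≈ (λ _ → refl) (σ-≅ H J g) f)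
  go (inj₂ f) (inj₂ g) = inj₂ (≺-trans f g)

Positive : Graph → Set
Positive G = 0 < sum (σ G)

positive-≈ : ∀ G f → σ G ≈ f → 0 < sum f → Positive G
positive-≈ G f e h = subst (0 <_) (sym (sum-≈ (σ G) f e)) h

positive-∪ : ∀ G H → Positive G → Positive H → Positive (G ∪ᴳ H)
positive-∪ G H p q = positive-≈ (G ∪ᴳ H) (σ G ⊛ σ H) (σ-∪ G H) (sum-conv>0 (σ G) 0 (σ H) tt p q)

≼-∪ʳ : ∀ W {G H} → Positive W → G ≼ H → W ∪ᴳ G ≼ W ∪ᴳ H
≼-∪ʳ W {G} {H} p (e ,ᵒ inj₁ f) = ≅⇒≼ (W ∪ᴳ G) (W ∪ᴳ H) (∪-cong W W G H (≅-refl W) f)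
≼-∪ʳ W {G} {H} p (e ,ᵒ inj₂ f) = cong (order W +_) e ,ᵒ
  inj₂ (≺-resp-≈ (λ x → sym (σ-∪ W G x)) (λ x → sym (σ-∪ W H x)) (≺-⊛ (σ W) p f))

≼-∪ˡ : ∀ W {G H} → Positive W → G ≼ H → G ∪ᴳ W ≼ H ∪ᴳ W
≼-∪ˡ W {G} {H} p h = ≼-trans (≅⇒≼ (G ∪ᴳ W) (W ∪ᴳ G) (∪-comm G W)) (≼-trans (≼-∪ʳ W p h) (≅⇒≼ (W ∪ᴳ H) (H ∪ᴳ W) (∪-comm W H)))

same-adj : ∀ {n} a s i b s′ i′ → (∀ u v → a u v ≡ b u v) →
  record { order = n ; adj = a ; adj-sym = s ; adj-irrefl = i } ≅ record { order = n ; adj = b ; adj-sym = s′ ; adj-irrefl = i′ }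
same-adj {n} a s i b s′ i′ h =
  ≃⇒≅ {record { order = n ; adj = a ; adj-sym = s ; adj-irrefl = i }} {record { order = n ; adj = b ; adj-sym = s′ ; adj-irrefl = i′ }} record
  { to = id ; from = id ; to-from = λ _ → refl ; from-to = λ _ → refl
  ; E-to = λ {u} {v} e → trans (sym (h u v)) e ; E-from = λ {u} {v} e → trans (h u v) e }

path₁≅K₁ : pathGraph 1 ≅ K 1
path₁≅K₁ = same-adj (adj (pathGraph 1)) (adj-sym (pathGraph 1)) (adj-irrefl (pathGraph 1)) (adj (K 1)) (adj-sym (K 1)) (adj-irrefl (K 1))
  λ { zero zero → refl }

path₂≅K₂ : pathGraph 2 ≅ K 2
path₂≅K₂ = same-adj (adj (pathGraph 2)) (adj-sym (pathGraph 2)) (adj-irrefl (pathGraph 2)) (adj (K 2)) (adj-sym (K 2)) (adj-irrefl (K 2))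
  λ { zero zero → refl ; zero (suc zero) → refl ; (suc zero) zero → refl ; (suc zero) (suc zero) → refl }

C₃≅K₃ : C 3 ≅ K₃
C₃≅K₃ = same-adj (adj (C 3)) (adj-sym (C 3)) (adj-irrefl (C 3)) (adj K₃) (adj-sym K₃) (adj-irrefl K₃) λ
  { zero zero → refl ; zero (suc zero) → refl ; zero (suc (suc zero)) → refl
  ; (suc zero) zero → refl ; (suc zero) (suc zero) → refl ; (suc zero) (suc (suc zero)) → refl
  ; (suc (suc zero)) zero → refl ; (suc (suc zero)) (suc zero) → refl ; (suc (suc zero)) (suc (suc zero)) → refl }

-- What may remain beside the triangles. The orders 0, 1, 2, 4, 5 cover each residue modulo 3.
data Rest : Set where
  none one two four five : Rest

restGraph : Rest → Graph
restGraph none = emptyGraph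
restGraph one  = K 1
restGraph two  = K 2
restGraph four = C 4
restGraph five = C 5

restSeq : Rest → Seq
restSeq none = 1 ∷ []
restSeq one  = k₁
restSeq two  = k₂
restSeq four = cycle 3
restSeq five = cycle 4

σ-∅ : σ emptyGraph ≈ 1 ∷ []
σ-∅ x = trans (eval-σ emptyGraph x) (sym (eval-[-] 1 x))

σ-rest : ∀ r → σ (restGraph r) ≈ restSeq r
σ-rest none = σ-∅
σ-rest one  x = trans (sym (σ-≅ (pathGraph 1) (K 1) path₁≅K₁ x)) (σ-path 0 x)
σ-rest two  x = trans (sym (σ-≅ (pathGraph 2) (K 2) path₂≅K₂ x)) (σ-path 1 x)
σ-rest four = σ-cycle 1
σ-rest five = σ-cycle 2

σ-K₃ : σ K₃ ≈ k₃
σ-K₃ x = trans (sym (σ-≅ (C 3) K₃ C₃≅K₃ x)) (σ-cycle 0 x)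

σ-copies : ∀ q → σ (copies q K₃) ≈ k₃^ q
σ-copies zero    = σ-∅
σ-copies (suc q) x = trans (σ-∪ K₃ (copies q K₃) x) (⊛-cong {σ K₃} {k₃} {σ (copies q K₃)} {k₃^ q} σ-K₃ (σ-copies q) x)

positive-K₃ : Positive K₃
positive-K₃ = positive-≈ K₃ k₃ σ-K₃ (s≤s z≤n)

positive-copies : ∀ q → Positive (copies q K₃)
positive-copies zero    = positive-≈ emptyGraph (1 ∷ []) σ-∅ (s≤s z≤n)
positive-copies (suc q) = positive-∪ K₃ (copies q K₃) positive-K₃ (positive-copies q)

positive-rest : ∀ r → Positive (restGraph r)
positive-rest r = positive-≈ (restGraph r) (restSeq r) (σ-rest r) (restSeq>0 r)
  where
  restSeq>0 : ∀ r → 0 < sum (restSeq r)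
  restSeq>0 none = s≤s z≤n
  restSeq>0 one  = s≤s z≤n
  restSeq>0 two  = s≤s z≤n
  restSeq>0 four = s≤s z≤n
  restSeq>0 five = s≤s z≤n

infix 8 _K₃∪_
_K₃∪_ : ℕ → Rest → Graph
q K₃∪ r = copies q K₃ ∪ᴳ restGraph r

nSeq : ℕ → Rest → Seq
nSeq q r = k₃^ q ⊛ restSeq r

σ-K₃∪ : ∀ q r → σ (q K₃∪ r) ≈ nSeq q r
σ-K₃∪ q r x = trans (σ-∪ (copies q K₃) (restGraph r) x)
  (⊛-cong {σ (copies q K₃)} {k₃^ q} {σ (restGraph r)} {restSeq r} (σ-copies q) (σ-rest r) x)

positive-K₃∪ : ∀ q r → Positive (q K₃∪ r)
positive-K₃∪ q r = positive-∪ (copies q K₃) (restGraph r) (positive-copies q) (positive-rest r)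

Reduces : Graph → Set
Reduces G = Σ ℕ λ q → Σ Rest λ r → G ≼ q K₃∪ r

reduces : ∀ z r q r′ → order (restGraph z ∪ᴳ restGraph r) ≡ order (q K₃∪ r′) →
  dominated (restSeq z ⊛ restSeq r) (nSeq q r′) ≡ true → strictly (restSeq z ⊛ restSeq r) (nSeq q r′) ≡ true →
  Reduces (restGraph z ∪ᴳ restGraph r)
reduces z r q r′ e d s = q , r′ , e ,ᵒ inj₂ (≺-resp-≈
  (λ x → sym (trans (σ-∪ (restGraph z) (restGraph r) x)
    (⊛-cong {σ (restGraph z)} {restSeq z} {σ (restGraph r)} {restSeq r} (σ-rest z) (σ-rest r) x)))
  (λ x → sym (σ-K₃∪ q r′ x)) (dominated⇒≺ (restSeq z ⊛ restSeq r) (nSeq q r′) d s))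

≼-reduces : ∀ {G H} → G ≼ H → Reduces H → Reduces G
≼-reduces h (q , r , h′) = q , r , ≼-trans h h′

-- Every union of two such remainders is brought back to triangles and at most one remainder. In the
-- cases without `none` the order and the dominance are checked by evaluation.
rest-∪-rest : ∀ z r → Reduces (restGraph z ∪ᴳ restGraph r)
rest-∪-rest none r    = 0 , r , ≅⇒≼ (restGraph none ∪ᴳ restGraph r) (0 K₃∪ r) (≅-refl (0 K₃∪ r))
rest-∪-rest one  none = 0 , one , ≅⇒≼ (K 1 ∪ᴳ emptyGraph) (0 K₃∪ one) (∪-comm (K 1) emptyGraph)
rest-∪-rest two  none = 0 , two , ≅⇒≼ (K 2 ∪ᴳ emptyGraph) (0 K₃∪ two) (∪-comm (K 2) emptyGraph)
rest-∪-rest four none = 0 , four , ≅⇒≼ (C 4 ∪ᴳ emptyGraph) (0 K₃∪ four) (∪-comm (C 4) emptyGraph)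
rest-∪-rest five none = 0 , five , ≅⇒≼ (C 5 ∪ᴳ emptyGraph) (0 K₃∪ five) (∪-comm (C 5) emptyGraph)
rest-∪-rest one  one  = reduces one one 0 two refl refl refl
rest-∪-rest one  two  = reduces one two 1 none refl refl refl
rest-∪-rest one  four = reduces one four 0 five refl refl refl
rest-∪-rest one  five = reduces one five 2 none refl refl refl
rest-∪-rest two  one  = reduces two one 1 none refl refl refl
rest-∪-rest two  two  = reduces two two 1 one refl refl refl
rest-∪-rest two  four = reduces two four 2 none refl refl refl
rest-∪-rest two  five = reduces two five 1 four refl refl refl
rest-∪-rest four one  = reduces four one 0 five refl refl refl
rest-∪-rest four two  = reduces four two 2 none refl refl refl
rest-∪-rest four four = reduces four four 1 five refl refl refl
rest-∪-rest four five = reduces four five 3 none refl refl refl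
rest-∪-rest five one  = reduces five one 2 none refl refl refl
rest-∪-rest five two  = reduces five two 1 four refl refl refl
rest-∪-rest five four = reduces five four 3 none refl refl refl
rest-∪-rest five five = reduces five five 2 four refl refl refl

rest-∪ : ∀ z q r → Reduces (restGraph z ∪ᴳ q K₃∪ r)
rest-∪ z q r with rest-∪-rest z r
... | n , r′ , h = q + n , r′ , ≼-trans
  (≅⇒≼ (Z ∪ᴳ (Cq ∪ᴳ R)) (Cq ∪ᴳ (Z ∪ᴳ R)) (≅-trans (Z ∪ᴳ (Cq ∪ᴳ R)) ((Z ∪ᴳ Cq) ∪ᴳ R) (Cq ∪ᴳ (Z ∪ᴳ R)) (∪-assoc⁻¹ Z Cq R)
    (≅-trans ((Z ∪ᴳ Cq) ∪ᴳ R) ((Cq ∪ᴳ Z) ∪ᴳ R) (Cq ∪ᴳ (Z ∪ᴳ R)) (∪-cong (Z ∪ᴳ Cq) (Cq ∪ᴳ Z) R R (∪-comm Z Cq) (≅-refl R)) (∪-assoc Cq Z R))))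
  (≼-trans (≼-∪ʳ Cq (positive-copies q) h)
    (≅⇒≼ (Cq ∪ᴳ (copies n K₃ ∪ᴳ restGraph r′)) ((q + n) K₃∪ r′) (≅-trans (Cq ∪ᴳ (copies n K₃ ∪ᴳ restGraph r′)) ((Cq ∪ᴳ copies n K₃) ∪ᴳ restGraph r′) ((q + n) K₃∪ r′)
      (∪-assoc⁻¹ Cq (copies n K₃) (restGraph r′))
      (∪-cong (Cq ∪ᴳ copies n K₃) (copies (q + n) K₃) (restGraph r′) (restGraph r′) (copies-+ q n K₃) (≅-refl (restGraph r′))))))
  where
  Z = restGraph z
  Cq = copies q K₃
  R = restGraph r

K₃-∪ : ∀ {G} → Reduces G → Reduces (K₃ ∪ᴳ G)
K₃-∪ (q , r , h) = suc q , r , ≼-trans (≼-∪ʳ K₃ positive-K₃ h) (≅⇒≼ (K₃ ∪ᴳ q K₃∪ r) (suc q K₃∪ r) (∪-assoc⁻¹ K₃ (copies q K₃) (restGraph r)))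

-- Long paths and cycles lose three vertices to a triangle at each step of `go`; the short ones are
-- triangles, become triangles, or are remainders to be merged with r.
component-∪ : ∀ c q r → Reduces (componentGraph c ∪ᴳ q K₃∪ r)
component-∪ c q r = go c
  where
  N = q K₃∪ r
  N≼ : ∀ {G H} → G ≼ H → G ∪ᴳ N ≼ H ∪ᴳ N
  N≼ = ≼-∪ˡ N (positive-K₃∪ q r)
  N-reduces : Reduces (K₃ ∪ᴳ N)
  N-reduces = K₃-∪ (q , r , ≅⇒≼ N N (≅-refl N))
  go : ∀ c → Reduces (componentGraph c ∪ᴳ N)
  go (pathᶜ 0) = ≼-reduces (N≼ (≅⇒≼ (pathGraph 1) (K 1) path₁≅K₁)) (rest-∪ one q r)
  go (pathᶜ 1) = ≼-reduces (N≼ (≅⇒≼ (pathGraph 2) (K 2) path₂≅K₂)) (rest-∪ two q r)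
  go (pathᶜ 2) = ≼-reduces (N≼ (refl ,ᵒ inj₂ (≺-resp-≈ (λ x → sym (σ-path 2 x)) (λ x → sym (σ-K₃ x))
    (dominated⇒≺ (path 2) k₃ refl refl)))) N-reduces
  go (pathᶜ (suc (suc (suc m)))) = ≼-reduces (≼-trans
    (N≼ (refl ,ᵒ inj₂ (≺-resp-≈ (λ x → sym (σ-path (3 + m) x)) (λ x → sym (trans (σ-∪ K₃ (pathGraph (suc m)) x)
      (⊛-cong {σ K₃} {k₃} {σ (pathGraph (suc m))} {path m} σ-K₃ (σ-path m) x))) (path-≺ m))))
    (≅⇒≼ ((K₃ ∪ᴳ pathGraph (suc m)) ∪ᴳ N) (K₃ ∪ᴳ (pathGraph (suc m) ∪ᴳ N)) (∪-assoc K₃ (pathGraph (suc m)) N))) (K₃-∪ (go (pathᶜ m)))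
  go (cycleᶜ 0) = ≼-reduces (N≼ (≅⇒≼ (C 3) K₃ C₃≅K₃)) N-reduces
  go (cycleᶜ 1) = rest-∪ four q r
  go (cycleᶜ 2) = rest-∪ five q r
  go (cycleᶜ (suc (suc (suc m)))) = ≼-reduces (≼-trans
    (N≼ (refl ,ᵒ inj₂ (≺-resp-≈ (λ x → sym (σ-cycle (3 + m) x)) (λ x → sym (trans (σ-∪ K₃ (C (3 + m)) x)
      (⊛-cong {σ K₃} {k₃} {σ (C (3 + m))} {cycle (2 + m)} σ-K₃ (σ-cycle m) x))) (cycle-≺ m))))
    (≅⇒≼ ((K₃ ∪ᴳ C (3 + m)) ∪ᴳ N) (K₃ ∪ᴳ (C (3 + m) ∪ᴳ N)) (∪-assoc K₃ (C (3 + m)) N))) (K₃-∪ (go (cycleᶜ m)))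

⋃-reduces : ∀ cs → Reduces (⋃ cs)
⋃-reduces []       = 0 , none , ≅⇒≼ emptyGraph (0 K₃∪ none) (≃⇒≅ {emptyGraph} {0 K₃∪ none}
  (≃-sym (≅⇒≃ {0 K₃∪ none} {emptyGraph} (∪-∅ emptyGraph))))
⋃-reduces (c ∷ cs) with ⋃-reduces cs
... | q , r , h with component-∪ c q r
...   | q′ , r′ , h′ = q′ , r′ , ≼-trans (≼-∪ʳ (componentGraph c) (positive-component c) h) h′
  where
  positive-component : ∀ c → Positive (componentGraph c)
  positive-component (pathᶜ m)  = positive-≈ (pathGraph (suc m)) (path m) (σ-path m)
    (Moments.M-pos k₁ (refl , tt) (s≤s z≤n) m)
  positive-component (cycleᶜ m) = positive-≈ (C (3 + m)) (cycle (2 + m)) (σ-cycle m)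
    (subst (0 <_) (sym (sum-⊕ (cycle m) (mul-x-1 m k₃))) (≤-trans (Moments.M-pos k₃ (refl , tt) (s≤s z≤n) m) (m≤n+m _ _)))

-- The comparison in the empty context only.
infix 4 _⊴_
record _⊴_ (G H : Graph) : Set where
  constructor _,ᵗ_
  field
    same-order : order G ≡ order H
    iso⊎below  : (G ≅ H) ⊎ (pr (σ G) ⊏ pr (σ H))

≺⇒⊏ : ∀ {f g} → f ≺ g → pr f ⊏ pr g
≺⇒⊏ {f} {g} h = subst₂ _⊏_ (unit-context f) (unit-context g) (_≺_.⊏-in h (1 ∷ []) (s≤s z≤n))
  where
  unit-context : ∀ f → pr (f ⊛ (1 ∷ [])) ≡ pr f
  unit-context f = pr-≈ (f ⊛ (1 ∷ [])) f λ x →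
    trans (eval-⊛ f (1 ∷ []) x) (trans (cong (eval f x *_) (eval-[-] 1 x)) (*-identityʳ (eval f x)))

≼⇒⊴ : ∀ {G H} → G ≼ H → G ⊴ H
≼⇒⊴ (e ,ᵒ inj₁ f) = e ,ᵗ inj₁ f
≼⇒⊴ (e ,ᵒ inj₂ h) = e ,ᵗ inj₂ (≺⇒⊏ h)

≼-⊴-trans : ∀ {G H J} → G ≼ H → H ⊴ J → G ⊴ J
≼-⊴-trans {G} {H} {J} (e ,ᵒ p) (e′ ,ᵗ q) = trans e e′ ,ᵗ go p q
  where
  go : (G ≅ H) ⊎ (σ G ≺ σ H) → (H ≅ J) ⊎ (pr (σ H) ⊏ pr (σ J)) → (G ≅ J) ⊎ (pr (σ G) ⊏ pr (σ J))
  go (inj₁ f) (inj₁ g) = inj₁ (≅-trans G H J f g)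
  go (inj₁ f) (inj₂ g) = inj₂ (subst (_⊏ pr (σ J)) (pr-≈ (σ H) (σ G) (λ x → sym (σ-≅ G H f x))) g)
  go (inj₂ f) (inj₁ g) = inj₂ (subst (pr (σ G) ⊏_) (pr-≈ (σ H) (σ J) (σ-≅ H J g)) (≺⇒⊏ f))
  go (inj₂ f) (inj₂ g) = inj₂ (⊏-trans (pr (σ G)) (pr (σ H)) (pr (σ J)) (≺⇒⊏ f) g)

⊏⇒⊴ : ∀ q r q′ r′ → order (q K₃∪ r) ≡ order (q′ K₃∪ r′) → pr (nSeq q r) ⊏ pr (nSeq q′ r′) → q K₃∪ r ⊴ q′ K₃∪ r′
⊏⇒⊴ q r q′ r′ e h = e ,ᵗ inj₂ (subst₂ _⊏_
  (pr-≈ (nSeq q r) (σ (q K₃∪ r)) (λ x → sym (σ-K₃∪ q r x))) (pr-≈ (nSeq q′ r′) (σ (q′ K₃∪ r′)) (λ x → sym (σ-K₃∪ q′ r′ x))) h)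

⊴-refl : ∀ G → G ⊴ G
⊴-refl G = refl ,ᵗ inj₁ (≅-refl G)

order-copies : ∀ q → order (copies q K₃) ≡ q * 3
order-copies zero    = refl
order-copies (suc q) = cong (3 +_) (order-copies q)

order-K₃∪ : ∀ q r → order (q K₃∪ r) ≡ order (restGraph r) + q * 3
order-K₃∪ q r = trans (cong (_+ order (restGraph r)) (order-copies q)) (+-comm (q * 3) (order (restGraph r)))

-- Comparison of the normal forms with `U`

U-0 : ∀ n → n % 3 ≡ 0 → U n ≡ copies (n / 3) K₃
U-0 n h rewrite h = refl

U-1 : ∀ n → n % 3 ≡ 1 → U n ≡ (if (n ≡ᵇ 4) ∨ (n ≡ᵇ 7) then copies ((n ∸ 1) / 3) K₃ ∪ᴳ K 1 else copies ((n ∸ 4) / 3) K₃ ∪ᴳ C 4)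
U-1 n h rewrite h = refl

U-2 : ∀ n → n % 3 ≡ 2 → U n ≡ copies ((n ∸ 5) / 3) K₃ ∪ᴳ C 5
U-2 n h rewrite h = refl

U-none : ∀ q → U (q * 3) ≡ copies q K₃
U-none q = trans (U-0 (q * 3) ([m+kn]%n≡m%n 0 q 3)) (cong (λ k → copies k K₃) (m*n/n≡m q 3))

U-four : ∀ q → U (4 + (2 + q) * 3) ≡ (2 + q) K₃∪ four
U-four q = trans (U-1 (4 + (2 + q) * 3) ([m+kn]%n≡m%n 4 (2 + q) 3)) (cong (_K₃∪ four) (m*n/n≡m (2 + q) 3))

U-five : ∀ q → U (5 + q * 3) ≡ q K₃∪ five
U-five q = trans (U-2 (5 + q * 3) ([m+kn]%n≡m%n 5 q 3)) (cong (_K₃∪ five) (m*n/n≡m q 3))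

-- In residue 1 the forms with K₁ and with C₄ compete, and the winner changes at order 10; in
-- residue 2 the form with K₂ loses to C₅ in every context. Order at least 3 excludes K₁ and K₂
-- alone.
to-U : ∀ q r → 3 ≤ order (restGraph r) + q * 3 → q K₃∪ r ⊴ U (order (restGraph r) + q * 3)
to-U q none h = subst (q K₃∪ none ⊴_) (sym (U-none q)) (≼⇒⊴ (≅⇒≼ (q K₃∪ none) (copies q K₃) (∪-∅ (copies q K₃))))
to-U zero    one (s≤s ())
to-U (suc zero)          one h = ⊴-refl (1 K₃∪ one)
to-U (suc (suc zero))    one h = ⊴-refl (2 K₃∪ one)
to-U (suc (suc (suc q))) one h = subst ((3 + q) K₃∪ one ⊴_) (sym (U-four q)) (⊏⇒⊴ (3 + q) one (2 + q) four
  (trans (order-K₃∪ (3 + q) one) (sym (order-K₃∪ (2 + q) four))) (k₃^-k₁-⊏ q))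
to-U zero    two (s≤s (s≤s ()))
to-U (suc q) two h = subst (suc q K₃∪ two ⊴_) (sym (U-five q))
  (trans (order-K₃∪ (suc q) two) (sym (order-K₃∪ q five)) ,ᵗ inj₂ (≺⇒⊏ {σ (suc q K₃∪ two)} {σ (q K₃∪ five)} (≺-resp-≈ (λ x → sym (left x)) (λ x → sym (right x))
    -- One triangle is joined with K₂ and compared with C₅ by dominance; the other q triangles are
    -- context.
    (≺-⊛ (σ (copies q K₃)) (positive-copies q) (dominated⇒≺ (k₃ ⊛ k₂) (cycle 4) refl refl)))))
  where
  lem : ∀ a b c → a * b * c ≡ b * (a * c)
  lem = solve-∀
  right : σ (q K₃∪ five) ≈ σ (copies q K₃) ⊛ cycle 4
  right x = trans (σ-∪ (copies q K₃) (C 5) x)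
    (⊛-cong {σ (copies q K₃)} {σ (copies q K₃)} {σ (C 5)} {cycle 4} (λ _ → refl) (σ-cycle 2) x)
  left : σ (suc q K₃∪ two) ≈ σ (copies q K₃) ⊛ (k₃ ⊛ k₂)
  left x = begin
    eval (σ (suc q K₃∪ two)) x                                   ≡⟨ σ-K₃∪ (suc q) two x ⟩
    eval (nSeq (suc q) two) x                                    ≡⟨ eval-⊛ (k₃^ (suc q)) k₂ x ⟩
    eval (k₃ ⊛ k₃^ q) x * eval k₂ x                              ≡⟨ cong (_* eval k₂ x) (eval-⊛ k₃ (k₃^ q) x) ⟩
    eval k₃ x * eval (k₃^ q) x * eval k₂ x                       ≡⟨ lem (eval k₃ x) (eval (k₃^ q) x) (eval k₂ x) ⟩
    eval (k₃^ q) x * (eval k₃ x * eval k₂ x)                     ≡⟨ cong₂ _*_ (σ-copies q x) (eval-⊛ k₃ k₂ x) ⟨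
    eval (σ (copies q K₃)) x * eval (k₃ ⊛ k₂) x                  ≡⟨ eval-⊛ (σ (copies q K₃)) (k₃ ⊛ k₂) x ⟨
    eval (σ (copies q K₃) ⊛ (k₃ ⊛ k₂)) x                         ∎
    where open ≡-Reasoning
-- At orders 4 and 7 the form with K₁ has the larger mean, by numerical evaluation.
to-U zero          four h = ⊏⇒⊴ 0 four 1 one refl (≤ᵇ⇒≤ _ _ tt)
to-U (suc zero)    four h = ⊏⇒⊴ 1 four 2 one refl (≤ᵇ⇒≤ _ _ tt)
to-U (suc (suc q)) four h = subst ((2 + q) K₃∪ four ⊴_) (sym (U-four q)) (⊴-refl ((2 + q) K₃∪ four))
to-U q five h = subst (q K₃∪ five ⊴_) (sym (U-five q)) (⊴-refl (q K₃∪ five))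

below-U : ∀ G → 3 ≤ order G → maxDegree G ≤ 2 → G ⊴ U (order G)
below-U G n≥3 Δ≤2 with decompose G (maxDegree≤2⇒≤2-neighbours G Δ≤2)
... | cs , f with ⋃-reduces cs
...   | q , r , h = subst (λ n → G ⊴ U n) (sym order-eq) (≼-⊴-trans G≼N (to-U q r (subst (3 ≤_) order-eq n≥3)))
  where
  G≼N : G ≼ q K₃∪ r
  G≼N = ≼-trans (≅⇒≼ G (⋃ cs) f) h
  order-eq : order G ≡ order (restGraph r) + q * 3
  order-eq = trans (_≼_.same-order G≼N) (order-K₃∪ q r)

theorem18 : (G : Graph) → 3 ≤ order G → maxDegree G ≡ 2 →
    (𝓣 G * 𝓑 (U (order G)) ≤ 𝓣 (U (order G)) * 𝓑 G)
    × ((𝓣 G * 𝓑 (U (order G)) ≡ 𝓣 (U (order G)) * 𝓑 G) ⇔ (G ≅ U (order G)))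
theorem18 G n≥3 Δ≡2 with below-U G n≥3 (≤-reflexive Δ≡2)
... | order-eq ,ᵗ iso⊎below = bound iso⊎below , mk⇔ (iso iso⊎below) equality
  where
  H : Graph
  H = U (order G)
  G>0 : 0 < order G
  G>0 = ≤-trans (s≤s z≤n) n≥3
  H>0 : 0 < order H
  H>0 = subst (0 <_) order-eq G>0
  equality : G ≅ H → 𝓣 G * 𝓑 H ≡ 𝓣 H * 𝓑 G
  equality f = cong₂ _*_
    (trans (𝓣≡T G G>0) (trans (T-≈ (σ G) (σ H) (σ-≅ G H f)) (sym (𝓣≡T H H>0))))
    (trans (𝓑≡sum H H>0) (trans (sym (sum-≈ (σ G) (σ H) (σ-≅ G H f))) (sym (𝓑≡sum G G>0))))
  below : pr (σ G) ⊏ pr (σ H) → 𝓣 G * 𝓑 H < 𝓣 H * 𝓑 G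
  below = subst₂ _<_ (sym (cong₂ _*_ (𝓣≡T G G>0) (𝓑≡sum H H>0))) (sym (cong₂ _*_ (𝓣≡T H H>0) (𝓑≡sum G G>0)))
  bound : (G ≅ H) ⊎ (pr (σ G) ⊏ pr (σ H)) → 𝓣 G * 𝓑 H ≤ 𝓣 H * 𝓑 G
  bound (inj₁ f) = ≤-reflexive (equality f)
  bound (inj₂ h) = <⇒≤ (below h)
  iso : (G ≅ H) ⊎ (pr (σ G) ⊏ pr (σ H)) → 𝓣 G * 𝓑 H ≡ 𝓣 H * 𝓑 G → G ≅ H
  iso (inj₁ f) _ = f
  iso (inj₂ h) e = ⊥-elim (<⇒≢ (below h) e)
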